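{- In the Farzan–Munro model of group representation, there is a representation of finite Hamiltonian groups such that, for every finite Hamiltonian group $G$, the multiplication operation can be performed using $\mathcal{O}(1)$ space (words) in $\mathcal{O}(1)$ time. The constants in the $\mathcal{O}$-notation are absolute (independent of $G$).
   Context: A Hamiltonian group is a nonabelian group all of whose subgroups are normal. Farzan–Munro model: computation is on a random access machine in which a word is large enough to hold the value of the order $n$ of the input group (words have $\mathcal{O}(\log n)$ bits); random access and arithmetic, logic and comparison operations on words take $\mathcal{O}(1)$ time, and bit-reversal of a word is also available as a native $\mathcal{O}(1)$-time operation. A representation of a class of groups consists of the following. (i) A compression algorithm, which takes a group $G$ of the class and outputs a compressed form of $G$. (ii) A labeling, which (based on the compression) represents each element of $G$ by a label. (iii) A query processing unit, which stores the compressed form of $G$ and, given the labels of two elements $x,y\in G$, returns the label of the product $xy$. Compression and labeling are carried out by an "outside user", who also supplies the labels of the elements to be multiplied to the query processing unit; the time and space used for compression and labeling are not counted. The space of the representation is the number of words used by the query processing unit, and the query time is the worst-case time it uses to answer a multiplication query. -}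

module Defs where

open import Algebra.Bundles using (Group)
open import Algebra.Definitions using (Commutative)
open import Data.Bool.Base using (Bool; if_then_else_; not; _∧_; _∨_; _xor_)
open import Data.Fin.Base using (Fin)
open import Data.List.Base as List using (List)
open import Data.Maybe.Base using (Maybe; just; nothing; map; _>>=_)
open import Data.Nat.Base hiding (_⊔_)
open import Data.Nat.Properties using (m^n≢0)
open import Data.Product.Base using (Σ-syntax; _×_)
open import Data.Vec.Base using (Vec; []; _∷_; _++_; zipWith; reverse)
import Data.Vec.Base as Vec
open import Function.Bundles using (Inverse)
open import Level using (Level; _⊔_) renaming (suc to lsuc)
open import Relation.Binary.PropositionalEquality using (_≡_; setoid)
open import Relation.Nullary using (¬_)
open import Relation.Unary using (Pred)

module _ {c ℓ : Level} (G : Group c ℓ) where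
  open Group G

  record IsSubgroup {p : Level} (H : Pred Carrier p) : Set (c ⊔ ℓ ⊔ p) where
    field
      resp-≈    : ∀ {x y} → x ≈ y → H x → H y
      ε-closed  : H ε
      ∙-closed  : ∀ {x y} → H x → H y → H (x ∙ y)
      ⁻¹-closed : ∀ {x} → H x → H (x ⁻¹)

  IsNormal : {p : Level} → Pred Carrier p → Set (c ⊔ p)
  IsNormal H = ∀ g {x} → H x → H ((g ∙ x) ∙ g ⁻¹)

  IsHamiltonian : Set (lsuc (c ⊔ ℓ))
  IsHamiltonian =
    ¬ Commutative _≈_ _∙_ ×
    (∀ (H : Pred Carrier (c ⊔ ℓ)) → IsSubgroup H → IsNormal H)

record FiniteGroup (c ℓ : Level) : Set (lsuc (c ⊔ ℓ)) where
  field
    group       : Group c ℓ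
    order       : ℕ
    enumeration : Inverse (Group.setoid group) (setoid (Fin order))
  open Group group public

Hamiltonian : ∀ {c ℓ} → FiniteGroup c ℓ → Set (lsuc (c ⊔ ℓ))
Hamiltonian G = IsHamiltonian (FiniteGroup.group G)

-- The least significant bit comes first.
Word : ℕ → Set
Word w = Vec Bool w

value : ∀ {w} → Word w → ℕ
value []       = 0
value (b ∷ bs) = (if b then 1 else 0) + 2 * value bs

-- The word of value n mod 2 ^ w.
fromℕ : ∀ {w} → ℕ → Word w
fromℕ {zero}  n = []
fromℕ {suc w} n = (n % 2 ≡ᵇ 1) ∷ fromℕ (n / 2)

data UnaryOp : Set where
  copy complement bit-reverse : UnaryOp

data BinaryOp : Set where
  add sub mul div mod  : BinaryOp
  and or xor shl shr   : BinaryOp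
  less-than equal      : BinaryOp

unary : ∀ {w} → UnaryOp → Word w → Word w
unary copy        x = x
unary complement  x = Vec.map not x
unary bit-reverse x = reverse x

-- By convention, quotient and remainder by zero are 0.
_quot_ : ℕ → ℕ → ℕ
m quot zero    = 0
m quot (suc n) = m / suc n

_rem_ : ℕ → ℕ → ℕ
m rem zero    = 0
m rem (suc n) = m % suc n

binary : ∀ {w} → BinaryOp → Word w → Word w → Word w
binary     add       x y = fromℕ (value x + value y)
binary {w} sub       x y = fromℕ ((value x + 2 ^ w) ∸ value y)
binary     mul       x y = fromℕ (value x * value y)
binary     div       x y = fromℕ (value x quot value y)
binary     mod       x y = fromℕ (value x rem value y)
binary     and       x y = zipWith _∧_ x y
binary     or        x y = zipWith _∨_ x y
binary     xor       x y = zipWith _xor_ x y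
binary     shl       x y = fromℕ (value x * 2 ^ value y)
binary     shr       x y = fromℕ ((value x / 2 ^ value y) {{m^n≢0 2 (value y)}})
binary     less-than x y = fromℕ (if value x <ᵇ value y then 1 else 0)
binary     equal     x y = fromℕ (if value x ≡ᵇ value y then 1 else 0)

-- A program is a fixed finite list, so its cell addresses, literals and
-- jump targets are plain numbers that do not depend on the word size.
data Instruction : Set where
  literal   : (dst n : ℕ) → Instruction
  unaryOp   : UnaryOp → (dst src : ℕ) → Instruction
  binaryOp  : BinaryOp → (dst src₁ src₂ : ℕ) → Instruction
  load      : (dst ptr : ℕ) → Instruction
  store     : (ptr src : ℕ) → Instruction
  jump-if   : (src target : ℕ) → Instruction
  halt      : Instruction

Program : Set
Program = List Instruction

-- The machine has exactly s cells; any access beyond them is an error, so s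
-- bounds the number of words used by a run that succeeds.
Memory : ℕ → ℕ → Set
Memory w s = Vec (Word w) s

peek : ∀ {a} {A : Set a} {s} → Vec A s → ℕ → Maybe A
peek []       _       = nothing
peek (x ∷ xs) zero    = just x
peek (x ∷ xs) (suc i) = peek xs i

poke : ∀ {a} {A : Set a} {s} → Vec A s → ℕ → A → Maybe (Vec A s)
poke []       _       y = nothing
poke (x ∷ xs) zero    y = just (y ∷ xs)
poke (x ∷ xs) (suc i) y = map (x ∷_) (poke xs i y)

-- run p t k m executes p from instruction number k and memory m.  It is the
-- final memory if p halts after at most t instructions (the halt included).
run : ∀ {w s} → Program → ℕ → ℕ → Memory w s → Maybe (Memory w s)

execute : ∀ {w s} → Program → ℕ → ℕ → Memory w s → Instruction →
          Maybe (Memory w s)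

run p zero    k m = nothing
run p (suc t) k m = List.head (List.drop k p) >>= execute p t k m

execute p t k m (literal dst n) =
  poke m dst (fromℕ n) >>= run p t (suc k)
execute p t k m (unaryOp o dst src) =
  peek m src >>= λ x →
  poke m dst (unary o x) >>= run p t (suc k)
execute p t k m (binaryOp o dst src₁ src₂) =
  peek m src₁ >>= λ x →
  peek m src₂ >>= λ y →
  poke m dst (binary o x y) >>= run p t (suc k)
execute p t k m (load dst ptr) =
  peek m ptr >>= λ a →
  peek m (value a) >>= λ x →
  poke m dst x >>= run p t (suc k)
execute p t k m (store ptr src) =
  peek m ptr >>= λ a →
  peek m src >>= λ x →
  poke m (value a) x >>= run p t (suc k)
execute p t k m (jump-if src target) =
  peek m src >>= λ x →
  run p t (if value x ≡ᵇ 0 then suc k else target) m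
execute p t k m halt = just m

-- A group of the class together with a word size at which a word can hold
-- the value of its order.
record Input {c ℓ q} (𝒞 : FiniteGroup c ℓ → Set q) :
             Set (lsuc (c ⊔ ℓ) ⊔ q) where
  field
    finiteGroup : FiniteGroup c ℓ
    member      : 𝒞 finiteGroup
    w           : ℕ
    order<2^w   : FiniteGroup.order finiteGroup < 2 ^ w
  open FiniteGroup finiteGroup public

record Representation {c ℓ q} (𝒞 : FiniteGroup c ℓ → Set q) :
                      Set (lsuc (c ⊔ ℓ) ⊔ q) where
  open Input

  field
    -- One program serves all groups and all word sizes.
    query : Program

    formLength labelLength workLength : Input 𝒞 → ℕ

    compress : ∀ I → Vec (Word (w I)) (formLength I)

    label           : ∀ I → Carrier I → Vec (Word (w I)) (labelLength I)
    label-cong      : ∀ I {x y} → _≈_ I x y → label I x ≡ label I y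
    label-injective : ∀ I {x y} → label I x ≡ label I y → _≈_ I x y

  space : Input 𝒞 → ℕ
  space I = labelLength I + (labelLength I + (formLength I + workLength I))

  field
    -- An upper bound on the number of instructions executed for a query.
    time : Input 𝒞 → ℕ

    -- The working cells start with arbitrary contents and the compressed form
    -- is intact at the end, so queries can be answered one after another.
    correct : ∀ I x y (work : Vec (Word (w I)) (workLength I)) →
      Σ[ rest ∈ Vec (Word (w I)) (labelLength I) ]
      Σ[ work′ ∈ Vec (Word (w I)) (workLength I) ]
        run query (time I) 0
            (label I x ++ (label I y ++ (compress I ++ work)))
        ≡ just (label I (_∙_ I x y) ++ (rest ++ (compress I ++ work′)))

{-# OPTIONS --safe #-}
-- In a group all of whose subgroups are normal, [ a , b ] lies in ⟨ a ⟩ ∩ ⟨ b ⟩.  From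
-- every noncommuting pair this yields an element whose square is a commutator of order 2,
-- and then x and y with x² = y² = [ y , x ] = z of order 2, a quaternion group.  Their centralizer C has no element of order 4, hence is
-- abelian, and every element is uniquely xⁱ yʲ c with i, j ∈ {0, 1} and c ∈ C.  So a
-- product is computed by bitwise operations on i and j and at most two additions in C.
--
-- C is a product of cyclic groups of orders d with ∏ d ≤ |C| ≤ n / 2.  Residues modulo
-- all d, each in a field with one spare bit, fill at most 2w bits, which fit into three
-- words of w bits: the fields before the one crossing the first word boundary, that one,
-- and the fields after it.  All residues in a word are added at once; reducing them needs
-- the overflow bit of each field to be spread downwards over the field, and in the
-- bit-reversed word a carry does this.
module Submission where

open import Defs
open import Level using (Level)
open import Data.Nat.Base using (ℕ; _≤_)
open import Data.Product.Base using (Σ-syntax; _×_)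

open import Algebra.Bundles using (AbelianGroup; Group)
open import Algebra.Bundles.Raw using (RawGroup)
import Algebra.Morphism.GroupMonomorphism as GroupMonomorphism
import Algebra.Properties.AbelianGroup as AbelianGroupProperties
import Algebra.Properties.CommutativeMonoid.Mult as CommutativeMult
import Algebra.Properties.CommutativeSemigroup as CommutativeSemigroupProperties
import Algebra.Properties.Group as GroupProperties
import Algebra.Properties.Monoid.Mult as MonoidMult
import Algebra.Solver.Monoid as MonoidSolver
open import Algebra.Structures using (IsAbelianGroup; IsGroup)
open import Data.Bool.Base using (Bool; true; false; if_then_else_; _∧_; _∨_) renaming (_xor_ to _⊻_)
open import Data.Bool.Properties using (∧-identityʳ; ∧-zeroʳ; ∨-identityˡ; ∨-identityʳ; xor-identityʳ)
  renaming (_≟_ to _≟ᵇ_)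
open import Data.Fin.Base as Fin using (Fin; fromℕ<; remQuot; toℕ)
import Data.Fin.Properties as Fin
open import Data.Fin.Patterns using (0F; 1F; 2F; 3F; 4F)
open import Data.List.Base as List using (List; []; _∷_)
import Data.List.Properties as List
open import Data.List.Relation.Unary.All as All using (All; []; _∷_)
import Data.List.Relation.Unary.All.Properties as All
open import Data.Maybe.Base using (just)
open import Data.Nat.Base
open import Data.Nat.Coprimality using (Coprime; coprime-divisor; gcd≡1⇒coprime) renaming (sym to coprime-sym)
open import Data.Nat.DivMod using ([m+kn]%n≡m%n; +-distrib-/-∣ʳ; m%n<n; m*n/n≡m; m<n*o⇒m/o<n; m≡m%n+[m/n]*n)
open import Data.Nat.Divisibility
open import Data.Nat.GCD using (gcd; gcd[m,n]∣m; gcd[m,n]∣n)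
open import Data.Nat.Induction using (<-wellFounded)
open import Data.Nat.ListAction using (product; sum)
open import Data.Nat.ListAction.Properties using (sum-++)
open import Data.Nat.Primality
open import Data.Nat.Primality.Factorisation using (factorise)
open import Data.Nat.Properties
open CommutativeSemigroupProperties +-commutativeSemigroup using (xy∙z≈xz∙y)
open import Data.Nat.Tactic.RingSolver using (solve-∀)
open import Data.Product.Base using (∃-syntax; _,_; proj₁; proj₂)
open import Data.Sum.Base using (_⊎_; inj₁; inj₂)
open import Data.Unit.Base using (⊤; tt)
open import Data.Vec.Base as Vec using (Vec; []; _∷_; _++_; _∷ʳ_; lookup; replicate; reverse; zipWith)
open import Data.Vec.Properties using (++-injective; reverse-∷; reverse-involutive; reverse-reverse; zipWith-++;
  zipWith-identityˡ; zipWith-identityʳ; zipWith-replicate; zipWith-zeroʳ; ∷-injective)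
open import Function.Bundles using (Inverse)
open import Function.Definitions using (Injective)
open import Induction.WellFounded using (Acc; acc)
open import Level using (Lift; lift) renaming (_⊔_ to _⊔ˡ_)
open import Relation.Binary.PropositionalEquality
open import Relation.Nullary using (¬_; Dec; yes; no; contradiction)
open import Relation.Nullary.Decidable using (_×-dec_; decidable-stable)

-- Words and packed addition

-- The prime 2 is singled out by `(a^k b)^t = c^(k t(t-1)/2) a^(kt) b^t`, valid for a commutator `c`
-- that commutes with `a` and `b`. One can shift `b` by a power of `a` until its `t`-th power is a
-- power of `c` alone. This power must be nontrivial, and as the prime order of `c` divides `t`,
-- only 2 is compatible with the factor t(t-1)/2. All elements constructed stay in a given set
-- closed under products; inside the centralizer the same construction would give an element of
-- order 4, and this is why the centralizer is abelian.
--
-- The 2w bits come from squaring: a modulus `d` with `2^l < d ≤ 2^(l+1)` takes `l + 2` bits, and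
-- `2^(l+2) ≤ d^2`, with equality for `d = 2`. The fields have different widths, so no common shift
-- spreads all the overflow bits, whereas a carry adapts to the width of each field.

bit : Bool → ℕ
bit b = if b then 1 else 0

value<2^ : ∀ {w} (x : Word w) → value x < 2 ^ w
value<2^ []              = s≤s z≤n
value<2^ {suc w} (b ∷ x) = begin-strict
  bit b + 2 * value x ≤⟨ +-monoˡ-≤ _ (bit≤1 b) ⟩
  1 + 2 * value x     <⟨ n<1+n _ ⟩
  2 + 2 * value x     ≡⟨ *-suc 2 (value x) ⟨
  2 * suc (value x)   ≤⟨ *-monoʳ-≤ 2 (value<2^ x) ⟩
  2 * 2 ^ w           ∎
  where
  open ≤-Reasoning
  bit≤1 : ∀ b → bit b ≤ 1
  bit≤1 false = z≤n
  bit≤1 true  = s≤s z≤n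

fromℕ-value : ∀ {w} (x : Word w) → fromℕ (value x) ≡ x
fromℕ-value []      = refl
fromℕ-value (b ∷ x) = cong₂ _∷_ (low b) (trans (cong fromℕ (high b)) (fromℕ-value x))
  where
  low : ∀ b → ((bit b + 2 * value x) % 2 ≡ᵇ 1) ≡ b
  low b = trans (cong (_≡ᵇ 1) (trans (cong (λ n → (bit b + n) % 2) (*-comm 2 (value x)))
                                     ([m+kn]%n≡m%n (bit b) (value x) 2))) (bit%2 b)
    where
    bit%2 : ∀ b → (bit b % 2 ≡ᵇ 1) ≡ b
    bit%2 false = refl
    bit%2 true  = refl
  high : ∀ b → (bit b + 2 * value x) / 2 ≡ value x
  high b = trans (+-distrib-/-∣ʳ (bit b) {d = 2} (m∣m*n (value x)))
                 (cong₂ _+_ (bit/2 b) (trans (cong (_/ 2) (*-comm 2 (value x))) (m*n/n≡m (value x) 2)))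
    where
    bit/2 : ∀ b → bit b / 2 ≡ 0
    bit/2 false = refl
    bit/2 true  = refl

value-fromℕ : ∀ w {n} → n < 2 ^ w → value (fromℕ {w} n) ≡ n
value-fromℕ zero    {zero}  _         = refl
value-fromℕ zero    {suc n} (s≤s ())
value-fromℕ (suc w) {n}     n<        = begin
  bit (n % 2 ≡ᵇ 1) + 2 * value (fromℕ {w} (n / 2))
    ≡⟨ cong₂ _+_ (low (n % 2) (m%n<n n 2)) (cong (2 *_) (value-fromℕ w half<)) ⟩
  n % 2 + 2 * (n / 2)  ≡⟨ cong (n % 2 +_) (*-comm 2 (n / 2)) ⟩
  n % 2 + n / 2 * 2    ≡⟨ m≡m%n+[m/n]*n n 2 ⟨
  n                    ∎
  where
  open ≡-Reasoning
  low : ∀ r → r < 2 → bit (r ≡ᵇ 1) ≡ r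
  low zero          _               = refl
  low (suc zero)    _               = refl
  low (suc (suc _)) (s≤s (s≤s ()))
  half< : n / 2 < 2 ^ w
  half< = m<n*o⇒m/o<n (subst (n <_) (*-comm 2 (2 ^ w)) n<)

value-++ : ∀ {v w} (x : Word v) (y : Word w) → value (x ++ y) ≡ value x + 2 ^ v * value y
value-++         []      y = sym (+-identityʳ (value y))
value-++ {suc v} (b ∷ x) y rewrite value-++ x y = shuffle (bit b) (value x) (2 ^ v) (value y)
  where
  shuffle : ∀ b x p y → b + 2 * (x + p * y) ≡ b + 2 * x + 2 * p * y
  shuffle = solve-∀

value-∷ʳ : ∀ {w} (x : Word w) b → value (x ∷ʳ b) ≡ value x + 2 ^ w * bit b
value-∷ʳ         []      b = refl
value-∷ʳ {suc w} (a ∷ x) b rewrite value-∷ʳ x b = shuffle (bit a) (value x) (2 ^ w) (bit b)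
  where
  shuffle : ∀ a x p y → a + 2 * (x + p * y) ≡ a + 2 * x + 2 * p * y
  shuffle = solve-∀

-- Reversal puts the highest bit at the units place, so carries in `valueʳ` run towards the low bits
-- of the word.
valueʳ : ∀ {w} → Word w → ℕ
valueʳ x = value (reverse x)

valueʳ-∷ : ∀ {w} b (x : Word w) → valueʳ (b ∷ x) ≡ valueʳ x + 2 ^ w * bit b
valueʳ-∷ b x = trans (cong value (reverse-∷ b x)) (value-∷ʳ (reverse x) b)

valueʳ-++ : ∀ {v w} (x : Word v) (y : Word w) → valueʳ (x ++ y) ≡ 2 ^ w * valueʳ x + valueʳ y
valueʳ-++         {w = w} []      y = cong (_+ valueʳ y) (sym (*-zeroʳ (2 ^ w)))
valueʳ-++ {suc v} {w}     (b ∷ x) y = begin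
  valueʳ (b ∷ x ++ y)                              ≡⟨ valueʳ-∷ b (x ++ y) ⟩
  valueʳ (x ++ y) + 2 ^ (v + w) * bit b
    ≡⟨ cong₂ (λ s p → s + p * bit b) (valueʳ-++ x y) (^-distribˡ-+-* 2 v w) ⟩
  2 ^ w * valueʳ x + valueʳ y + 2 ^ v * 2 ^ w * bit b
    ≡⟨ shuffle (2 ^ w) (valueʳ x) (valueʳ y) (2 ^ v) (bit b) ⟩
  2 ^ w * (valueʳ x + 2 ^ v * bit b) + valueʳ y    ≡⟨ cong (λ s → 2 ^ w * s + valueʳ y) (valueʳ-∷ b x) ⟨
  2 ^ w * valueʳ (b ∷ x) + valueʳ y                ∎
  where
  open ≡-Reasoning
  shuffle : ∀ p x y q b → p * x + y + q * p * b ≡ p * (x + q * b) + y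
  shuffle = solve-∀

zeros ones : ∀ {w} → Word w
zeros = replicate _ false
ones  = replicate _ true

value-zeros : ∀ w → value (zeros {w}) ≡ 0
value-zeros zero    = refl
value-zeros (suc w) rewrite value-zeros w = refl

valueʳ-zeros : ∀ w → valueʳ (zeros {w}) ≡ 0
valueʳ-zeros zero    = refl
valueʳ-zeros (suc w) = begin
  valueʳ (zeros {suc w})       ≡⟨ valueʳ-∷ false (zeros {w}) ⟩
  valueʳ (zeros {w}) + 2 ^ w * 0 ≡⟨ cong₂ _+_ (valueʳ-zeros w) (*-zeroʳ (2 ^ w)) ⟩
  0 ∎
  where open ≡-Reasoning

suc-valueʳ-ones : ∀ w → suc (valueʳ (ones {w})) ≡ 2 ^ w
suc-valueʳ-ones zero    = refl
suc-valueʳ-ones (suc w) = begin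
  suc (valueʳ (ones {suc w}))          ≡⟨ cong suc (valueʳ-∷ true (ones {w})) ⟩
  suc (valueʳ (ones {w})) + 2 ^ w * 1  ≡⟨ cong (_+ 2 ^ w * 1) (suc-valueʳ-ones w) ⟩
  2 ^ w + 2 ^ w * 1                    ≡⟨ cong (2 ^ w +_) (*-comm (2 ^ w) 1) ⟩
  2 * 2 ^ w                            ∎
  where open ≡-Reasoning

record Constants (w : ℕ) : Set where
  constructor constants
  field
    gap top spread keep : Word w

open Constants

_⊹_ : ∀ {v w} → Constants v → Constants w → Constants (v + w)
constants k t s e ⊹ constants k′ t′ s′ e′ = constants (k ++ k′) (t ++ t′) (s ++ s′) (e ++ e′)

-- `u` is the biased sum `x + y + gap`. In a field whose top bit is set, removing that bit leaves
-- the sum minus the modulus; in any other field the gap has to be taken back. The mask `v` xor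
-- `keep` is zero on the field in the former case and all ones in the latter.
correction : ∀ {w} → Constants w → (u v : Word w) → Word w
correction c u v =
  zipWith _∨_ (zipWith _∧_ u (top c)) (zipWith _∧_ (gap c) (zipWith _⊻_ v (keep c)))

packedAdd : ∀ {w} → Constants w → (x y : Word w) → Word w
packedAdd c x y = binary sub u (correction c u v)
  where
  u = binary add (binary add x y) (gap c)
  v = reverse (binary add (reverse (zipWith _∧_ u (top c))) (reverse (spread c)))

-- The intermediate results of packedAdd, none of which overflows, described by
-- equations that are compatible with concatenation.
record Adds {w} (c : Constants w) (x y r : Word w) : Set where
  field
    u v     : Word w
    total     : value x + value y + value (gap c) ≡ value u
    carries : valueʳ (zipWith _∧_ u (top c)) + valueʳ (spread c) ≡ valueʳ v
    result  : value r + value (correction c u v) ≡ value u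

add-value : ∀ {w} (x y z : Word w) → value x + value y ≡ value z → binary add x y ≡ z
add-value x y z eq = trans (cong fromℕ eq) (fromℕ-value z)

-- Disposes of the `2 ^ w` that `sub` adds before its truncated subtraction.
fromℕ-mod : ∀ w n → fromℕ {w} (n + 2 ^ w) ≡ fromℕ n
fromℕ-mod zero    n = refl
fromℕ-mod (suc w) n = cong₂ _∷_ low (trans (cong fromℕ high) (fromℕ-mod w (n / 2)))
  where
  low : ((n + 2 * 2 ^ w) % 2 ≡ᵇ 1) ≡ (n % 2 ≡ᵇ 1)
  low = cong (_≡ᵇ 1) (trans (cong (λ m → (n + m) % 2) (*-comm 2 (2 ^ w))) ([m+kn]%n≡m%n n (2 ^ w) 2))
  high : (n + 2 * 2 ^ w) / 2 ≡ n / 2 + 2 ^ w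
  high = trans (+-distrib-/-∣ʳ n {d = 2} (m∣m*n (2 ^ w)))
               (cong (n / 2 +_) (trans (cong (_/ 2) (*-comm 2 (2 ^ w))) (m*n/n≡m (2 ^ w) 2)))

sub-value : ∀ {w} (x y z : Word w) → value z + value y ≡ value x → binary sub x y ≡ z
sub-value {w} x y z eq = begin
  fromℕ ((value x + 2 ^ w) ∸ value y)               ≡⟨ cong (λ m → fromℕ ((m + 2 ^ w) ∸ value y)) eq ⟨
  fromℕ ((value z + value y + 2 ^ w) ∸ value y)
    ≡⟨ cong (λ m → fromℕ (m ∸ value y)) (xy∙z≈xz∙y (value z) (value y) (2 ^ w)) ⟩
  fromℕ ((value z + 2 ^ w + value y) ∸ value y)     ≡⟨ cong fromℕ (m+n∸n≡m (value z + 2 ^ w) (value y)) ⟩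
  fromℕ (value z + 2 ^ w)                           ≡⟨ fromℕ-mod w (value z) ⟩
  fromℕ (value z)                                   ≡⟨ fromℕ-value z ⟩
  z                                                 ∎
  where open ≡-Reasoning

packedAdd-correct : ∀ {w} {c : Constants w} {x y r} → Adds c x y r → packedAdd c x y ≡ r
packedAdd-correct {w} {c} {x} {y} {r} a = begin
  finish (binary add (binary add x y) (gap c)) ≡⟨ cong finish u≡ ⟩
  finish u                                     ≡⟨ cong (λ v′ → binary sub u (correction c u v′)) v≡ ⟩
  binary sub u (correction c u v)              ≡⟨ sub-value u (correction c u v) r result ⟩
  r                                            ∎
  where
  open ≡-Reasoning
  open Adds a
  finish : Word w → Word w
  finish u′ = binary sub u′ (correction c u′
    (reverse (binary add (reverse (zipWith _∧_ u′ (top c))) (reverse (spread c)))))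
  u≡ : binary add (binary add x y) (gap c) ≡ u
  u≡ = begin
    fromℕ (value (fromℕ {w} (value x + value y)) + value (gap c))
      ≡⟨ cong (λ m → fromℕ (m + value (gap c))) (value-fromℕ w x+y<) ⟩
    fromℕ (value x + value y + value (gap c)) ≡⟨ cong fromℕ total ⟩
    fromℕ (value u)                           ≡⟨ fromℕ-value u ⟩
    u                                         ∎
    where
    x+y< : value x + value y < 2 ^ w
    x+y< = ≤-<-trans (m≤m+n _ (value (gap c))) (subst (_< 2 ^ w) (sym total) (value<2^ u))
  v≡ : reverse (binary add (reverse (zipWith _∧_ u (top c))) (reverse (spread c))) ≡ v
  v≡ = trans (cong reverse (add-value (reverse (zipWith _∧_ u (top c))) (reverse (spread c)) (reverse v) carries))
             (reverse-involutive v)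

correction-++ : ∀ {v w} (c : Constants v) (c′ : Constants w) u₁ v₁ u₂ v₂ →
  correction (c ⊹ c′) (u₁ ++ u₂) (v₁ ++ v₂) ≡ correction c u₁ v₁ ++ correction c′ u₂ v₂
correction-++ (constants k t s e) (constants k′ t′ s′ e′) u₁ v₁ u₂ v₂
  rewrite zipWith-++ _⊻_ v₁ v₂ e e′ | zipWith-++ _∧_ u₁ u₂ t t′
        | zipWith-++ _∧_ k k′ (zipWith _⊻_ v₁ e) (zipWith _⊻_ v₂ e′) =
  zipWith-++ _∨_ (zipWith _∧_ u₁ t) (zipWith _∧_ u₂ t′)
                 (zipWith _∧_ k (zipWith _⊻_ v₁ e)) (zipWith _∧_ k′ (zipWith _⊻_ v₂ e′))

Adds-++ : ∀ {v w} {c : Constants v} {c′ : Constants w} {x y r x′ y′ r′} →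
  Adds c x y r → Adds c′ x′ y′ r′ → Adds (c ⊹ c′) (x ++ x′) (y ++ y′) (r ++ r′)
Adds-++ {v} {w} {c@(constants k t s e)} {c′@(constants k′ t′ s′ e′)} {x} {y} {r} {x′} {y′} {r′} a a′ = record
  { u       = A.u ++ A′.u
  ; v       = A.v ++ A′.v
  ; total     = total
  ; carries = carries
  ; result  = result
  }
  where
  module A  = Adds a
  module A′ = Adds a′
  open ≡-Reasoning
  gather₃ : ∀ p a b c d e f → a + p * d + (b + p * e) + (c + p * f) ≡ a + b + c + p * (d + e + f)
  gather₃ = solve-∀
  gather₂ : ∀ p a b c d → a + p * c + (b + p * d) ≡ a + b + p * (c + d)
  gather₂ = solve-∀
  gatherʳ : ∀ p a b c d → p * a + c + (p * b + d) ≡ p * (a + b) + (c + d)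
  gatherʳ = solve-∀
  total : value (x ++ x′) + value (y ++ y′) + value (k ++ k′) ≡ value (A.u ++ A′.u)
  total rewrite value-++ x x′ | value-++ y y′ | value-++ k k′ | value-++ A.u A′.u | sym A.total | sym A′.total =
    gather₃ (2 ^ v) (value x) (value y) (value k) (value x′) (value y′) (value k′)
  carries : valueʳ (zipWith _∧_ (A.u ++ A′.u) (t ++ t′)) + valueʳ (s ++ s′) ≡ valueʳ (A.v ++ A′.v)
  carries rewrite zipWith-++ _∧_ A.u A′.u t t′ | valueʳ-++ (zipWith _∧_ A.u t) (zipWith _∧_ A′.u t′)
                | valueʳ-++ s s′ | valueʳ-++ A.v A′.v | sym A.carries | sym A′.carries =
    gatherʳ (2 ^ w) (valueʳ (zipWith _∧_ A.u t)) (valueʳ s) (valueʳ (zipWith _∧_ A′.u t′)) (valueʳ s′)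
  result : value (r ++ r′) + value (correction (c ⊹ c′) (A.u ++ A′.u) (A.v ++ A′.v)) ≡ value (A.u ++ A′.u)
  result rewrite correction-++ c c′ A.u A.v A′.u A′.v | value-++ r r′
               | value-++ (correction c A.u A.v) (correction c′ A′.u A′.v)
               | value-++ A.u A′.u | sym A.result | sym A′.result =
    gather₂ (2 ^ v) (value r) (value (correction c A.u A.v)) (value r′) (value (correction c′ A′.u A′.v))

zipWith-zeros : ∀ {w} (f : Bool → Bool → Bool) → f false false ≡ false → zipWith f (zeros {w}) zeros ≡ zeros
zipWith-zeros {zero}  f eq = refl
zipWith-zeros {suc w} f eq = cong₂ _∷_ eq (zipWith-zeros f eq)

-- Fills a word up beyond its last field.
padding : ∀ {w} → Constants w
padding = constants zeros zeros zeros zeros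

Adds-padding : ∀ {w} → Adds {w} padding zeros zeros zeros
Adds-padding {w} = record
  { u       = zeros
  ; v       = zeros
  ; total     = trans (cong₂ _+_ (cong₂ _+_ zero≡ zero≡) zero≡) (sym zero≡)
  ; carries = trans (cong₂ _+_ (trans (cong valueʳ (zipWith-zeros {w} _∧_ refl)) (valueʳ-zeros w)) (valueʳ-zeros w))
                    (sym (valueʳ-zeros w))
  ; result  = trans (cong₂ _+_ zero≡ (trans (cong value no-correction) zero≡)) (sym zero≡)
  }
  where
  zero≡ : value (zeros {w}) ≡ 0
  zero≡ = value-zeros w
  no-correction : correction {w} padding zeros zeros ≡ zeros
  no-correction rewrite zipWith-zeros {w} _⊻_ refl | zipWith-zeros {w} _∧_ refl = zipWith-zeros _∨_ refl

-- Addition modulo `d` of residues, where at most one `d` has to be removed; the two cases are the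
-- two values of the overflow bit.
AddsMod : ℕ → ℕ → ℕ → ℕ → Set
AddsMod d a b c = a + b ≡ c ⊎ a + b ≡ c + d

zipWith-∷ʳ : ∀ {w} (f : Bool → Bool → Bool) (x y : Word w) a b → zipWith f (x ∷ʳ a) (y ∷ʳ b) ≡ zipWith f x y ∷ʳ f a b
zipWith-∷ʳ f []      []      a b = refl
zipWith-∷ʳ f (_ ∷ x) (_ ∷ y) a b = cong (_ ∷_) (zipWith-∷ʳ f x y a b)

valueʳ-∷ʳ : ∀ {w} (x : Word w) b → valueʳ (x ∷ʳ b) ≡ bit b + 2 * valueʳ x
valueʳ-∷ʳ x b = cong value {y = b ∷ reverse x}
  (reverse-reverse (trans (reverse-∷ b (reverse x)) (cong (_∷ʳ b) (reverse-involutive x))))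

digit : ∀ l → ℕ → Word (suc l)
digit l a = fromℕ {l} a ∷ʳ false

-- A residue below d ≤ 2 ^ suc l occupies a field of suc l bits and a top bit.  Adding
-- the gap 2 ^ suc l ∸ d to a sum of two residues sets the top bit exactly if the
-- sum is at least d.  In the bit-reversed field the top bit is the lowest one, and
-- adding it to 01…1 makes it cross the whole field.
fieldConstants : (d l : ℕ) → Constants (suc (suc l))
fieldConstants d l =
  constants (digit (suc l) (2 ^ suc l ∸ d)) (zeros ∷ʳ true) ((false ∷ ones) ∷ʳ true) ((true ∷ zeros) ∷ʳ false)

value-digit : ∀ l {a} → a < 2 ^ l → value (digit l a) ≡ a
value-digit l {a} a< = begin
  value (fromℕ {l} a ∷ʳ false)        ≡⟨ value-∷ʳ (fromℕ {l} a) false ⟩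
  value (fromℕ {l} a) + 2 ^ l * 0     ≡⟨ cong₂ _+_ (value-fromℕ l a<) (*-zeroʳ (2 ^ l)) ⟩
  a + 0                               ≡⟨ +-identityʳ a ⟩
  a                                   ∎
  where open ≡-Reasoning

Adds-field : ∀ {d l a b c} → 0 < d → d ≤ 2 ^ suc l → a < d → b < d → c < d → AddsMod d a b c →
  Adds (fieldConstants d l) (digit (suc l) a) (digit (suc l) b) (digit (suc l) c)
Adds-field {d} {l} {a} {b} {c} 0<d d≤ a<d b<d c<d = adds
  where
  open ≡-Reasoning
  L = suc l
  k = fieldConstants d l
  k< : 2 ^ L ∸ d < 2 ^ L
  k< = ∸-monoʳ-< 0<d d≤
  gap≡ : value (gap k) ≡ 2 ^ L ∸ d
  gap≡ = value-digit L k<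
  dig : ∀ {e} → e < d → value (digit L e) ≡ e
  dig e<d = value-digit L (<-≤-trans e<d d≤)
  lhs≡ : value (digit L a) + value (digit L b) + value (gap k) ≡ a + b + (2 ^ L ∸ d)
  lhs≡ = cong₂ _+_ (cong₂ _+_ (dig a<d) (dig b<d)) gap≡
  adds : AddsMod d a b c → Adds k (digit L a) (digit L b) (digit L c)
  -- The top bit of `u` is clear, so nothing is added to `spread`, and `spread` xor `keep` is all
  -- ones.
  adds (inj₁ a+b≡c) = record
    { u       = u
    ; v       = spread k
    ; total     = trans lhs≡ (trans (cong (_+ (2 ^ L ∸ d)) a+b≡c) (sym u≡))
    ; carries = cong (_+ valueʳ (spread k)) (trans (cong valueʳ no-carry) (valueʳ-zeros (suc L)))
    ; result  = trans (cong₂ _+_ (dig c<d) (trans (cong value corr≡) gap≡)) (sym u≡)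
    }
    where
    u = digit L (c + (2 ^ L ∸ d))
    u≡ : value u ≡ c + (2 ^ L ∸ d)
    u≡ = value-digit L (subst (c + (2 ^ L ∸ d) <_) (m+[n∸m]≡n d≤) (+-monoˡ-< (2 ^ L ∸ d) c<d))
    zeros-∷ʳ : ∀ w → zeros {w} ∷ʳ false ≡ zeros {suc w}
    zeros-∷ʳ zero    = refl
    zeros-∷ʳ (suc w) = cong (false ∷_) (zeros-∷ʳ w)
    ones-∷ʳ : ∀ w → ones {w} ∷ʳ true ≡ ones {suc w}
    ones-∷ʳ zero    = refl
    ones-∷ʳ (suc w) = cong (true ∷_) (ones-∷ʳ w)
    no-carry : zipWith _∧_ u (top k) ≡ zeros
    no-carry = trans (zipWith-∷ʳ _∧_ (fromℕ {L} (c + (2 ^ L ∸ d))) zeros false true)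
      (trans (cong (_∷ʳ false) (zipWith-zeroʳ ∧-zeroʳ (fromℕ {L} (c + (2 ^ L ∸ d))))) (zeros-∷ʳ L))
    keep≡ : zipWith _⊻_ (spread k) (keep k) ≡ ones
    keep≡ = trans (zipWith-∷ʳ _⊻_ (false ∷ ones {l}) (true ∷ zeros) true false)
      (cong (true ∷_) (trans (cong (_∷ʳ true) (zipWith-identityʳ xor-identityʳ (ones {l}))) (ones-∷ʳ l)))
    corr≡ : correction k u (spread k) ≡ gap k
    corr≡ = trans (cong₂ (zipWith _∨_) no-carry
                         (trans (cong (zipWith _∧_ (gap k)) keep≡) (zipWith-identityʳ ∧-identityʳ (gap k))))
                  (zipWith-identityˡ ∨-identityˡ (gap k))
  -- Read in reverse, the top bit is 1, `spread` is `2 ^ suc l ∸ 1` and `keep` is `2 ^ suc l`; the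
  -- carry stops inside the field.
  adds (inj₂ a+b≡c+d) = record
    { u       = u
    ; v       = keep k
    ; total     = begin
        value (digit L a) + value (digit L b) + value (gap k) ≡⟨ lhs≡ ⟩
        a + b + (2 ^ L ∸ d)    ≡⟨ cong (_+ (2 ^ L ∸ d)) a+b≡c+d ⟩
        c + d + (2 ^ L ∸ d)    ≡⟨ +-assoc c d (2 ^ L ∸ d) ⟩
        c + (d + (2 ^ L ∸ d))  ≡⟨ cong (c +_) (m+[n∸m]≡n d≤) ⟩
        c + 2 ^ L              ≡⟨ u≡ ⟨
        value u                ∎
    ; carries = begin
        valueʳ (zipWith _∧_ u (top k)) + valueʳ (spread k)
          ≡⟨ cong₂ _+_ (trans (cong valueʳ carry)
                              (trans (valueʳ-∷ʳ (zeros {L}) true) (cong (λ m → 1 + 2 * m) (valueʳ-zeros L))))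
                       (trans (valueʳ-∷ʳ (false ∷ ones {l}) true)
                              (cong (λ m → 1 + 2 * m)
                                (trans (valueʳ-∷ false (ones {l})) (cong (valueʳ (ones {l}) +_) (*-zeroʳ (2 ^ l)))))) ⟩
        1 + (1 + 2 * (valueʳ (ones {l}) + 0)) ≡⟨ shuffle (valueʳ (ones {l})) ⟩
        2 * suc (valueʳ (ones {l}))     ≡⟨ cong (2 *_) (suc-valueʳ-ones l) ⟩
        2 * 2 ^ l                       ≡⟨ cong (2 *_) (*-identityʳ (2 ^ l)) ⟨
        2 * (0 + 2 ^ l * 1)             ≡⟨ cong (λ m → 2 * (m + 2 ^ l * 1)) (valueʳ-zeros l) ⟨
        2 * (valueʳ (zeros {l}) + 2 ^ l * 1) ≡⟨ cong (2 *_) (valueʳ-∷ true (zeros {l})) ⟨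
        0 + 2 * valueʳ (true ∷ zeros {l}) ≡⟨ valueʳ-∷ʳ (true ∷ zeros {l}) false ⟨
        valueʳ (keep k)                 ∎
    ; result  = begin
        value (digit L c) + value (correction k u (keep k)) ≡⟨ cong₂ _+_ (dig c<d) (cong value corr≡) ⟩
        c + value (zeros {L} ∷ʳ true)
          ≡⟨ cong (c +_) (trans (value-∷ʳ (zeros {L}) true) (cong₂ _+_ (value-zeros L) (*-identityʳ (2 ^ L)))) ⟩
        c + 2 ^ L                             ≡⟨ u≡ ⟨
        value u                               ∎
    }
    where
    u = fromℕ {L} c ∷ʳ true
    shuffle : ∀ m → 1 + (1 + 2 * (m + 0)) ≡ 2 * suc m
    shuffle = solve-∀
    u≡ : value u ≡ c + 2 ^ L
    u≡ = trans (value-∷ʳ (fromℕ {L} c) true)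
               (cong₂ _+_ (value-fromℕ L (<-≤-trans c<d d≤)) (*-identityʳ (2 ^ L)))
    carry : zipWith _∧_ u (top k) ≡ zeros ∷ʳ true
    carry = trans (zipWith-∷ʳ _∧_ (fromℕ {L} c) zeros true true) (cong (_∷ʳ true) (zipWith-zeroʳ ∧-zeroʳ (fromℕ {L} c)))
    xor-self : ∀ {w} (x : Word w) → zipWith _⊻_ x x ≡ zeros
    xor-self []          = refl
    xor-self (true  ∷ x) = cong (false ∷_) (xor-self x)
    xor-self (false ∷ x) = cong (false ∷_) (xor-self x)
    corr≡ : correction k u (keep k) ≡ zeros ∷ʳ true
    corr≡ = trans (cong₂ (zipWith _∨_) carry
                         (trans (cong (zipWith _∧_ (gap k)) (xor-self (keep k))) (zipWith-zeroʳ ∧-zeroʳ (gap k))))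
                  (zipWith-identityʳ ∨-identityʳ (zeros ∷ʳ true))

digit-injective : ∀ l {a b} → a < 2 ^ l → b < 2 ^ l → digit l a ≡ digit l b → a ≡ b
digit-injective l a< b< eq = trans (sym (value-digit l a<)) (trans (cong value eq) (value-digit l b<))

-- Divisibility

record IsPeriod (P : ℕ → Set) (t : ℕ) : Set where
  field
    positive : 0 < t
    holds    : P t
    minimal  : ∀ {k} → P k → t ∣ k

-- `P` is closed under differences, so division by its least positive member leaves a remainder that
-- satisfies `P` and must therefore be 0.
period : ∀ {P : ℕ → Set} → (∀ k → Dec (P k)) → (∀ {k l} → P k → P (k + l) → P l) →
  ∀ {N} → 0 < N → P N → ∃[ t ] IsPeriod P t
period {P} P? diff {N} 0<N PN = search N (<-wellFounded N) 0<N PN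
  where
  reduce : ∀ {t r} q → P t → P (q * t + r) → P r
  reduce         zero    Pt Pr = Pr
  reduce {t} {r} (suc q) Pt Pr = reduce q Pt (diff Pt (subst P (+-assoc t (q * t) r) Pr))
  search : ∀ N → Acc _<_ N → 0 < N → P N → ∃[ t ] IsPeriod P t
  search N@(suc _) (acc rs) 0<N PN with anyUpTo? (λ k → (0 <? k) ×-dec P? k) N
  ... | yes (k , k<N , 0<k , Pk) = search k (rs k<N) 0<k Pk
  ... | no  least                = N , record { positive = 0<N ; holds = PN ; minimal = multiple }
    where
    multiple : ∀ {k} → P k → N ∣ k
    multiple {k} Pk with k % N in eq
    ... | zero  = m%n≡0⇒n∣m k N eq
    ... | suc r = contradiction
      (k % N , m%n<n k N , subst (0 <_) (sym eq) z<s ,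
       reduce (k / N) PN (subst P (trans (m≡m%n+[m/n]*n k N) (+-comm (k % N) (k / N * N))) Pk))
      least

∃-prime-divisor : ∀ n → 1 < n → ∃[ p ] Prime p × p ∣ n
∃-prime-divisor n@(suc _) 1<n with factorise n
... | record { factors = []     ; isFactorisation = eq }                        =
  contradiction (subst (1 <_) eq 1<n) (<-irrefl refl)
... | record { factors = p ∷ ps ; isFactorisation = eq ; factorsPrime = pp ∷ _ } =
  p , pp , subst (p ∣_) (sym eq) (m∣m*n _)

prime>1 : ∀ {p} → Prime p → 1 < p
prime>1 pp = nonTrivial⇒n>1 _ {{prime⇒nonTrivial pp}}

prime∤⇒coprime : ∀ {p m} → Prime p → ¬ p ∣ m → Coprime p m
prime∤⇒coprime pp p∤m (d∣p , d∣m) with prime⇒irreducible pp d∣p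
... | inj₁ d≡1  = d≡1
... | inj₂ refl = contradiction d∣m p∤m

prime^∤⇒coprime : ∀ {p m} → Prime p → ¬ p ∣ m → ∀ k → Coprime (p ^ k) m
prime^∤⇒coprime         pp p∤m zero    (d∣1 , _)   = ∣1⇒≡1 d∣1
prime^∤⇒coprime {p} {m} pp p∤m (suc k) {d} (d∣ , d∣m) =
  prime^∤⇒coprime pp p∤m k (coprime-divisor d⊥p d∣ , d∣m)
  where
  d⊥p : Coprime d p
  d⊥p (e∣d , e∣p) = prime∤⇒coprime pp p∤m (e∣p , ∣-trans e∣d d∣m)

coprime-*∣ : ∀ {m n k} → Coprime m n → m ∣ k → n ∣ k → m * n ∣ k
coprime-*∣ {m} {n} m⊥n (divides q refl) n∣k =
  subst (m * n ∣_) (*-comm m q) (*-monoʳ-∣ m (coprime-divisor (coprime-sym m⊥n) (subst (n ∣_) (*-comm q m) n∣k)))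

prime-part : ∀ {p m} → Prime p → 0 < m → ∃[ j ] ∃[ m′ ] m ≡ p ^ j * m′ × ¬ p ∣ m′
prime-part {p} {m} pp 0<m = go m (<-wellFounded m) 0<m
  where
  go : ∀ m → Acc _<_ m → 0 < m → ∃[ j ] ∃[ m′ ] m ≡ p ^ j * m′ × ¬ p ∣ m′
  go m (acc rs) 0<m with p ∣? m
  ... | no  p∤m                = 0 , m , sym (+-identityʳ m) , p∤m
  ... | yes (divides zero refl) = contradiction 0<m (<-irrefl refl)
  ... | yes (divides q@(suc _) refl) with go q (rs (m<m*n q p (prime>1 pp))) z<s
  ...   | j , m′ , eq , p∤m′ = suc j , m′ , trans (cong (_* p) eq) (shuffle (p ^ j) m′ p) , p∤m′
    where
    shuffle : ∀ a b c → a * b * c ≡ c * a * b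
    shuffle = solve-∀

-- Cancelling a common prime from `m` and `n` preserves the failure of divisibility, and once the
-- numbers are coprime any prime divisor of `n` will do. On the way back the cancelled prime raises
-- `j` if it is the one found, and is otherwise absorbed into `m′`.
excess-prime : ∀ m n → 0 < m → 0 < n → ¬ n ∣ m →
  ∃[ p ] ∃[ j ] ∃[ m′ ] Prime p × m ≡ p ^ j * m′ × ¬ p ∣ m′ × p ^ suc j ∣ n
excess-prime m n 0<m 0<n n∤m = go m n (<-wellFounded m) 0<m 0<n n∤m
  where
  go : ∀ m n → Acc _<_ m → 0 < m → 0 < n → ¬ n ∣ m →
    ∃[ p ] ∃[ j ] ∃[ m′ ] Prime p × m ≡ p ^ j * m′ × ¬ p ∣ m′ × p ^ suc j ∣ n
  go m n (acc rs) 0<m 0<n n∤m with gcd m n in g≡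
  ... | zero = contradiction (0∣⇒≡0 (subst (_∣ m) g≡ (gcd[m,n]∣m m n))) (λ { refl → <-irrefl refl 0<m })
  ... | suc zero with ∃-prime-divisor n 1<n
    where
    1<n : 1 < n
    1<n = ≤∧≢⇒< 0<n λ { refl → n∤m (1∣ m) }
  ...   | p , pp , p∣n = p , 0 , m , pp , sym (+-identityʳ m) , p∤m , subst (_∣ n) (sym (*-identityʳ p)) p∣n
    where
    p∤m : ¬ p ∣ m
    p∤m p∣m = contradiction (prime>1 pp) (λ 1<p → <⇒≢ 1<p (sym (gcd≡1⇒coprime g≡ (p∣m , p∣n))))
  go m n (acc rs) 0<m 0<n n∤m | suc (suc g) with ∃-prime-divisor (suc (suc g)) (s≤s (s≤s z≤n))
  ... | p , pp , p∣g with ∣-trans p∣g (subst (_∣ m) g≡ (gcd[m,n]∣m m n))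
                    | ∣-trans p∣g (subst (_∣ n) g≡ (gcd[m,n]∣n m n))
  ...   | divides zero refl         | _                         = contradiction 0<m (<-irrefl refl)
  ...   | divides (suc _) refl      | divides zero refl         = contradiction 0<n (<-irrefl refl)
  ...   | divides m₁@(suc _) refl   | divides n₁@(suc _) refl
    with go m₁ n₁ (rs (m<m*n m₁ p (prime>1 pp))) z<s z<s (λ n₁∣m₁ → n∤m (*-monoˡ-∣ p n₁∣m₁))
  ...     | q , j , m′ , qq , eq , q∤m′ , q^∣n₁ with q ≟ p
  ...       | yes refl = q , suc j , m′ , qq , trans (cong (_* q) eq) (shuffle (q ^ j) m′ q) , q∤m′ ,
                         subst (_∣ n₁ * q) (*-comm (q ^ suc j) q) (*-monoˡ-∣ q q^∣n₁)
    where
    shuffle : ∀ a b c → a * b * c ≡ c * a * b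
    shuffle = solve-∀
  ...       | no  q≢p  = q , j , m′ * p , qq , trans (cong (_* p) eq) (*-assoc (q ^ j) m′ p) ,
                         q∤m′p , ∣-trans q^∣n₁ (m∣m*n p)
    where
    q∤m′p : ¬ q ∣ m′ * p
    q∤m′p q∣ with euclidsLemma m′ p qq q∣
    ... | inj₁ q∣m′ = q∤m′ q∣m′
    ... | inj₂ q∣p with prime⇒irreducible pp q∣p
    ...   | inj₁ q≡1 = <⇒≢ (prime>1 qq) (sym q≡1)
    ...   | inj₂ q≡p = q≢p q≡p

-- Finite abelian groups

-- A homomorphism from `H` to the integers modulo `modulus`, by representatives. It is total on `A`,
-- so that only additivity depends on membership in `H`.
record Coordinate {a} {A : Set a} (_∙_ : A → A → A) (H : A → Set) : Set a where
  field
    modulus   : ℕ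
    coord     : A → ℕ
    modulus>1 : 1 < modulus
    coord<    : ∀ x → coord x < modulus
    additive  : ∀ {x y} → H x → H y → AddsMod modulus (coord x) (coord y) (coord (x ∙ y))

open Coordinate

module FiniteAbelian {n} {_⊕_ : Fin n → Fin n → Fin n} {𝟎 : Fin n} {⊝_ : Fin n → Fin n}
                     (isAbelianGroup : IsAbelianGroup _≡_ _⊕_ 𝟎 ⊝_) where

  private
    G : AbelianGroup _ _
    G = record { isAbelianGroup = isAbelianGroup }

  open AbelianGroup G using (assoc; comm; identityˡ; identityʳ; inverseˡ; inverseʳ;
    commutativeMonoid; commutativeSemigroup)
  open CommutativeMult commutativeMonoid renaming (_×_ to _·_)
  open CommutativeSemigroupProperties commutativeSemigroup using (interchange)
  open AbelianGroupProperties G using (∙-cancelˡ; ∙-cancelʳ)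

  ·-zeroʳ : ∀ k → k · 𝟎 ≡ 𝟎
  ·-zeroʳ zero    = refl
  ·-zeroʳ (suc k) = trans (identityˡ _) (·-zeroʳ k)

  multiple-vanishes : ∀ {m g} → m · g ≡ 𝟎 → ∀ q → (q * m) · g ≡ 𝟎
  multiple-vanishes {m} {g} mg≡0 q = trans (sym (×-assocˡ g q m)) (trans (cong (q ·_) mg≡0) (·-zeroʳ q))

  -- The bound `N ≤ n` is what limits the search for an element of largest relative order.
  torsion : ∀ x → ∃[ N ] 0 < N × N ≤ n × N · x ≡ 𝟎
  torsion x with Fin.pigeonhole (n<1+n n) (λ i → toℕ i · x)
  ... | i , j , i<j , eq = toℕ j ∸ toℕ i , m<n⇒0<n∸m i<j , ≤-trans (m∸n≤m (toℕ j) (toℕ i)) (Fin.toℕ≤pred[n] j) ,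
    ∙-cancelˡ (toℕ i · x) _ _ (begin
      (toℕ i · x) ⊕ ((toℕ j ∸ toℕ i) · x) ≡⟨ ×-homo-+ x (toℕ i) (toℕ j ∸ toℕ i) ⟨
      (toℕ i + (toℕ j ∸ toℕ i)) · x       ≡⟨ cong (_· x) (m+[n∸m]≡n (<⇒≤ i<j)) ⟩
      toℕ j · x                           ≡⟨ eq ⟨
      toℕ i · x                           ≡⟨ identityʳ _ ⟨
      (toℕ i · x) ⊕ 𝟎                     ∎)
    where open ≡-Reasoning

  -- A subgroup with coordinates that is pure enough to be a direct summand of every
  -- subgroup generated by it and one more element.
  record Summand (H : Fin n → Set) : Set where
    field
      member?    : ∀ x → Dec (H x)
      0-closed   : H 𝟎
      +-closed   : ∀ {x y} → H x → H y → H (x ⊕ y)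
      neg-closed : ∀ {x} → H x → H (⊝ x)
      adjust : ∀ {x t} → IsPeriod (λ k → H (k · x)) t → ∃[ h ] H h × t · (x ⊕ h) ≡ 𝟎
      size       : ℕ
      size>0     : 0 < size
      embed      : Fin size → Fin n
      embed∈     : ∀ i → H (embed i)
      embed-inj  : Injective _≡_ _≡_ embed
      coords     : List (Coordinate _⊕_ H)
      moduli     : product (List.map modulus coords) ≡ size
      separates  : ∀ {x y} → H x → H y → All (λ c → coord c x ≡ coord c y) coords → x ≡ y

  trivial : Summand (_≡ 𝟎)
  trivial = record
    { member?    = Fin._≟ 𝟎
    ; 0-closed   = refl
    ; +-closed   = λ { refl refl → identityˡ 𝟎 }
    ; neg-closed = λ { refl → trans (sym (identityˡ (⊝ 𝟎))) (inverseʳ 𝟎) }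
    ; adjust = λ {x} {t} per → 𝟎 , refl , trans (cong (t ·_) (identityʳ x)) (IsPeriod.holds per)
    ; size       = 1
    ; size>0     = z<s
    ; embed      = λ _ → 𝟎
    ; embed∈     = λ _ → refl
    ; embed-inj  = λ { {Fin.zero} {Fin.zero} _ → refl }
    ; coords     = []
    ; moduli     = refl
    ; separates  = λ { refl refl _ → refl }
    }

  module _ {H : Fin n → Set} (S : Summand H) where
    open Summand S

    ·-closed : ∀ k {x} → H x → H (k · x)
    ·-closed zero    Hx = 0-closed
    ·-closed (suc k) Hx = +-closed Hx (·-closed k Hx)

    cancel-closed : ∀ {x y} → H x → H (x ⊕ y) → H y
    cancel-closed {x} {y} Hx Hxy = subst H eq (+-closed (neg-closed Hx) Hxy)
      where
      eq : (⊝ x) ⊕ (x ⊕ y) ≡ y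
      eq = trans (sym (assoc (⊝ x) x y)) (trans (cong (_⊕ y) (inverseˡ x)) (identityˡ y))

    relative-order : ∀ x → ∃[ t ] IsPeriod (λ k → H (k · x)) t
    relative-order x with torsion x
    ... | N , 0<N , _ , Nx≡0 = period (λ k → member? (k · x))
      (λ {k} {l} Hk Hkl → cancel-closed Hk (subst H (×-homo-+ x k l) Hkl)) 0<N (subst H (sym Nx≡0) 0-closed)

    relative-order≤ : ∀ {x t} → IsPeriod (λ k → H (k · x)) t → t ≤ n
    relative-order≤ {x} per with torsion x
    ... | N@(suc _) , 0<N , N≤n , Nx≡0 = ≤-trans (∣⇒≤ (IsPeriod.minimal per (subst H (sym Nx≡0) 0-closed))) N≤n

    -- The new element is composed of coprime parts of x and y.
    larger-order : ∀ {x y m} → IsPeriod (λ k → H (k · x)) m → ¬ H (m · y) →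
      ∃[ x′ ] ∃[ m′ ] m < m′ × IsPeriod (λ k → H (k · x′)) m′
    larger-order {x} {y} {m} X ¬Hmy with relative-order y
    ... | t , Y with excess-prime m t (IsPeriod.positive X) (IsPeriod.positive Y) t∤m
      where
      t∤m : ¬ t ∣ m
      t∤m (divides q refl) = ¬Hmy (subst H (×-assocˡ y q t) (·-closed q (IsPeriod.holds Y)))
    ... | p , j , m′ , pp , refl , p∤m′ , divides t′ refl = x′ , M , m<M , record
      { positive = ≤-<-trans z≤n m<M
      ; holds    = M-holds
      ; minimal  = λ {i} Hi → subst (_∣ i) (*-comm P m′) (coprime-*∣ P⊥m′ (P∣ i Hi) (m′∣ i Hi))
      }
      where
      P = p ^ suc j
      M = m′ * P
      x′ = ((p ^ j) · x) ⊕ (t′ · y)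
      P⊥m′ : Coprime P m′
      P⊥m′ = prime^∤⇒coprime pp p∤m′ (suc j)
      pʲ>0 : 0 < p ^ j
      pʲ>0 = m^n>0 p {{prime⇒nonZero pp}} j
      instance
        p^j≢0 : NonZero (p ^ j)
        p^j≢0 = >-nonZero pʲ>0
        m′≢0 : NonZero m′
        m′≢0 = ≢-nonZero λ { refl → p∤m′ (p ∣0) }
        t′≢0 : NonZero t′
        t′≢0 = ≢-nonZero λ { refl → <-irrefl refl (IsPeriod.positive Y) }
      m<M : p ^ j * m′ < M
      m<M = subst (_< M) (*-comm m′ (p ^ j)) (*-monoʳ-< m′
        (subst (p ^ j <_) (*-comm (p ^ j) p) (m<m*n (p ^ j) p (prime>1 pp))))
      ·x′ : ∀ i → i · x′ ≡ ((i * p ^ j) · x) ⊕ ((i * t′) · y)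
      ·x′ i = trans (×-distrib-+ _ _ i) (cong₂ _⊕_ (×-assocˡ x i (p ^ j)) (×-assocˡ y i t′))
      M-holds : H (M · x′)
      M-holds = subst H (sym (·x′ M)) (+-closed
        (subst H (trans (×-assocˡ x P (p ^ j * m′)) (cong (_· x) (e₁ P (p ^ j) m′))) (·-closed P (IsPeriod.holds X)))
        (subst H (trans (×-assocˡ y m′ (t′ * P)) (cong (_· y) (e₂ m′ t′ P))) (·-closed m′ (IsPeriod.holds Y))))
        where
        e₁ : ∀ a b c → a * (b * c) ≡ c * a * b
        e₁ = solve-∀
        e₂ : ∀ a b c → a * (b * c) ≡ a * c * b
        e₂ = solve-∀
      -- Multiplication by `P` takes the `y` part of `i · x′` into `H`, because `t′ * P` is the
      -- relative order of `y`; what remains concerns `x` alone. For `P∣` the factor `m′` does the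
      -- same to the `x` part.
      m′∣ : ∀ i → H (i · x′) → m′ ∣ i
      m′∣ i Hi = coprime-divisor (coprime-sym P⊥m′) (subst (m′ ∣_) (*-comm i P) (*-cancelˡ-∣ (p ^ j)
        (subst (p ^ j * m′ ∣_) (e₁ P i (p ^ j)) (IsPeriod.minimal X (cancel-closed (·-closed i (IsPeriod.holds Y))
          (subst H (trans (cong (P ·_) (·x′ i)) (trans (×-distrib-+ _ _ P) (trans (comm _ _) (cong₂ _⊕_
            (trans (×-assocˡ y P (i * t′)) (trans (cong (_· y) (e₂ P i t′)) (sym (×-assocˡ y i (t′ * P)))))
            (×-assocˡ x P (i * p ^ j)))))) (·-closed P Hi)))))))
        where
        e₁ : ∀ a b c → a * (b * c) ≡ c * (b * a)
        e₁ = solve-∀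
        e₂ : ∀ a b c → a * (b * c) ≡ b * (c * a)
        e₂ = solve-∀
      P∣ : ∀ i → H (i · x′) → P ∣ i
      P∣ i Hi = coprime-divisor P⊥m′ (*-cancelˡ-∣ t′
        (subst (t′ * P ∣_) (e₁ m′ i t′) (IsPeriod.minimal Y (cancel-closed (·-closed i (IsPeriod.holds X))
          (subst H (trans (cong (m′ ·_) (·x′ i)) (trans (×-distrib-+ _ _ m′) (cong₂ _⊕_
            (trans (×-assocˡ x m′ (i * p ^ j)) (trans (cong (_· x) (e₂ m′ i (p ^ j))) (sym (×-assocˡ x i (p ^ j * m′)))))
            (×-assocˡ y m′ (i * t′))))) (·-closed m′ Hi))))))
        where
        e₁ : ∀ a b c → a * (b * c) ≡ c * (a * b)
        e₁ = solve-∀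
        e₂ : ∀ a b c → a * (b * c) ≡ b * (c * a)
        e₂ = solve-∀

    -- An element x of largest relative order works.
    exponent : ∃[ x ] ∃[ m ] IsPeriod (λ k → H (k · x)) m × (∀ y → H (m · y))
    exponent with relative-order 𝟎
    ... | m₀ , per₀ = go n per₀ (m<m+n n (IsPeriod.positive per₀))
      where
      go : ∀ fuel {x m} → IsPeriod (λ k → H (k · x)) m → n < fuel + m →
        ∃[ x ] ∃[ m ] IsPeriod (λ k → H (k · x)) m × (∀ y → H (m · y))
      go zero       per n<m = contradiction n<m (≤⇒≯ (relative-order≤ per))
      go (suc fuel) {x} {m} per n< with Fin.all? (λ y → member? (m · y))
      ... | yes all∈ = x , m , per , all∈
      ... | no ¬all∈ with Fin.¬∀⟶∃¬ n _ (λ y → member? (m · y)) ¬all∈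
      ...   | y , ¬Hmy with larger-order per ¬Hmy
      ...     | x′ , m′ , m<m′ , per′ =
        go fuel per′ (<-≤-trans n< (subst (_≤ fuel + m′) (+-suc fuel m) (+-monoʳ-≤ fuel m<m′)))

    module _ {g m₀} (m·g≡0 : suc m₀ · g ≡ 𝟎) (order : ∀ {i} → H (i · g) → suc m₀ ∣ i)
             (exponent-m : ∀ y → H (suc m₀ · y)) (1<m : 1 < suc m₀) where

      private
        m = suc m₀

      -- The bound on `a` makes membership decidable by search, and the coefficient found becomes
      -- the new coordinate.
      Extended : Fin n → Set
      Extended x = Σ[ a ∈ Fin m ] ∃[ h ] H h × x ≡ h ⊕ (toℕ a · g)

      reduce : ∀ k → k · g ≡ (k % m) · g
      reduce k = begin
        k · g                               ≡⟨ cong (_· g) (m≡m%n+[m/n]*n k m) ⟩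
        (k % m + k / m * m) · g             ≡⟨ ×-homo-+ g (k % m) (k / m * m) ⟩
        ((k % m) · g) ⊕ ((k / m * m) · g)   ≡⟨ cong (((k % m) · g) ⊕_) (multiple-vanishes {m} m·g≡0 (k / m)) ⟩
        ((k % m) · g) ⊕ 𝟎                   ≡⟨ identityʳ _ ⟩
        (k % m) · g                         ∎
        where open ≡-Reasoning

      extend : ∀ {x h} k → H h → x ≡ h ⊕ (k · g) → Extended x
      extend {x} {h} k Hh x≡ = fromℕ< (m%n<n k m) , h , Hh ,
        trans x≡ (cong (h ⊕_) (trans (reduce k) (cong (_· g) (sym (Fin.toℕ-fromℕ< (m%n<n k m))))))

      -- With `m ∸ b` in place of the negative of `b`, the multiple `(a + (m ∸ b)) · g` lies in `H`.
      -- So `m` divides `a + (m ∸ b)`, which is positive and below `2 * m`, hence equal to `m`.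
      unique : ∀ {h h′ a b} → H h → H h′ → a < m → b < m → h ⊕ (a · g) ≡ h′ ⊕ (b · g) → a ≡ b × h ≡ h′
      unique {h} {h′} {a} {b} Hh Hh′ a<m b<m eq =
        a≡b , ∙-cancelʳ (a · g) h h′ (trans eq (cong (λ c → h′ ⊕ (c · g)) (sym a≡b)))
        where
        open ≡-Reasoning
        shift : h ⊕ ((a + (m ∸ b)) · g) ≡ h′
        shift = begin
          h ⊕ ((a + (m ∸ b)) · g)            ≡⟨ cong (h ⊕_) (×-homo-+ g a (m ∸ b)) ⟩
          h ⊕ ((a · g) ⊕ ((m ∸ b) · g))      ≡⟨ assoc _ _ _ ⟨
          (h ⊕ (a · g)) ⊕ ((m ∸ b) · g)      ≡⟨ cong (_⊕ ((m ∸ b) · g)) eq ⟩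
          (h′ ⊕ (b · g)) ⊕ ((m ∸ b) · g)     ≡⟨ assoc _ _ _ ⟩
          h′ ⊕ ((b · g) ⊕ ((m ∸ b) · g))     ≡⟨ cong (h′ ⊕_) (×-homo-+ g b (m ∸ b)) ⟨
          h′ ⊕ ((b + (m ∸ b)) · g)           ≡⟨ cong (λ c → h′ ⊕ (c · g)) (m+[n∸m]≡n (<⇒≤ b<m)) ⟩
          h′ ⊕ (m · g)                       ≡⟨ cong (h′ ⊕_) m·g≡0 ⟩
          h′ ⊕ 𝟎                             ≡⟨ identityʳ h′ ⟩
          h′                                 ∎
        a≡b : a ≡ b
        a≡b with order {a + (m ∸ b)} (cancel-closed Hh (subst H (sym shift) Hh′))
        ... | divides zero eq₀ = contradiction (m+n≡0⇒n≡0 a eq₀) (>⇒≢ (m<n⇒0<n∸m b<m))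
        ... | divides (suc zero) eq₁ = +-cancelʳ-≡ (m ∸ b) a b
          (trans eq₁ (trans (+-identityʳ m) (sym (m+[n∸m]≡n (<⇒≤ b<m)))))
        ... | divides (suc (suc q)) eq₂ = contradiction eq₂ (<⇒≢ (<-≤-trans (+-mono-<-≤ a<m (m∸n≤m m b))
          (+-monoʳ-≤ m (m≤m+n m (q * m)))))

      member?′ : ∀ x → Dec (Extended x)
      member?′ x = Fin.any? λ a → Fin.any? λ h → member? h ×-dec (x Fin.≟ h ⊕ (toℕ a · g))

      -- Outside `Extended` the value 0 here and `𝟎` for `project` are defaults; they make
      -- `top-coord<` and `project∈` hold without a membership hypothesis.
      top-coord : Fin n → ℕ
      top-coord x with member?′ x
      ... | yes (a , _) = toℕ a
      ... | no  _       = 0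

      top-coord< : ∀ x → top-coord x < m
      top-coord< x with member?′ x
      ... | yes (a , _) = Fin.toℕ<n a
      ... | no  _       = z<s

      project : Fin n → Fin n
      project x with member?′ x
      ... | yes (_ , h , _) = h
      ... | no  _           = 𝟎

      project∈ : ∀ x → H (project x)
      project∈ x with member?′ x
      ... | yes (_ , _ , Hh , _) = Hh
      ... | no  _                = 0-closed

      decompose : ∀ {x} → Extended x → x ≡ project x ⊕ (top-coord x · g)
      decompose {x} Ex with member?′ x
      ... | yes (_ , _ , _ , eq) = eq
      ... | no  ¬Ex              = contradiction Ex ¬Ex

      +-closed′ : ∀ {x y} → Extended x → Extended y → Extended (x ⊕ y)
      +-closed′ (a , h , Hh , refl) (b , h′ , Hh′ , refl) = extend (toℕ a + toℕ b) (+-closed Hh Hh′)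
        (trans (interchange _ _ _ _) (cong ((h ⊕ h′) ⊕_) (sym (×-homo-+ g (toℕ a) (toℕ b)))))

      project-∙ : ∀ {x y} → Extended x → Extended y →
        (project x ⊕ project y) ⊕ ((top-coord x + top-coord y) · g) ≡ project (x ⊕ y) ⊕ (top-coord (x ⊕ y) · g)
      project-∙ {x} {y} Ex Ey = begin
        (project x ⊕ project y) ⊕ ((top-coord x + top-coord y) · g)
          ≡⟨ cong ((project x ⊕ project y) ⊕_) (×-homo-+ g (top-coord x) (top-coord y)) ⟩
        (project x ⊕ project y) ⊕ ((top-coord x · g) ⊕ (top-coord y · g))
          ≡⟨ interchange (project x) (project y) (top-coord x · g) (top-coord y · g) ⟩
        (project x ⊕ (top-coord x · g)) ⊕ (project y ⊕ (top-coord y · g))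
          ≡⟨ cong₂ _⊕_ (decompose Ex) (decompose Ey) ⟨
        x ⊕ y
          ≡⟨ decompose (+-closed′ Ex Ey) ⟩
        project (x ⊕ y) ⊕ (top-coord (x ⊕ y) · g) ∎
        where open ≡-Reasoning

      unique-mod : ∀ {h h′ a b c} → H h → H h′ → a < m → b < m → c < m →
        h ⊕ ((a + b) · g) ≡ h′ ⊕ (c · g) → AddsMod m a b c × h ≡ h′
      unique-mod {h} {h′} {a} {b} {c} Hh Hh′ a<m b<m c<m eq with a + b <? m
      ... | yes a+b<m with unique Hh Hh′ a+b<m c<m eq
      ...   | a+b≡c , h≡h′ = inj₁ a+b≡c , h≡h′
      unique-mod {h} {h′} {a} {b} {c} Hh Hh′ a<m b<m c<m eq | no a+b≮m with unique Hh Hh′ a+b∸m<m c<m eq′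
        where
        m≤a+b : m ≤ a + b
        m≤a+b = ≮⇒≥ a+b≮m
        a+b∸m<m : a + b ∸ m < m
        a+b∸m<m = subst (a + b ∸ m <_) (m+n∸n≡m m m) (∸-monoˡ-< (+-mono-< a<m b<m) m≤a+b)
        eq′ : h ⊕ ((a + b ∸ m) · g) ≡ h′ ⊕ (c · g)
        eq′ = trans (cong (h ⊕_) (sym (begin
          (a + b) · g                     ≡⟨ cong (_· g) (m∸n+n≡m m≤a+b) ⟨
          (a + b ∸ m + m) · g             ≡⟨ ×-homo-+ g (a + b ∸ m) m ⟩
          ((a + b ∸ m) · g) ⊕ (m · g)     ≡⟨ cong (((a + b ∸ m) · g) ⊕_) m·g≡0 ⟩
          ((a + b ∸ m) · g) ⊕ 𝟎           ≡⟨ identityʳ _ ⟩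
          (a + b ∸ m) · g                 ∎))) eq
          where open ≡-Reasoning
      ...   | a+b∸m≡c , h≡h′ = inj₂ (trans (sym (m∸n+n≡m (≮⇒≥ a+b≮m))) (cong (_+ m) a+b∸m≡c)) , h≡h′

      additive′ : ∀ {x y} → Extended x → Extended y →
        AddsMod m (top-coord x) (top-coord y) (top-coord (x ⊕ y)) × project x ⊕ project y ≡ project (x ⊕ y)
      additive′ {x} {y} Ex Ey = unique-mod (+-closed (project∈ x) (project∈ y)) (project∈ (x ⊕ y))
        (top-coord< x) (top-coord< y) (top-coord< (x ⊕ y)) (project-∙ Ex Ey)

      pullback : Coordinate _⊕_ H → Coordinate _⊕_ Extended
      pullback c = record
        { modulus   = modulus c
        ; coord     = λ x → coord c (project x)
        ; modulus>1 = modulus>1 c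
        ; coord<    = λ x → coord< c (project x)
        ; additive  = λ {x} {y} Ex Ey → subst
            (λ z → AddsMod (modulus c) (coord c (project x)) (coord c (project y)) (coord c z))
            (proj₂ (additive′ Ex Ey)) (additive c (project∈ x) (project∈ y))
        }

      extended : Summand Extended
      extended = record
        { member?    = member?′
        ; 0-closed   = extend 0 0-closed (sym (identityʳ 𝟎))
        ; +-closed   = +-closed′
        ; neg-closed = λ { {x} (a , h , Hh , x≡) → extend (m₀ * toℕ a) (neg-closed Hh) (neg x≡) }
        ; adjust = λ { {x} {t} per → adjust′ per (IsPeriod.holds per) }
        ; size       = m * size
        ; size>0     = *-mono-≤ {1} {m} (s≤s z≤n) size>0
        ; embed      = embed′
        ; embed∈     = λ i → extend (toℕ (row i)) (embed∈ (column i)) refl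
        ; embed-inj  = embed-inj′
        ; coords     = newest ∷ List.map pullback coords
        ; moduli     = cong (m *_) (trans (cong product (moduli-pullback coords)) moduli)
        ; separates  = separates′
        }
        where
        open ≡-Reasoning
        -- Since `suc m₀ · g ≡ 𝟎`, the coefficient `m₀` acts on `g` as -1.
        neg : ∀ {x h} {a : ℕ} → x ≡ h ⊕ (a · g) → ⊝ x ≡ (⊝ h) ⊕ ((m₀ * a) · g)
        neg {x} {h} {a} refl = ∙-cancelˡ (h ⊕ (a · g)) _ _ (begin
          (h ⊕ (a · g)) ⊕ (⊝ (h ⊕ (a · g)))               ≡⟨ inverseʳ _ ⟩
          𝟎                                               ≡⟨ identityˡ 𝟎 ⟨
          𝟎 ⊕ 𝟎
            ≡⟨ cong₂ _⊕_ (inverseʳ h) (trans (cong (_· g) (*-comm m a)) (multiple-vanishes {m} m·g≡0 a)) ⟨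
          (h ⊕ (⊝ h)) ⊕ ((a + m₀ * a) · g)                ≡⟨ cong ((h ⊕ (⊝ h)) ⊕_) (×-homo-+ g a (m₀ * a)) ⟩
          (h ⊕ (⊝ h)) ⊕ ((a · g) ⊕ ((m₀ * a) · g))        ≡⟨ interchange _ _ _ _ ⟩
          (h ⊕ (a · g)) ⊕ ((⊝ h) ⊕ ((m₀ * a) · g))        ∎)
        row : Fin (m * size) → Fin m
        row i = proj₁ (remQuot {m} size i)
        column : Fin (m * size) → Fin size
        column i = proj₂ (remQuot {m} size i)
        embed′ : Fin (m * size) → Fin n
        embed′ i = embed (column i) ⊕ (toℕ (row i) · g)
        embed-inj′ : Injective _≡_ _≡_ embed′
        embed-inj′ {i} {j} eq
          with unique (embed∈ (column i)) (embed∈ (column j)) (Fin.toℕ<n (row i)) (Fin.toℕ<n (row j)) eq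
        ... | a≡ , h≡ = trans (sym (Fin.combine-remQuot {m} size i)) (trans
          (cong₂ (Fin.combine {m} {size}) (Fin.toℕ-injective a≡) (embed-inj h≡)) (Fin.combine-remQuot {m} size j))
        newest : Coordinate _⊕_ Extended
        newest = record { modulus = m ; coord = top-coord ; modulus>1 = 1<m ; coord< = top-coord<
                     ; additive = λ Ex Ey → proj₁ (additive′ Ex Ey) }
        moduli-pullback : ∀ cs → List.map modulus (List.map pullback cs) ≡ List.map modulus cs
        moduli-pullback []       = refl
        moduli-pullback (c ∷ cs) = cong (modulus c ∷_) (moduli-pullback cs)
        separates′ : ∀ {x y} → Extended x → Extended y →
          All (λ c → coord c x ≡ coord c y) (newest ∷ List.map pullback coords) → x ≡ y
        separates′ {x} {y} Ex Ey (a≡ ∷ cs≡) = trans (decompose Ex) (trans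
          (cong₂ (λ h a → h ⊕ (a · g)) (separates (project∈ x) (project∈ y) (All.map⁻ cs≡)) a≡)
          (sym (decompose Ey)))
        -- From t · x = h + s · g and t ∣ m it follows that t ∣ s.
        adjust′ : ∀ {x t} → IsPeriod (λ k → Extended (k · x)) t → Extended (t · x) → ∃[ h ] Extended h × t · (x ⊕ h) ≡ 𝟎
        adjust′ {x} {t} per (a , h₁ , Hh₁ , tx≡)
          with IsPeriod.minimal per (extend 0 (exponent-m x) (sym (identityʳ _)))
        ... | divides q@(suc _) m≡q*t
          with *-cancelˡ-∣ q (subst (_∣ q * toℕ a) m≡q*t (order (cancel-closed (·-closed q Hh₁)
            (subst H qtx (exponent-m x)))))
          where
          qtx : m · x ≡ (q · h₁) ⊕ ((q * toℕ a) · g)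
          qtx = begin
            m · x                            ≡⟨ cong (_· x) m≡q*t ⟩
            (q * t) · x                      ≡⟨ ×-assocˡ x q t ⟨
            q · (t · x)                      ≡⟨ cong (q ·_) tx≡ ⟩
            q · (h₁ ⊕ (toℕ a · g))           ≡⟨ ×-distrib-+ h₁ (toℕ a · g) q ⟩
            (q · h₁) ⊕ (q · (toℕ a · g))     ≡⟨ cong ((q · h₁) ⊕_) (×-assocˡ g q (toℕ a)) ⟩
            (q · h₁) ⊕ ((q * toℕ a) · g)     ∎
        ...   | divides s a≡s*t with adjust {y} {t} (record
            { positive = IsPeriod.positive per
            ; holds    = subst H (sym ty≡h₁) Hh₁
            ; minimal  = λ {i} Hiy → IsPeriod.minimal per (extend (i * s) Hiy (ix i))
            })
          where
          -- This is `x` minus `s · g`. Its multiple `t · y` lies in `H` and its relative order is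
          -- still `t`, so the `adjust` of `H` applies to it.
          y = x ⊕ ((s * m₀) · g)
          arith : ∀ t s m₀ → s * t + t * (s * m₀) ≡ t * s * suc m₀
          arith = solve-∀
          ty≡h₁ : t · y ≡ h₁
          ty≡h₁ = begin
            t · y                                           ≡⟨ ×-distrib-+ x ((s * m₀) · g) t ⟩
            (t · x) ⊕ (t · ((s * m₀) · g))                  ≡⟨ cong₂ _⊕_ tx≡ (×-assocˡ g t (s * m₀)) ⟩
            (h₁ ⊕ (toℕ a · g)) ⊕ ((t * (s * m₀)) · g)       ≡⟨ assoc _ _ _ ⟩
            h₁ ⊕ ((toℕ a · g) ⊕ ((t * (s * m₀)) · g))
              ≡⟨ cong (h₁ ⊕_) (×-homo-+ g (toℕ a) (t * (s * m₀))) ⟨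
            h₁ ⊕ ((toℕ a + t * (s * m₀)) · g)
              ≡⟨ cong (λ k → h₁ ⊕ (k · g)) (trans (cong (_+ t * (s * m₀)) a≡s*t) (arith t s m₀)) ⟩
            h₁ ⊕ ((t * s * m) · g)
              ≡⟨ cong (h₁ ⊕_) (multiple-vanishes {m} m·g≡0 (t * s)) ⟩
            h₁ ⊕ 𝟎                                          ≡⟨ identityʳ h₁ ⟩
            h₁                                              ∎
          arith′ : ∀ i s m₀ → i * (s * m₀) + i * s ≡ i * s * suc m₀
          arith′ = solve-∀
          ix : ∀ i → i · x ≡ (i · y) ⊕ ((i * s) · g)
          ix i = sym (begin
            (i · y) ⊕ ((i * s) · g)
              ≡⟨ cong (_⊕ ((i * s) · g)) (trans (×-distrib-+ x _ i) (cong ((i · x) ⊕_) (×-assocˡ g i (s * m₀)))) ⟩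
            ((i · x) ⊕ ((i * (s * m₀)) · g)) ⊕ ((i * s) · g)      ≡⟨ assoc _ _ _ ⟩
            (i · x) ⊕ (((i * (s * m₀)) · g) ⊕ ((i * s) · g))
              ≡⟨ cong ((i · x) ⊕_) (×-homo-+ g (i * (s * m₀)) (i * s)) ⟨
            (i · x) ⊕ ((i * (s * m₀) + i * s) · g)
              ≡⟨ cong (λ k → (i · x) ⊕ (k · g)) (arith′ i s m₀) ⟩
            (i · x) ⊕ ((i * s * m) · g)
              ≡⟨ cong ((i · x) ⊕_) (multiple-vanishes {m} m·g≡0 (i * s)) ⟩
            (i · x) ⊕ 𝟎                                           ≡⟨ identityʳ _ ⟩
            i · x                                                 ∎)
        ...     | h , Hh , ty+h≡0 = ((s * m₀) · g) ⊕ h , extend (s * m₀) Hh (comm _ _) ,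
          trans (cong (t ·_) (sym (assoc x _ h))) ty+h≡0

  -- A summand that is not everything can be enlarged by a nontrivial cyclic factor, whose generator
  -- has the largest relative order and is adjusted to have this as its order. The injection `embed`
  -- bounds `size` by `n`; this ends the recursion and bounds the product of the moduli.
  coordinates : ∃[ cs ] product (List.map (modulus {_∙_ = _⊕_} {H = λ _ → ⊤}) cs) ≤ n ×
    (∀ {x y} → All (λ c → coord c x ≡ coord c y) cs → x ≡ y)
  coordinates = go n trivial (m<m+n n z<s)
    where
    go : ∀ fuel {H} (S : Summand H) → n < fuel + Summand.size S →
      ∃[ cs ] product (List.map (modulus {_∙_ = _⊕_} {H = λ _ → ⊤}) cs) ≤ n ×
      (∀ {x y} → All (λ c → coord c x ≡ coord c y) cs → x ≡ y)
    go zero S n< = contradiction n< (≤⇒≯ (Fin.injective⇒≤ (Summand.embed-inj S)))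
    go (suc fuel) {H} S n< with Fin.all? (Summand.member? S)
    ... | yes all∈ = List.map total coords , subst (_≤ n) (sym (trans (cong product (moduli-total coords)) moduli))
                       (Fin.injective⇒≤ embed-inj) ,
                     λ eqs → separates (all∈ _) (all∈ _) (All.map⁻ eqs)
      where
      open Summand S
      total : Coordinate _⊕_ H → Coordinate _⊕_ (λ _ → ⊤)
      total c = record { modulus = modulus c ; coord = coord c ; modulus>1 = modulus>1 c ; coord< = coord< c
                       ; additive = λ {x} {y} _ _ → additive c (all∈ x) (all∈ y) }
      moduli-total : ∀ cs → List.map modulus (List.map total cs) ≡ List.map modulus cs
      moduli-total []       = refl
      moduli-total (c ∷ cs) = cong (modulus c ∷_) (moduli-total cs)
    ... | no ¬all∈ with Fin.¬∀⟶∃¬ n _ (Summand.member? S) ¬all∈ | exponent S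
    ...   | y , y∉H | x , zero        , per , all-m = contradiction (IsPeriod.positive per) (<-irrefl refl)
    ...   | y , y∉H | x , suc zero    , per , all-m = contradiction (subst H (identityʳ y) (all-m y)) y∉H
    ...   | y , y∉H | x , m@(suc (suc m₀)) , per , all-m with Summand.adjust S per
    ...     | h , Hh , mg≡0 = go fuel (extended S {g = x ⊕ h} mg≡0 order all-m (s≤s (s≤s z≤n)))
        (<-≤-trans n< (subst (_≤ fuel + m * size) (+-suc fuel size) (+-monoʳ-≤ fuel size<m*size)))
      where
      open Summand S
      size<m*size : size < m * size
      size<m*size = subst (size <_) (*-comm size m) (m<m*n size m {{>-nonZero size>0}} (s≤s (s≤s z≤n)))
      order : ∀ {i} → H (i · (x ⊕ h)) → m ∣ i
      order {i} Hi = IsPeriod.minimal per (cancel-closed S (·-closed S i Hh)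
        (subst H (trans (×-distrib-+ x h i) (comm _ _)) Hi))

-- Groups all of whose subgroups are normal

-- Turns the centralizer, a decidable subset, into a group on a `Fin` type, to which the
-- decomposition of finite abelian groups applies.
record Enumeration {n} (P : Fin n → Set) : Set where
  field
    size     : ℕ
    element  : Fin size → Fin n
    element∈ : ∀ i → P (element i)
    injects  : ∀ {i j} → element i ≡ element j → i ≡ j
    index    : ∀ {x} → P x → Fin size
    element-index : ∀ {x} (Px : P x) → element (index Px) ≡ x

enumerate : ∀ {n} {P : Fin n → Set} → (∀ x → Dec (P x)) → Enumeration P
enumerate {zero}      P? = record
  { size = 0 ; element = λ () ; element∈ = λ () ; injects = λ { {()} }
  ; index = λ { {()} } ; element-index = λ { {()} } }
enumerate {suc n} {P} P? with P? Fin.zero | enumerate (λ i → P? (Fin.suc i))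
... | yes P₀ | E = record
  { size          = suc size
  ; element       = element₀
  ; element∈      = λ { Fin.zero → P₀ ; (Fin.suc i) → element∈ i }
  ; injects       = λ { {Fin.zero} {Fin.zero} _ → refl
                      ; {Fin.suc i} {Fin.suc j} eq → cong Fin.suc (injects (Fin.suc-injective eq)) }
  ; index         = λ { {Fin.zero} _ → Fin.zero ; {Fin.suc x} Px → Fin.suc (index Px) }
  ; element-index = λ { {Fin.zero} _ → refl ; {Fin.suc x} Px → cong Fin.suc (element-index Px) }
  }
  where
  open Enumeration E
  element₀ : Fin (suc size) → Fin (suc n)
  element₀ Fin.zero    = Fin.zero
  element₀ (Fin.suc i) = Fin.suc (element i)
... | no ¬P₀ | E = record
  { size          = size
  ; element       = λ i → Fin.suc (element i)
  ; element∈      = element∈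
  ; injects       = λ eq → injects (Fin.suc-injective eq)
  ; index         = λ { {Fin.zero} P₀ → contradiction P₀ ¬P₀ ; {Fin.suc x} Px → index Px }
  ; element-index = λ { {Fin.zero} P₀ → contradiction P₀ ¬P₀ ; {Fin.suc x} Px → cong Fin.suc (element-index Px) }
  }
  where open Enumeration E

-- The exponent of `z` released when `xⁱ yʲ` times `xⁱ′ yʲ′` is sorted: `j ∧ i′` from moving `y`
-- past `x`, the other two terms from squares of `x` and of `y`.
cocycle : (i j i′ j′ : Bool) → Bool
cocycle i j i′ j′ = (j ∧ i′) ⊻ ((i ∧ i′) ⊻ (j ∧ j′))

-- An extension of an abelian group by the Klein four-group, with the cocycle of the
-- quaternion group.
record QuaternionExtension {n} (_∙_ : Fin n → Fin n → Fin n) : Set where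
  infixl 7 _⊕_
  field
    coreSize       : ℕ
    _⊕_            : Fin coreSize → Fin coreSize → Fin coreSize
    𝟎 ζ            : Fin coreSize
    ⊝_             : Fin coreSize → Fin coreSize
    isAbelianGroup : IsAbelianGroup _≡_ _⊕_ 𝟎 ⊝_
    bitˣ bitʸ      : Fin n → Bool
    core           : Fin n → Fin coreSize
    bitˣ-∙         : ∀ g h → bitˣ (g ∙ h) ≡ bitˣ g ⊻ bitˣ h
    bitʸ-∙         : ∀ g h → bitʸ (g ∙ h) ≡ bitʸ g ⊻ bitʸ h
    core-∙         : ∀ g h → core (g ∙ h) ≡
      core g ⊕ core h ⊕ (if cocycle (bitˣ g) (bitʸ g) (bitˣ h) (bitʸ h) then ζ else 𝟎)
    injective      : ∀ {g h} → bitˣ g ≡ bitˣ h → bitʸ g ≡ bitʸ h → core g ≡ core h → g ≡ h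
    2*coreSize≤n   : 2 * coreSize ≤ n

module Dedekind {n} {_∙_ : Fin n → Fin n → Fin n} {ε : Fin n} {_⁻¹ : Fin n → Fin n}
                (isGroup : IsGroup _≡_ _∙_ ε _⁻¹) where

  G : Group _ _
  G = record { isGroup = isGroup }

  open Group G using (assoc; identityˡ; identityʳ; inverseˡ; inverseʳ; monoid)
  open MonoidMult monoid renaming (_×_ to _·_)
  open MonoidSolver monoid using (solve; _⊕_; _⊜_)
  open GroupProperties G using (∙-cancelˡ; ∙-cancelʳ)

  infixr 8 _↑_
  _↑_ : Fin n → ℕ → Fin n
  x ↑ k = k · x

  Commute : Fin n → Fin n → Set
  Commute a b = a ∙ b ≡ b ∙ a

  Commute-∙ : ∀ {a b c} → Commute a c → Commute b c → Commute (a ∙ b) c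
  Commute-∙ {a} {b} {c} ac bc = begin
    (a ∙ b) ∙ c  ≡⟨ assoc a b c ⟩
    a ∙ (b ∙ c)  ≡⟨ cong (a ∙_) bc ⟩
    a ∙ (c ∙ b)  ≡⟨ assoc a c b ⟨
    (a ∙ c) ∙ b  ≡⟨ cong (_∙ b) ac ⟩
    (c ∙ a) ∙ b  ≡⟨ assoc c a b ⟩
    c ∙ (a ∙ b)  ∎
    where open ≡-Reasoning

  Commute-ε : ∀ {a} → Commute ε a
  Commute-ε {a} = trans (identityˡ a) (sym (identityʳ a))

  Commute-^ : ∀ {a c} k → Commute a c → Commute (a ↑ k) c
  Commute-^ zero    ac = Commute-ε
  Commute-^ (suc k) ac = Commute-∙ ac (Commute-^ k ac)

  ε^ : ∀ k → ε ↑ k ≡ ε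
  ε^ zero    = refl
  ε^ (suc k) = trans (identityˡ _) (ε^ k)

  ^-multiple : ∀ {a k} q → a ↑ k ≡ ε → a ↑ (q * k) ≡ ε
  ^-multiple {a} {k} q eq = trans (sym (×-assocˡ a q k)) (trans (cong (_↑ q) eq) (ε^ q))

  torsion : ∀ x → ∃[ N ] x ↑ suc N ≡ ε
  torsion x with Fin.pigeonhole (n<1+n n) (λ i → x ↑ toℕ i)
  ... | i , j , i<j , eq with toℕ j ∸ toℕ i in d≡
  ...   | zero  = contradiction (subst (0 <_) d≡ (m<n⇒0<n∸m i<j)) (<-irrefl refl)
  ...   | suc d = d , ∙-cancelˡ (x ↑ toℕ i) _ _ (begin
      (x ↑ toℕ i) ∙ (x ↑ suc d)   ≡⟨ ×-homo-+ x (toℕ i) (suc d) ⟨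
      x ↑ (toℕ i + suc d)         ≡⟨ cong (λ e → x ↑ (toℕ i + e)) d≡ ⟨
      x ↑ (toℕ i + (toℕ j ∸ toℕ i)) ≡⟨ cong (x ↑_) (m+[n∸m]≡n (<⇒≤ i<j)) ⟩
      x ↑ toℕ j                   ≡⟨ eq ⟨
      x ↑ toℕ i                   ≡⟨ identityʳ _ ⟨
      (x ↑ toℕ i) ∙ ε             ∎)
    where open ≡-Reasoning

  IsOrder : Fin n → ℕ → Set
  IsOrder x = IsPeriod (λ k → x ↑ k ≡ ε)

  order : ∀ x → ∃[ m ] IsOrder x m
  order x with torsion x
  ... | N , eq = period (λ k → x ↑ k Fin.≟ ε)
    (λ {k} {l} xᵏ xᵏˡ → trans (sym (identityˡ _)) (trans (cong (_∙ (x ↑ l)) (sym xᵏ))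
      (trans (sym (×-homo-+ x k l)) xᵏˡ)))
    {suc N} z<s eq

  ^-quotient : ∀ {b c d N} → c ∙ b ≡ d → b ↑ suc N ≡ ε → c ≡ d ∙ (b ↑ N)
  ^-quotient {b} {c} {d} {N} eq bᴺ = begin
    c                   ≡⟨ identityʳ c ⟨
    c ∙ ε               ≡⟨ cong (c ∙_) bᴺ ⟨
    c ∙ (b ∙ (b ↑ N))   ≡⟨ assoc c b (b ↑ N) ⟨
    (c ∙ b) ∙ (b ↑ N)   ≡⟨ cong (_∙ (b ↑ N)) eq ⟩
    d ∙ (b ↑ N)         ∎
    where open ≡-Reasoning

  module _ {c} (c²≡ε : c ↑ 2 ≡ ε) where
    even^ : ∀ {k} → 2 ∣ k → c ↑ k ≡ ε
    even^ (divides q refl) = ^-multiple q c²≡ε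

    odd^ : ∀ {k} → ¬ 2 ∣ k → c ↑ k ≡ c
    odd^ {k} 2∤k with k % 2 in eq | m%n<n k 2
    ... | zero        | _               = contradiction (m%n≡0⇒n∣m k 2 eq) 2∤k
    ... | suc zero    | _               = begin
      c ↑ k                           ≡⟨ cong (c ↑_) (trans (m≡m%n+[m/n]*n k 2) (cong (_+ k / 2 * 2) eq)) ⟩
      c ∙ (c ↑ (k / 2 * 2))           ≡⟨ cong (c ∙_) (^-multiple (k / 2) c²≡ε) ⟩
      c ∙ ε                           ≡⟨ identityʳ c ⟩
      c                               ∎
      where open ≡-Reasoning
    ... | suc (suc _) | s≤s (s≤s ())

  prime^ : ∀ {c p} → Prime p → c ≢ ε → c ↑ p ≡ ε → ∀ {k} → c ↑ k ≡ ε → p ∣ k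
  prime^ {c} {p} pp c≢ε cᵖ {k} cᵏ with order c
  ... | e , per with prime⇒irreducible pp (IsPeriod.minimal per cᵖ)
  ...   | inj₁ refl = contradiction (trans (sym (identityʳ c)) (IsPeriod.holds per)) c≢ε
  ...   | inj₂ refl = IsPeriod.minimal per cᵏ

  -- `c` is `b a b⁻¹ a⁻¹`, described without inverses. As it commutes with both elements, taking
  -- commutators is compatible with powers in either argument.
  record Commutator (a b c : Fin n) : Set where
    field
      swap    : b ∙ a ≡ c ∙ (a ∙ b)
      central : Commute c a × Commute c b

    c-a = proj₁ central
    c-b = proj₂ central

    swap-^ : ∀ k → b ∙ (a ↑ k) ≡ (c ↑ k) ∙ ((a ↑ k) ∙ b)
    swap-^ zero    = trans (identityʳ b) (sym (trans (identityˡ _) (identityˡ b)))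
    swap-^ (suc k) = begin
      b ∙ (a ∙ aᵏ)                ≡⟨ solve 3 (λ a b x → b ⊕ (a ⊕ x) ⊜ (b ⊕ a) ⊕ x) refl a b aᵏ ⟩
      (b ∙ a) ∙ aᵏ                ≡⟨ cong (_∙ aᵏ) swap ⟩
      (c ∙ (a ∙ b)) ∙ aᵏ
        ≡⟨ solve 4 (λ a b c x → (c ⊕ (a ⊕ b)) ⊕ x ⊜ (c ⊕ a) ⊕ (b ⊕ x)) refl a b c aᵏ ⟩
      (c ∙ a) ∙ (b ∙ aᵏ)          ≡⟨ cong ((c ∙ a) ∙_) (swap-^ k) ⟩
      (c ∙ a) ∙ (cᵏ ∙ (aᵏ ∙ b))
        ≡⟨ solve 4 (λ a c y z → (c ⊕ a) ⊕ (y ⊕ z) ⊜ c ⊕ ((a ⊕ y) ⊕ z)) refl a c cᵏ (aᵏ ∙ b) ⟩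
      c ∙ ((a ∙ cᵏ) ∙ (aᵏ ∙ b))   ≡⟨ cong (λ d → c ∙ (d ∙ (aᵏ ∙ b))) (Commute-^ k c-a) ⟨
      c ∙ ((cᵏ ∙ a) ∙ (aᵏ ∙ b))
        ≡⟨ solve 5 (λ a b c x y → c ⊕ ((y ⊕ a) ⊕ (x ⊕ b)) ⊜ (c ⊕ y) ⊕ ((a ⊕ x) ⊕ b)) refl a b c aᵏ cᵏ ⟩
      (c ∙ cᵏ) ∙ ((a ∙ aᵏ) ∙ b)   ∎
      where
      open ≡-Reasoning
      aᵏ = a ↑ k
      cᵏ = c ↑ k

    ^-swap : ∀ k → (b ↑ k) ∙ a ≡ (c ↑ k) ∙ (a ∙ (b ↑ k))
    ^-swap zero    = trans (identityˡ a) (sym (trans (identityˡ _) (identityʳ a)))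
    ^-swap (suc k) = begin
      (b ∙ bᵏ) ∙ a                ≡⟨ assoc b bᵏ a ⟩
      b ∙ (bᵏ ∙ a)                ≡⟨ cong (b ∙_) (^-swap k) ⟩
      b ∙ (cᵏ ∙ (a ∙ bᵏ))         ≡⟨ assoc b cᵏ (a ∙ bᵏ) ⟨
      (b ∙ cᵏ) ∙ (a ∙ bᵏ)         ≡⟨ cong (_∙ (a ∙ bᵏ)) (Commute-^ k c-b) ⟨
      (cᵏ ∙ b) ∙ (a ∙ bᵏ)
        ≡⟨ solve 4 (λ a b x y → (y ⊕ b) ⊕ (a ⊕ x) ⊜ y ⊕ ((b ⊕ a) ⊕ x)) refl a b bᵏ cᵏ ⟩
      cᵏ ∙ ((b ∙ a) ∙ bᵏ)         ≡⟨ cong (λ d → cᵏ ∙ (d ∙ bᵏ)) swap ⟩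
      cᵏ ∙ ((c ∙ (a ∙ b)) ∙ bᵏ)
        ≡⟨ solve 5 (λ a b c x y → y ⊕ ((c ⊕ (a ⊕ b)) ⊕ x) ⊜ (y ⊕ c) ⊕ (a ⊕ (b ⊕ x))) refl a b c bᵏ cᵏ ⟩
      (cᵏ ∙ c) ∙ (a ∙ (b ∙ bᵏ))   ≡⟨ cong (_∙ (a ∙ (b ∙ bᵏ))) (Commute-^ k refl) ⟩
      (c ∙ cᵏ) ∙ (a ∙ (b ∙ bᵏ))   ∎
      where
      open ≡-Reasoning
      bᵏ = b ↑ k
      cᵏ = c ↑ k

    swap-ε : ∀ k → c ↑ k ≡ ε → Commute (a ↑ k) b
    swap-ε k cᵏ = sym (trans (swap-^ k) (trans (cong (_∙ ((a ↑ k) ∙ b)) cᵏ) (identityˡ _)))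

    swap-ε⁻¹ : ∀ k → Commute (a ↑ k) b → c ↑ k ≡ ε
    swap-ε⁻¹ k ab = ∙-cancelʳ _ _ _ (trans (sym (swap-^ k)) (trans (sym ab) (sym (identityˡ _))))

    ε-swap : ∀ k → c ↑ k ≡ ε → Commute a (b ↑ k)
    ε-swap k cᵏ = sym (trans (^-swap k) (trans (cong (_∙ (a ∙ (b ↑ k))) cᵏ) (identityˡ _)))

    ε-swap⁻¹ : ∀ k → Commute a (b ↑ k) → c ↑ k ≡ ε
    ε-swap⁻¹ k ab = ∙-cancelʳ _ _ _ (trans (sym (^-swap k)) (trans (sym ab) (sym (identityˡ _))))

    noncommuting : ¬ Commute a b → c ≢ ε
    noncommuting ¬ab refl = ¬ab (sym (trans swap (identityˡ _)))

  commutator-unique : ∀ {a b c d} → Commutator a b c → b ∙ a ≡ d ∙ (a ∙ b) → c ≡ d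
  commutator-unique C eq = ∙-cancelʳ _ _ _ (trans (sym (Commutator.swap C)) eq)

  -- The binomial coefficient t(t-1)/2: the number of pairs among `t` factors.
  triangular : ℕ → ℕ
  triangular zero    = 0
  triangular (suc t) = t + triangular t

  2*triangular : ∀ t → 2 * triangular (suc t) ≡ suc t * t
  2*triangular zero    = refl
  2*triangular (suc t) = begin
    2 * (suc t + triangular (suc t))       ≡⟨ *-distribˡ-+ 2 (suc t) _ ⟩
    2 * suc t + 2 * triangular (suc t)     ≡⟨ cong (2 * suc t +_) (2*triangular t) ⟩
    2 * suc t + suc t * t                  ≡⟨ shuffle t ⟩
    suc (suc t) * suc t                    ∎
    where
    open ≡-Reasoning
    shuffle : ∀ t → 2 * suc t + suc t * t ≡ suc (suc t) * suc t
    shuffle = solve-∀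

  module _ {a b c} (C : Commutator a b c) where
    open Commutator C

    -- Collecting the powers of `a` on the left, every `b` passes each later `a ↑ k` once, at the
    -- cost of `c ↑ k`.
    product-^ : ∀ k t → ((a ↑ k) ∙ b) ↑ t ≡ (c ↑ (k * triangular t)) ∙ ((a ↑ (k * t)) ∙ (b ↑ t))
    product-^ k zero    = sym (trans (cong₂ (λ i j → (c ↑ i) ∙ ((a ↑ j) ∙ ε)) (*-zeroʳ k) (*-zeroʳ k))
                                     (trans (identityˡ _) (identityˡ _)))
    product-^ k (suc t) = begin
      (aᵏ ∙ b) ∙ (((a ↑ k) ∙ b) ↑ t)             ≡⟨ cong ((aᵏ ∙ b) ∙_) (product-^ k t) ⟩
      (aᵏ ∙ b) ∙ (cᵀ ∙ (aᵏᵗ ∙ bᵗ))               ≡⟨ assoc (aᵏ ∙ b) cᵀ (aᵏᵗ ∙ bᵗ) ⟨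
      ((aᵏ ∙ b) ∙ cᵀ) ∙ (aᵏᵗ ∙ bᵗ)               ≡⟨ cong (_∙ (aᵏᵗ ∙ bᵗ)) (cᵀ-comm (k * triangular t)) ⟨
      (cᵀ ∙ (aᵏ ∙ b)) ∙ (aᵏᵗ ∙ bᵗ)
        ≡⟨ solve 5 (λ A b c X Y → (c ⊕ (A ⊕ b)) ⊕ (X ⊕ Y) ⊜ c ⊕ (A ⊕ ((b ⊕ X) ⊕ Y))) refl aᵏ b cᵀ aᵏᵗ bᵗ ⟩
      cᵀ ∙ (aᵏ ∙ ((b ∙ aᵏᵗ) ∙ bᵗ))               ≡⟨ cong (λ d → cᵀ ∙ (aᵏ ∙ (d ∙ bᵗ))) (swap-^ (k * t)) ⟩
      cᵀ ∙ (aᵏ ∙ ((cᵏᵗ ∙ (aᵏᵗ ∙ b)) ∙ bᵗ))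
        ≡⟨ solve 6 (λ A b c d X Y → c ⊕ (A ⊕ ((d ⊕ (X ⊕ b)) ⊕ Y)) ⊜ c ⊕ ((A ⊕ d) ⊕ (X ⊕ (b ⊕ Y)))) refl aᵏ b cᵀ cᵏᵗ aᵏᵗ bᵗ ⟩
      cᵀ ∙ ((aᵏ ∙ cᵏᵗ) ∙ (aᵏᵗ ∙ (b ∙ bᵗ)))
        ≡⟨ cong (λ d → cᵀ ∙ (d ∙ (aᵏᵗ ∙ (b ∙ bᵗ)))) (Commute-^ k (sym (Commute-^ (k * t) c-a))) ⟩
      cᵀ ∙ ((cᵏᵗ ∙ aᵏ) ∙ (aᵏᵗ ∙ (b ∙ bᵗ)))
        ≡⟨ solve 5 (λ A c d X Y → c ⊕ ((d ⊕ A) ⊕ (X ⊕ Y)) ⊜ (c ⊕ d) ⊕ ((A ⊕ X) ⊕ Y)) refl aᵏ cᵀ cᵏᵗ aᵏᵗ (b ∙ bᵗ) ⟩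
      (cᵀ ∙ cᵏᵗ) ∙ ((aᵏ ∙ aᵏᵗ) ∙ (b ∙ bᵗ))
        ≡⟨ cong₂ (λ d e → d ∙ (e ∙ (b ∙ bᵗ))) (×-homo-+ c (k * triangular t) (k * t)) (×-homo-+ a k (k * t)) ⟨
      (c ↑ (k * triangular t + k * t)) ∙ ((a ↑ (k + k * t)) ∙ (b ∙ bᵗ))
        ≡⟨ cong₂ (λ i j → (c ↑ i) ∙ ((a ↑ j) ∙ (b ∙ bᵗ)))
             (trans (+-comm (k * triangular t) (k * t)) (sym (*-distribˡ-+ k t (triangular t)))) (sym (*-suc k t)) ⟩
      (c ↑ (k * (t + triangular t))) ∙ ((a ↑ (k * suc t)) ∙ (b ∙ bᵗ)) ∎
      where
      open ≡-Reasoning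
      aᵏ = a ↑ k
      aᵏᵗ = a ↑ (k * t)
      bᵗ = b ↑ t
      cᵀ = c ↑ (k * triangular t)
      cᵏᵗ = c ↑ (k * t)
      cᵀ-comm : ∀ i → Commute (c ↑ i) (aᵏ ∙ b)
      cᵀ-comm i = Commute-^ i (sym (Commute-∙ (Commute-^ k (sym c-a)) (sym c-b)))

  module _ {a} M₀ (aᴹ : a ↑ suc M₀ ≡ ε) where

    -- The exponent `M₀ * i` plays the role of the negative of `i`.
    power-quotient : ∀ {y} i j → (a ↑ i) ∙ y ≡ a ↑ j → y ≡ a ↑ (M₀ * i + j)
    power-quotient {y} i j eq = ∙-cancelˡ (a ↑ i) _ _ (begin
      (a ↑ i) ∙ y                         ≡⟨ eq ⟩
      a ↑ j                               ≡⟨ identityˡ _ ⟨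
      ε ∙ (a ↑ j)
        ≡⟨ cong (_∙ (a ↑ j)) (trans (cong (a ↑_) (*-comm (suc M₀) i)) (^-multiple {a} {suc M₀} i aᴹ)) ⟨
      (a ↑ (suc M₀ * i)) ∙ (a ↑ j)        ≡⟨ ×-homo-+ a (suc M₀ * i) j ⟨
      a ↑ (i + M₀ * i + j)                ≡⟨ cong (a ↑_) (+-assoc i (M₀ * i) j) ⟩
      a ↑ (i + (M₀ * i + j))              ≡⟨ ×-homo-+ a i (M₀ * i + j) ⟩
      (a ↑ i) ∙ (a ↑ (M₀ * i + j))        ∎)
      where open ≡-Reasoning

    reduce : ∀ s → a ↑ s ≡ a ↑ (s % suc M₀)
    reduce s = begin
      a ↑ s                                       ≡⟨ cong (a ↑_) (m≡m%n+[m/n]*n s M) ⟩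
      a ↑ (s % M + s / M * M)                     ≡⟨ ×-homo-+ a (s % M) (s / M * M) ⟩
      (a ↑ (s % M)) ∙ (a ↑ (s / M * M))           ≡⟨ cong ((a ↑ (s % M)) ∙_) (^-multiple {a} {M} (s / M) aᴹ) ⟩
      (a ↑ (s % M)) ∙ ε                           ≡⟨ identityʳ _ ⟩
      a ↑ (s % M)                                 ∎
      where
      open ≡-Reasoning
      M = suc M₀

    power? : ∀ x → Dec (∃[ s ] x ≡ a ↑ s)
    power? x with anyUpTo? (λ s → x Fin.≟ a ↑ s) (suc M₀)
    ... | yes (s , _ , eq) = yes (s , eq)
    ... | no ¬power        = no λ (s , eq) → ¬power (s % suc M₀ , m%n<n s (suc M₀) , trans eq (reduce s))

  QuaternionGenerators : Set
  QuaternionGenerators = ∃[ x ] ∃[ y ] ∃[ z ] x ∙ x ≡ z × y ∙ y ≡ z × z ∙ z ≡ ε × z ≢ ε × y ∙ x ≡ z ∙ (x ∙ y)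

  -- From noncommuting pairs to quaternion generators

  module _ (dedekind : ∀ a b → ∃[ k ] a ∙ b ≡ (b ↑ k) ∙ a) where

    -- From `b a = a^k b` the commutator is `a^(k-1)`, and from `a b = b^l a` it is `b^(1-l)`. Being
    -- a power of each element, it commutes with each.
    commutator : ∀ a b → ∃[ c ] Commutator a b c × (∃[ r ] c ≡ a ↑ r) × (∃[ s ] c ≡ b ↑ s)
    commutator a b with dedekind b a | dedekind a b | torsion a | torsion b
    ... | k , ba≡ | l , ab≡ | M , aᴹ | N , bᴺ =
      c , record { swap = swap ; central = in-a C≡aʳ , in-b C≡bˢ } , C≡aʳ , C≡bˢ
      where
      open ≡-Reasoning
      c = (a ↑ k) ∙ (a ↑ M)
      c·a≡aᵏ : c ∙ a ≡ a ↑ k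
      c·a≡aᵏ = begin
        ((a ↑ k) ∙ (a ↑ M)) ∙ a   ≡⟨ assoc _ _ _ ⟩
        (a ↑ k) ∙ ((a ↑ M) ∙ a)   ≡⟨ cong ((a ↑ k) ∙_) (trans (Commute-^ M refl) aᴹ) ⟩
        (a ↑ k) ∙ ε               ≡⟨ identityʳ _ ⟩
        a ↑ k                     ∎
      swap : b ∙ a ≡ c ∙ (a ∙ b)
      swap = trans ba≡ (trans (cong (_∙ b) (sym c·a≡aᵏ)) (assoc c a b))
      C≡aʳ : ∃[ r ] c ≡ a ↑ r
      C≡aʳ = k + M , sym (×-homo-+ a k M)
      c·bˡ≡b : c ∙ (b ↑ l) ≡ b
      c·bˡ≡b = ∙-cancelʳ a _ _ (begin
        (c ∙ (b ↑ l)) ∙ a   ≡⟨ assoc _ _ _ ⟩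
        c ∙ ((b ↑ l) ∙ a)   ≡⟨ cong (c ∙_) ab≡ ⟨
        c ∙ (a ∙ b)         ≡⟨ swap ⟨
        b ∙ a               ∎)
      C≡bˢ : ∃[ s ] c ≡ b ↑ s
      C≡bˢ = suc (N * l) , trans (^-quotient {b ↑ l} {N = N} c·bˡ≡b
        (trans (×-assocˡ b (suc N) l) (trans (cong (b ↑_) (*-comm (suc N) l)) (^-multiple {b} {suc N} l bᴺ))))
        (cong (b ∙_) (×-assocˡ b N l))
      in-a : ∃[ r ] c ≡ a ↑ r → Commute c a
      in-a (r , eq) = subst (λ d → Commute d a) (sym eq) (Commute-^ r refl)
      in-b : ∃[ r ] c ≡ b ↑ r → Commute c b
      in-b (r , eq) = subst (λ d → Commute d b) (sym eq) (Commute-^ r refl)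

    module _ {S : Fin n → Set} (S-ε : S ε) (S-∙ : ∀ {x y} → S x → S y → S (x ∙ y)) where

      S-^ : ∀ {x} k → S x → S (x ↑ k)
      S-^ zero    Sx = S-ε
      S-^ (suc k) Sx = S-∙ Sx (S-^ k Sx)

      -- `S` is instantiated with the whole group, to find the quaternion generators, and with their
      -- centralizer, where `u∈` contradicts the absence of elements of order 4.
      record Involution (a : Fin n) : Set where
        field
          {c u}   : Fin n
          u∈      : S u
          u²≡c    : u ∙ u ≡ c
          c²≡ε    : c ↑ 2 ≡ ε
          c≢ε     : c ≢ ε
          commute : Commutator a u c

      -- Since b ↑ t ≡ a ↑ s with t ∣ s, multiplying b by a power of a yields b′
      -- with b′ ↑ t ∈ ⟨ c ⟩, and c is a power of b′ ↑ t because c ∈ ⟨ a ⟩ ∩ ⟨ b′ ⟩.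
      involution : ∀ {a b M p} → S a → S b → IsOrder a M → b ↑ M ≡ ε → Prime p →
        ¬ Commute a b → Commute (a ↑ p) b → Involution a
      involution {a} {b} {zero}      _ _ per _ _ _ _ = contradiction (IsPeriod.positive per) (<-irrefl refl)
      involution {a} {b} {M@(suc M₀)} {p} Sa Sb per bᴹ pp ¬ab aᵖb
        with commutator a b | period {λ k → ∃[ s ] b ↑ k ≡ a ↑ s} (λ k → power? M₀ (IsPeriod.holds per) (b ↑ k))
             (λ {k} {l} (i , bᵏ) (j , bᵏˡ) → M₀ * i + j , power-quotient M₀ (IsPeriod.holds per) i j
               (trans (cong (_∙ (b ↑ l)) (sym bᵏ)) (trans (sym (×-homo-+ b k l)) bᵏˡ)))
             {M} z<s (0 , bᴹ)
      ... | c , C , (r , c≡aʳ) , _ | zero        , per-t = contradiction (IsPeriod.positive per-t) (<-irrefl refl)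
      ... | c , C , (r , c≡aʳ) , _ | t@(suc t₀) , per-t with IsPeriod.holds per-t | IsPeriod.minimal per-t (0 , bᴹ)
      ...   | s , bᵗ≡aˢ | divides q@(suc _) M≡q*t
        -- Here `M ≡ q * t` divides `q * s`, so `t ∣ s`. It is used that `b ↑ M` is trivial.
        with *-cancelˡ-∣ q (subst (_∣ q * s) M≡q*t (IsPeriod.minimal per {q * s} (begin
            a ↑ (q * s)     ≡⟨ ×-assocˡ a q s ⟨
            (a ↑ s) ↑ q     ≡⟨ cong (_↑ q) bᵗ≡aˢ ⟨
            (b ↑ t) ↑ q     ≡⟨ ×-assocˡ b q t ⟩
            b ↑ (q * t)     ≡⟨ cong (b ↑_) M≡q*t ⟨
            b ↑ M           ≡⟨ bᴹ ⟩
            ε               ∎)))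
        where open ≡-Reasoning
      ...     | divides s′ s≡ = finish (IsPeriod.minimal per-t b^j)
        where
        open ≡-Reasoning
        open Commutator C
        aᴹ = IsPeriod.holds per
        -- Stands for the negative of `s′`, so that the powers of `a` in `b′ ↑ t` cancel.
        k = M₀ * s′
        N = k * triangular t
        b′ = (a ↑ k) ∙ b
        Sb′ : S b′
        Sb′ = S-∙ (S-^ k Sa) Sb
        arith : ∀ M₀ s t → M₀ * s * t + s * t ≡ s * t * suc M₀
        arith = solve-∀
        b′ᵗ : b′ ↑ t ≡ c ↑ N
        b′ᵗ = begin
          b′ ↑ t                                  ≡⟨ product-^ C k t ⟩
          (c ↑ N) ∙ ((a ↑ (k * t)) ∙ (b ↑ t))
            ≡⟨ cong (λ x → (c ↑ N) ∙ ((a ↑ (k * t)) ∙ x)) (trans bᵗ≡aˢ (cong (a ↑_) s≡)) ⟩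
          (c ↑ N) ∙ ((a ↑ (k * t)) ∙ (a ↑ (s′ * t))) ≡⟨ cong ((c ↑ N) ∙_) (×-homo-+ a (k * t) (s′ * t)) ⟨
          (c ↑ N) ∙ (a ↑ (k * t + s′ * t))        ≡⟨ cong (λ i → (c ↑ N) ∙ (a ↑ i)) (arith M₀ s′ t) ⟩
          (c ↑ N) ∙ (a ↑ (s′ * t * M))            ≡⟨ cong ((c ↑ N) ∙_) (^-multiple {a} {M} (s′ * t) aᴹ) ⟩
          (c ↑ N) ∙ ε                             ≡⟨ identityʳ _ ⟩
          c ↑ N                                   ∎
        swap′ : b′ ∙ a ≡ c ∙ (a ∙ b′)
        swap′ = begin
          ((a ↑ k) ∙ b) ∙ a           ≡⟨ assoc _ _ _ ⟩
          (a ↑ k) ∙ (b ∙ a)           ≡⟨ cong ((a ↑ k) ∙_) swap ⟩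
          (a ↑ k) ∙ (c ∙ (a ∙ b))
            ≡⟨ solve 4 (λ A c a b → A ⊕ (c ⊕ (a ⊕ b)) ⊜ (A ⊕ (c ⊕ a)) ⊕ b) refl (a ↑ k) c a b ⟩
          ((a ↑ k) ∙ (c ∙ a)) ∙ b
            ≡⟨ cong (_∙ b) (Commute-∙ {c} {a} {a ↑ k} (sym (Commute-^ k (sym c-a))) (sym (Commute-^ k refl))) ⟨
          ((c ∙ a) ∙ (a ↑ k)) ∙ b
            ≡⟨ solve 4 (λ A c a b → ((c ⊕ a) ⊕ A) ⊕ b ⊜ c ⊕ (a ⊕ (A ⊕ b))) refl (a ↑ k) c a b ⟩
          c ∙ (a ∙ ((a ↑ k) ∙ b))     ∎
        C′ = commutator a b′
        j = proj₁ (proj₂ (proj₂ (proj₂ C′)))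
        c≡b′ʲ : c ≡ b′ ↑ j
        c≡b′ʲ = trans (sym (commutator-unique (proj₁ (proj₂ C′)) swap′)) (proj₂ (proj₂ (proj₂ (proj₂ C′))))
        -- `c ≡ b′ ↑ j` is a power of `a`, and the product formula turns this into a statement on
        -- `b ↑ j`; the minimality of `t` then gives `t ∣ j`.
        b^j : ∃[ i ] b ↑ j ≡ a ↑ i
        b^j = M₀ * (k * triangular j * r + k * j) + r , power-quotient M₀ aᴹ (k * triangular j * r + k * j) r (begin
          (a ↑ (k * triangular j * r + k * j)) ∙ (b ↑ j)
            ≡⟨ cong (_∙ (b ↑ j)) (×-homo-+ a (k * triangular j * r) (k * j)) ⟩
          ((a ↑ (k * triangular j * r)) ∙ (a ↑ (k * j))) ∙ (b ↑ j)  ≡⟨ assoc _ _ _ ⟩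
          (a ↑ (k * triangular j * r)) ∙ ((a ↑ (k * j)) ∙ (b ↑ j))
            ≡⟨ cong (_∙ ((a ↑ (k * j)) ∙ (b ↑ j)))
                 (trans (cong (_↑ (k * triangular j)) c≡aʳ) (×-assocˡ a (k * triangular j) r)) ⟨
          (c ↑ (k * triangular j)) ∙ ((a ↑ (k * j)) ∙ (b ↑ j))      ≡⟨ product-^ C k j ⟨
          b′ ↑ j                                                    ≡⟨ c≡b′ʲ ⟨
          c                                                         ≡⟨ c≡aʳ ⟩
          a ↑ r                                                     ∎)
        c≢ε : c ≢ ε
        c≢ε = noncommuting ¬ab
        cᵖ : c ↑ p ≡ ε
        cᵖ = swap-ε⁻¹ p aᵖb
        finish : t ∣ j → Involution a
        finish (divides q′ j≡) = record
          { u∈      = S-^ h Sb′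
          ; u²≡c    = u²≡c
          ; c²≡ε    = c²≡ε
          ; c≢ε     = c≢ε
          ; commute = record
            { swap    = subst (λ d → u ∙ a ≡ d ∙ (a ∙ u)) (odd^ c²≡ε 2∤h) (Commutator.^-swap C″ h)
            ; central = c-a , subst (λ d → Commute d u) u²≡c (Commute-∙ refl refl)
            }
          }
          where
          C″ : Commutator a b′ c
          C″ = record { swap = swap′ ; central = c-a , subst (λ d → Commute d b′) (sym c≡b′ʲ) (Commute-^ j refl) }
          -- Since `t ∣ j`, the element `c` is a power of `b′ ↑ t ≡ c ↑ N`, which cannot be trivial.
          p∤N : ¬ p ∣ N
          p∤N (divides i N≡) = c≢ε (begin
            c              ≡⟨ c≡b′ʲ ⟩
            b′ ↑ j         ≡⟨ cong (b′ ↑_) j≡ ⟩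
            b′ ↑ (q′ * t)  ≡⟨ ×-assocˡ b′ q′ t ⟨
            (b′ ↑ t) ↑ q′  ≡⟨ cong (_↑ q′) (trans b′ᵗ (trans (cong (c ↑_) N≡) (^-multiple {c} {p} i cᵖ))) ⟩
            ε ↑ q′         ≡⟨ ε^ q′ ⟩
            ε              ∎)
          -- `b ↑ t` is a power of `a` and commutes with it, so `c ↑ t` is trivial.
          p∣t : p ∣ t
          p∣t = prime^ pp c≢ε cᵖ (ε-swap⁻¹ t (subst (Commute a) (sym bᵗ≡aˢ) (sym (Commute-^ s refl))))
          -- `p` divides `2 * triangular t`, a multiple of `t`, but not `triangular t`, a divisor of
          -- `N`.
          p≡2 : p ≡ 2
          p≡2 with euclidsLemma 2 (triangular t) pp (subst (p ∣_) (sym (2*triangular t₀)) (∣-trans p∣t (m∣m*n t₀)))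
          ... | inj₁ p∣2 = ≤-antisym (∣⇒≤ p∣2) (prime>1 pp)
          ... | inj₂ p∣T = contradiction (∣-trans p∣T (n∣m*n k)) p∤N
          c²≡ε : c ↑ 2 ≡ ε
          c²≡ε = subst (λ i → c ↑ i ≡ ε) p≡2 cᵖ
          2∣t : 2 ∣ t
          2∣t = subst (_∣ t) p≡2 p∣t
          h = quotient 2∣t
          t≡h*2 : t ≡ h * 2
          t≡h*2 = _∣_.equality 2∣t
          u = b′ ↑ h
          u²≡c : u ∙ u ≡ c
          u²≡c = begin
            (b′ ↑ h) ∙ (b′ ↑ h)  ≡⟨ ×-homo-+ b′ h h ⟨
            b′ ↑ (h + h)
              ≡⟨ cong (b′ ↑_) (trans (cong (h +_) (sym (+-identityʳ h))) (trans (*-comm 2 h) (sym t≡h*2))) ⟩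
            b′ ↑ t               ≡⟨ b′ᵗ ⟩
            c ↑ N                ≡⟨ odd^ c²≡ε (λ 2∣N → p∤N (subst (_∣ N) (sym p≡2) 2∣N)) ⟩
            c                    ∎
          -- `triangular t` equals `h` times the predecessor of `t`, so an even `h` would make `N`
          -- even.
          2∤h : ¬ 2 ∣ h
          2∤h 2∣h = p∤N (subst (_∣ N) (sym p≡2) (∣-trans (subst (2 ∣_) (sym T≡) (∣-trans 2∣h (m∣m*n t₀))) (n∣m*n k)))
            where
            arith₂ : ∀ h t → h * 2 * t ≡ 2 * (h * t)
            arith₂ = solve-∀
            T≡ : triangular t ≡ h * t₀
            T≡ = *-cancelˡ-≡ _ _ 2 (trans (2*triangular t₀) (trans (cong (_* t₀) t≡h*2) (arith₂ h t₀)))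

      swap-power : ∀ {a b} p → Commute (a ↑ p) b → Commute (b ↑ p) a
      swap-power {a} {b} p aᵖb with commutator a b
      ... | _ , C , _ = sym (Commutator.ε-swap C p (Commutator.swap-ε⁻¹ C p aᵖb))

      -- Raising `a` to the part `m′` of its order prime to `p` raises the commutator to the power
      -- `m′`, which is nontrivial because the commutator has order `p`.
      primary-part : ∀ {a b p} → Prime p → S a → ¬ Commute a b → Commute (a ↑ p) b →
        ∃[ a′ ] ∃[ i ] S a′ × IsOrder a′ (p ^ i) × ¬ Commute a′ b × Commute (a′ ↑ p) b
      primary-part {a} {b} {p} pp Sa ¬ab aᵖb with order a
      ... | m , per with prime-part pp (IsPeriod.positive per) | commutator a b
      ...   | i , m′ , refl , p∤m′ | c , C , _ = a ↑ m′ , i , S-^ m′ Sa , record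
          { positive = m^n>0 p {{prime⇒nonZero pp}} i
          ; holds    = trans (×-assocˡ a (p ^ i) m′) (IsPeriod.holds per)
          ; minimal  = λ {k} eq → *-cancelʳ-∣ m′ {{≢-nonZero λ { refl → p∤m′ (p ∣0) }}}
                                    (IsPeriod.minimal per (trans (sym (×-assocˡ a k m′)) eq))
          } , ¬a′b , subst (λ x → Commute x b)
              (trans (×-assocˡ a m′ p) (trans (cong (a ↑_) (*-comm m′ p)) (sym (×-assocˡ a p m′))))
                       (Commute-^ m′ aᵖb)
          where
          open Commutator C
          ¬a′b : ¬ Commute (a ↑ m′) b
          ¬a′b a′b = p∤m′ (prime^ pp (noncommuting ¬ab) (swap-ε⁻¹ p aᵖb) (swap-ε⁻¹ m′ a′b))

      -- If `f * p` is the order of the commutator of `a` and `b`, then that of `a ↑ f` and `b` has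
      -- order `p`.
      prime-commutator : ∀ {a b} → S a → ¬ Commute a b →
        ∃[ p ] ∃[ a′ ] Prime p × S a′ × ¬ Commute a′ b × Commute (a′ ↑ p) b
      prime-commutator {a} {b} Sa ¬ab with commutator a b
      ... | c , C , _ with order c
      ...   | e , per with ∃-prime-divisor e (≤∧≢⇒< (IsPeriod.positive per)
                             λ { refl → Commutator.noncommuting C ¬ab (trans (sym (identityʳ c)) (IsPeriod.holds per)) })
      ...     | p , pp , divides zero refl = contradiction (IsPeriod.positive per) (<-irrefl refl)
      ...     | p , pp , divides f@(suc _) refl = p , a ↑ f , pp , S-^ f Sa ,
        (λ a′b → contradiction (∣⇒≤ (IsPeriod.minimal per (swap-ε⁻¹ f a′b))) (<⇒≱ (m<m*n f p (prime>1 pp)))) ,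
        subst (λ x → Commute x b) (sym (×-assocˡ a p f))
          (swap-ε (p * f) (subst (λ k → c ↑ k ≡ ε) (*-comm f p) (IsPeriod.holds per)))
        where open Commutator C

      ^-raise : ∀ {x i j} p → i ≤ j → x ↑ (p ^ i) ≡ ε → x ↑ (p ^ j) ≡ ε
      ^-raise {x} {i} {j} p i≤j eq = subst (λ k → x ↑ k ≡ ε)
        (trans (sym (^-distribˡ-+-* p (j ∸ i) i)) (cong (p ^_) (m∸n+n≡m i≤j))) (^-multiple {x} {p ^ i} (p ^ (j ∸ i)) eq)

      -- `involution` requires the order of its first element to annihilate the second one. Orders
      -- that are powers of the same prime are comparable, so the element of larger order goes
      -- first.
      primary⇒involution : ∀ {a b p i j} → Prime p → S a → S b → IsOrder a (p ^ i) → IsOrder b (p ^ j) →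
        ¬ Commute a b → Commute (a ↑ p) b → ∃[ a′ ] Involution a′
      primary⇒involution {a} {b} {p} {i} {j} pp Sa Sb per-a per-b ¬ab aᵖb with ≤-total i j
      ... | inj₁ i≤j = b , involution Sb Sa per-b (^-raise p i≤j (IsPeriod.holds per-a)) pp
                             (λ ba → ¬ab (sym ba)) (swap-power p aᵖb)
      ... | inj₂ j≤i = a , involution Sa Sb per-a (^-raise p j≤i (IsPeriod.holds per-b)) pp ¬ab aᵖb

      nonabelian⇒involution : ∀ {a b} → S a → S b → ¬ Commute a b → ∃[ a′ ] Involution a′
      nonabelian⇒involution Sa Sb ¬ab =
        let p , a₁ , pp , Sa₁ , ¬a₁b , a₁ᵖb = prime-commutator Sa ¬ab
            a₂ , i , Sa₂ , per-a , ¬a₂b , a₂ᵖb = primary-part pp Sa₁ ¬a₁b a₁ᵖb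
            b₂ , j , Sb₂ , per-b , ¬b₂a₂ , b₂ᵖa₂ = primary-part pp Sb (λ ba₂ → ¬a₂b (sym ba₂)) (swap-power p a₂ᵖb)
        in primary⇒involution {i = j} {j = i} pp Sb₂ Sa₂ per-b per-a ¬b₂a₂ b₂ᵖa₂

      -- In the cyclic group generated by `a`, of order `M`, the element `c` of order 2 is
      -- `a^(M/2)`. It commutes with `u`, which forces `M/2` to be even, so `a^(M/4)` is a square
      -- root of `c`. If `M/4` is odd, its commutator with `u` is `c`.
      square-root : ∀ {a} → Involution a → QuaternionGenerators
      square-root {a} I with order a | commutator a (Involution.u I)
      ... | M , per | _ , C′ , (r , C′≡aʳ) , _ = even-order 2∣M
        where
        open Involution I
        open Commutator commute
        open ≡-Reasoning
        c≡aʳ : c ≡ a ↑ r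
        c≡aʳ = trans (sym (commutator-unique C′ swap)) C′≡aʳ
        M∣r*2 : M ∣ 2 * r
        M∣r*2 = IsPeriod.minimal per (trans (sym (×-assocˡ a 2 r)) (trans (cong (_↑ 2) (sym c≡aʳ)) c²≡ε))
        q = quotient M∣r*2
        r*2≡ : 2 * r ≡ q * M
        r*2≡ = _∣_.equality M∣r*2
        2∤q : ¬ 2 ∣ q
        2∤q (divides q′ q≡) = c≢ε (begin
          c              ≡⟨ c≡aʳ ⟩
          a ↑ r
            ≡⟨ cong (a ↑_) (*-cancelˡ-≡ r (q′ * M) 2 (trans r*2≡ (trans (cong (_* M) q≡) (arith q′ M)))) ⟩
          a ↑ (q′ * M)   ≡⟨ ^-multiple {a} {M} q′ (IsPeriod.holds per) ⟩
          ε              ∎)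
          where
          arith : ∀ q m → q * 2 * m ≡ 2 * (q * m)
          arith = solve-∀
        2∣M : 2 ∣ M
        2∣M with euclidsLemma q M prime[2] (subst (2 ∣_) r*2≡ (m∣m*n r))
        ... | inj₁ 2∣q = contradiction 2∣q 2∤q
        ... | inj₂ 2∣M = 2∣M
        even-order : 2 ∣ M → QuaternionGenerators
        even-order (divides M₁ M≡) = decide (2 ∣? M₁)
          where
          arith : ∀ q m → q * (m * 2) ≡ 2 * (q * m)
          arith = solve-∀
          aᴹ¹² : (a ↑ M₁) ↑ 2 ≡ ε
          aᴹ¹² = trans (×-assocˡ a 2 M₁) (trans (cong (a ↑_) (trans (*-comm 2 M₁) (sym M≡))) (IsPeriod.holds per))
          c≡aᴹ¹ : c ≡ a ↑ M₁
          c≡aᴹ¹ = begin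
            c               ≡⟨ c≡aʳ ⟩
            a ↑ r
              ≡⟨ cong (a ↑_) (*-cancelˡ-≡ r (q * M₁) 2 (trans r*2≡ (trans (cong (q *_) M≡) (arith q M₁)))) ⟩
            a ↑ (q * M₁)    ≡⟨ ×-assocˡ a q M₁ ⟨
            (a ↑ M₁) ↑ q    ≡⟨ odd^ aᴹ¹² 2∤q ⟩
            a ↑ M₁          ∎
          decide : Dec (2 ∣ M₁) → QuaternionGenerators
          decide (no 2∤M₁) = contradiction (trans (sym (odd^ c²≡ε 2∤M₁))
            (swap-ε⁻¹ M₁ (subst (λ x → Commute x u) c≡aᴹ¹ (proj₂ central)))) c≢ε
          decide (yes (divides M₂ M₁≡)) = root (2 ∣? M₂)
            where
            x = a ↑ M₂
            x²≡c : x ∙ x ≡ c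
            x²≡c = begin
              x ∙ x            ≡⟨ ×-homo-+ a M₂ M₂ ⟨
              a ↑ (M₂ + M₂)
                ≡⟨ cong (a ↑_) (trans (cong (M₂ +_) (sym (+-identityʳ M₂))) (trans (*-comm 2 M₂) (sym M₁≡))) ⟩
              a ↑ M₁           ≡⟨ c≡aᴹ¹ ⟨
              c                ∎
            c∙c≡ε : c ∙ c ≡ ε
            c∙c≡ε = trans (cong (c ∙_) (sym (identityʳ c))) c²≡ε
            root : Dec (2 ∣ M₂) → QuaternionGenerators
            root (no 2∤M₂) = x , u , c , x²≡c , u²≡c , c∙c≡ε , c≢ε ,
              subst (λ d → u ∙ x ≡ d ∙ (x ∙ u)) (odd^ c²≡ε 2∤M₂) (swap-^ M₂)
            -- Now `x` and `u` commute, so `w` has trivial square. Its commutator `c` with `a` is a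
            -- power of `w`, hence `ε` or `w`; in the latter case `w` commutes with `a`, and `c` is
            -- again trivial.
            root (yes 2∣M₂) with commutator a (u ∙ x)
            ... | _ , C″ , _ , (s , C″≡wˢ) = contradiction c≡ε c≢ε
              where
              w = u ∙ x
              ux≡xu : u ∙ x ≡ x ∙ u
              ux≡xu = sym (swap-ε M₂ (even^ c²≡ε 2∣M₂))
              w²≡ε : w ↑ 2 ≡ ε
              w²≡ε = begin
                w ∙ (w ∙ ε)              ≡⟨ cong (w ∙_) (identityʳ w) ⟩
                (u ∙ x) ∙ (u ∙ x)        ≡⟨ cong ((u ∙ x) ∙_) ux≡xu ⟩
                (u ∙ x) ∙ (x ∙ u)        ≡⟨ solve 2 (λ u x → (u ⊕ x) ⊕ (x ⊕ u) ⊜ u ⊕ ((x ⊕ x) ⊕ u)) refl u x ⟩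
                u ∙ ((x ∙ x) ∙ u)        ≡⟨ cong (λ d → u ∙ (d ∙ u)) x²≡c ⟩
                u ∙ (c ∙ u)              ≡⟨ cong (u ∙_) (proj₂ central) ⟩
                u ∙ (u ∙ c)              ≡⟨ assoc u u c ⟨
                (u ∙ u) ∙ c              ≡⟨ cong (_∙ c) u²≡c ⟩
                c ∙ c                    ≡⟨ c∙c≡ε ⟩
                ε                        ∎
              w-swap : w ∙ a ≡ c ∙ (a ∙ w)
              w-swap = begin
                (u ∙ x) ∙ a              ≡⟨ assoc u x a ⟩
                u ∙ (x ∙ a)              ≡⟨ cong (u ∙_) (Commute-^ M₂ refl) ⟩
                u ∙ (a ∙ x)              ≡⟨ assoc u a x ⟨
                (u ∙ a) ∙ x              ≡⟨ cong (_∙ x) swap ⟩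
                (c ∙ (a ∙ u)) ∙ x
                  ≡⟨ solve 4 (λ c a u x → (c ⊕ (a ⊕ u)) ⊕ x ⊜ c ⊕ (a ⊕ (u ⊕ x))) refl c a u x ⟩
                c ∙ (a ∙ w)              ∎
              c≡wˢ : c ≡ w ↑ s
              c≡wˢ = trans (sym (commutator-unique C″ w-swap)) C″≡wˢ
              c≡ε : c ≡ ε
              c≡ε with 2 ∣? s
              ... | yes 2∣s = trans c≡wˢ (even^ w²≡ε 2∣s)
              ... | no  2∤s = ∙-cancelʳ (a ∙ w) c ε (begin
                c ∙ (a ∙ w)              ≡⟨ w-swap ⟨
                w ∙ a                    ≡⟨ cong (_∙ a) (trans c≡wˢ (odd^ w²≡ε 2∤s)) ⟨
                c ∙ a                    ≡⟨ proj₁ central ⟩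
                a ∙ c                    ≡⟨ cong (a ∙_) (trans c≡wˢ (odd^ w²≡ε 2∤s)) ⟩
                a ∙ w                    ≡⟨ identityˡ _ ⟨
                ε ∙ (a ∙ w)              ∎)

    four-powers : ∀ {v d} → v ∙ v ≡ d → d ∙ d ≡ ε → ∀ k →
      (v ↑ k ≡ ε ⊎ v ↑ k ≡ v) ⊎ (v ↑ k ≡ d ⊎ v ↑ k ≡ d ∙ v)
    four-powers                 vv dd zero    = inj₁ (inj₁ refl)
    four-powers {v} {d} vv dd (suc k) with four-powers vv dd k
    ... | inj₁ (inj₁ eq) = inj₁ (inj₂ (trans (cong (v ∙_) eq) (identityʳ v)))
    ... | inj₁ (inj₂ eq) = inj₂ (inj₁ (trans (cong (v ∙_) eq) vv))
    ... | inj₂ (inj₁ eq) = inj₂ (inj₂ (trans (cong (v ∙_) eq) (subst (λ d → v ∙ d ≡ d ∙ v) vv (sym (assoc v v v)))))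
    ... | inj₂ (inj₂ eq) = inj₁ (inj₁ (begin
      v ∙ (v ↑ k)    ≡⟨ cong (v ∙_) eq ⟩
      v ∙ (d ∙ v)    ≡⟨ cong (λ d → v ∙ (d ∙ v)) vv ⟨
      v ∙ ((v ∙ v) ∙ v) ≡⟨ solve 1 (λ v → v ⊕ ((v ⊕ v) ⊕ v) ⊜ (v ⊕ v) ⊕ (v ⊕ v)) refl v ⟩
      (v ∙ v) ∙ (v ∙ v) ≡⟨ cong₂ _∙_ vv vv ⟩
      d ∙ d          ≡⟨ dd ⟩
      ε              ∎))
      where open ≡-Reasoning

    -- The centralizer of the quaternion generators

    module Quaternion {x y z} (x² : x ∙ x ≡ z) (y² : y ∙ y ≡ z) (z² : z ∙ z ≡ ε) (z≢ε : z ≢ ε)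
                      (yx : y ∙ x ≡ z ∙ (x ∙ y)) where
      open ≡-Reasoning

      twist : Bool → Fin n
      twist b = if b then z else ε

      twist-xor : ∀ a b → twist (a ⊻ b) ≡ twist a ∙ twist b
      twist-xor false b     = sym (identityˡ _)
      twist-xor true  false = sym (identityʳ z)
      twist-xor true  true  = sym z²

      z-x : Commute z x
      z-x = subst (λ d → Commute d x) x² (Commute-∙ refl refl)

      z-y : Commute z y
      z-y = subst (λ d → Commute d y) y² (Commute-∙ refl refl)

      twist-swap : ∀ {g v} → Commute z v → g ∙ v ≡ z ∙ (v ∙ g) → g ∙ (v ∙ v) ≡ (v ∙ v) ∙ g
      twist-swap {g} {v} zv gv = begin
        g ∙ (v ∙ v)               ≡⟨ assoc g v v ⟨
        (g ∙ v) ∙ v               ≡⟨ cong (_∙ v) gv ⟩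
        (z ∙ (v ∙ g)) ∙ v         ≡⟨ solve 3 (λ z v g → (z ⊕ (v ⊕ g)) ⊕ v ⊜ (z ⊕ v) ⊕ (g ⊕ v)) refl z v g ⟩
        (z ∙ v) ∙ (g ∙ v)         ≡⟨ cong₂ _∙_ zv gv ⟩
        (v ∙ z) ∙ (z ∙ (v ∙ g))
          ≡⟨ solve 3 (λ z v g → (v ⊕ z) ⊕ (z ⊕ (v ⊕ g)) ⊜ v ⊕ ((z ⊕ z) ⊕ (v ⊕ g))) refl z v g ⟩
        v ∙ ((z ∙ z) ∙ (v ∙ g))   ≡⟨ cong (λ d → v ∙ (d ∙ (v ∙ g))) z² ⟩
        v ∙ (ε ∙ (v ∙ g))         ≡⟨ cong (v ∙_) (identityˡ _) ⟩
        v ∙ (v ∙ g)               ≡⟨ assoc v v g ⟨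
        (v ∙ v) ∙ g               ∎

      -- The conjugate of `v` by `g` is a power of `v` and has order 4 like `v`, so only `v` and its
      -- inverse `z ∙ v` remain.
      sign-exists : ∀ {v} → v ∙ v ≡ z → ∀ g → ∃[ b ] g ∙ v ≡ twist b ∙ (v ∙ g)
      sign-exists {v} v² g with dedekind g v
      ... | k , gv≡ with four-powers v² z² k
      ...   | inj₁ (inj₁ eq) = contradiction (trans (sym v²) (trans (cong₂ _∙_ v≡ε v≡ε) (identityˡ ε))) z≢ε
        where
        v≡ε : v ≡ ε
        v≡ε = ∙-cancelˡ g v ε (trans gv≡ (trans (cong (_∙ g) eq) (trans (identityˡ g) (sym (identityʳ g)))))
      ...   | inj₁ (inj₂ eq) = false , trans gv≡ (trans (cong (_∙ g) eq) (sym (identityˡ _)))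
      ...   | inj₂ (inj₂ eq) = true , trans gv≡ (trans (cong (_∙ g) eq) (assoc z v g))
      ...   | inj₂ (inj₁ eq) = contradiction z≡ε z≢ε
        where
        gv≡zg : g ∙ v ≡ z ∙ g
        gv≡zg = trans gv≡ (cong (_∙ g) eq)
        z≡ε : z ≡ ε
        z≡ε = ∙-cancelˡ g z ε (begin
          g ∙ z          ≡⟨ cong (g ∙_) v² ⟨
          g ∙ (v ∙ v)    ≡⟨ assoc g v v ⟨
          (g ∙ v) ∙ v    ≡⟨ cong (_∙ v) gv≡zg ⟩
          (z ∙ g) ∙ v    ≡⟨ assoc z g v ⟩
          z ∙ (g ∙ v)    ≡⟨ cong (z ∙_) gv≡zg ⟩
          z ∙ (z ∙ g)    ≡⟨ assoc z z g ⟨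
          (z ∙ z) ∙ g    ≡⟨ cong (_∙ g) z² ⟩
          ε ∙ g          ≡⟨ identityˡ g ⟩
          g              ≡⟨ identityʳ g ⟨
          g ∙ ε          ∎)

      -- Conjugation by `g` fixes or inverts `x`, and in both cases it fixes the square of `x`.
      z-central : ∀ g → Commute z g
      z-central g with sign-exists x² g
      ... | true  , gx = sym (subst (λ d → g ∙ d ≡ d ∙ g) x² (twist-swap z-x gx))
      ... | false , gx = subst (λ d → Commute d g) x² (Commute-∙ xg xg)
        where
        xg : Commute x g
        xg = sym (trans gx (identityˡ _))

      twist-central : ∀ b g → Commute (twist b) g
      twist-central true  g = z-central g
      twist-central false g = Commute-ε

      twist-injective : ∀ {a b} → twist a ≡ twist b → a ≡ b
      twist-injective {false} {false} _  = refl
      twist-injective {true}  {true}  _  = refl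
      twist-injective {false} {true}  eq = contradiction (sym eq) z≢ε
      twist-injective {true}  {false} eq = contradiction eq z≢ε

      module Sign {v} (v² : v ∙ v ≡ z) where

        sign : Fin n → Bool
        sign g = proj₁ (sign-exists v² g)

        sign-swap : ∀ g → g ∙ v ≡ twist (sign g) ∙ (v ∙ g)
        sign-swap g = proj₂ (sign-exists v² g)

        sign-unique : ∀ {g b} → g ∙ v ≡ twist b ∙ (v ∙ g) → sign g ≡ b
        sign-unique {g} eq = twist-injective (∙-cancelʳ (v ∙ g) _ _ (trans (sym (sign-swap g)) eq))

        sign-∙ : ∀ g h → sign (g ∙ h) ≡ sign g ⊻ sign h
        sign-∙ g h = sign-unique (begin
          (g ∙ h) ∙ v                      ≡⟨ assoc g h v ⟩
          g ∙ (h ∙ v)                      ≡⟨ cong (g ∙_) (sign-swap h) ⟩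
          g ∙ (s ∙ (v ∙ h))                ≡⟨ assoc g s (v ∙ h) ⟨
          (g ∙ s) ∙ (v ∙ h)                ≡⟨ cong (_∙ (v ∙ h)) (twist-central (sign h) g) ⟨
          (s ∙ g) ∙ (v ∙ h)
            ≡⟨ solve 4 (λ s g v h → (s ⊕ g) ⊕ (v ⊕ h) ⊜ s ⊕ ((g ⊕ v) ⊕ h)) refl s g v h ⟩
          s ∙ ((g ∙ v) ∙ h)                ≡⟨ cong (λ d → s ∙ (d ∙ h)) (sign-swap g) ⟩
          s ∙ ((r ∙ (v ∙ g)) ∙ h)
            ≡⟨ solve 5 (λ s g v h r → s ⊕ ((r ⊕ (v ⊕ g)) ⊕ h) ⊜ (s ⊕ r) ⊕ (v ⊕ (g ⊕ h))) refl s g v h r ⟩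
          (s ∙ r) ∙ (v ∙ (g ∙ h))
            ≡⟨ cong (_∙ (v ∙ (g ∙ h))) (trans (twist-central (sign h) r) (sym (twist-xor (sign g) (sign h)))) ⟩
          twist (sign g ⊻ sign h) ∙ (v ∙ (g ∙ h)) ∎)
          where
          s = twist (sign h)
          r = twist (sign g)

      module X = Sign x²
      module Y = Sign y²

      Centralizer : Fin n → Set
      Centralizer g = Y.sign g ≡ false × X.sign g ≡ false

      centralizes-y : ∀ {g} → Centralizer g → Commute g y
      centralizes-y {g} (eq , _) = trans (Y.sign-swap g) (trans (cong (λ b → twist b ∙ (y ∙ g)) eq) (identityˡ _))

      centralizes-x : ∀ {g} → Centralizer g → Commute g x
      centralizes-x {g} (_ , eq) = trans (X.sign-swap g) (trans (cong (λ b → twist b ∙ (x ∙ g)) eq) (identityˡ _))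

      Centralizer-ε : Centralizer ε
      Centralizer-ε =
        Y.sign-unique (trans (Commute-ε {y}) (sym (identityˡ _))) ,
        X.sign-unique (trans (Commute-ε {x}) (sym (identityˡ _)))

      Centralizer-∙ : ∀ {g h} → Centralizer g → Centralizer h → Centralizer (g ∙ h)
      Centralizer-∙ {g} {h} (yg , xg) (yh , xh) =
        trans (Y.sign-∙ g h) (cong₂ _⊻_ yg yh) ,
        trans (X.sign-∙ g h) (cong₂ _⊻_ xg xh)

      -- If u had order 4 in the centralizer, then z ∉ ⟨ x ∙ u ⟩, although z = [ y , x ∙ u ].
      no-order-4 : ∀ {u c} → Centralizer u → u ∙ u ≡ c → c ∙ c ≡ ε → c ≡ ε
      no-order-4 {u} {c} Cu u² c² = analyse (four-powers w² (begin
          (z ∙ c) ∙ (z ∙ c)   ≡⟨ cong ((z ∙ c) ∙_) (z-central c) ⟩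
          (z ∙ c) ∙ (c ∙ z)   ≡⟨ solve 2 (λ z c → (z ⊕ c) ⊕ (c ⊕ z) ⊜ z ⊕ ((c ⊕ c) ⊕ z)) refl z c ⟩
          z ∙ ((c ∙ c) ∙ z)   ≡⟨ cong (λ d → z ∙ (d ∙ z)) c² ⟩
          z ∙ (ε ∙ z)         ≡⟨ cong (z ∙_) (identityˡ z) ⟩
          z ∙ z               ≡⟨ z² ⟩
          ε                   ∎) k)
        where
        w = x ∙ u
        w² : w ∙ w ≡ z ∙ c
        w² = begin
          (x ∙ u) ∙ (x ∙ u)   ≡⟨ solve 2 (λ x u → (x ⊕ u) ⊕ (x ⊕ u) ⊜ x ⊕ ((u ⊕ x) ⊕ u)) refl x u ⟩
          x ∙ ((u ∙ x) ∙ u)   ≡⟨ cong (λ d → x ∙ (d ∙ u)) (centralizes-x Cu) ⟩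
          x ∙ ((x ∙ u) ∙ u)   ≡⟨ solve 2 (λ x u → x ⊕ ((x ⊕ u) ⊕ u) ⊜ (x ⊕ x) ⊕ (u ⊕ u)) refl x u ⟩
          (x ∙ x) ∙ (u ∙ u)   ≡⟨ cong₂ _∙_ x² u² ⟩
          z ∙ c               ∎
        yw : y ∙ w ≡ z ∙ (w ∙ y)
        yw = begin
          y ∙ (x ∙ u)         ≡⟨ assoc y x u ⟨
          (y ∙ x) ∙ u         ≡⟨ cong (_∙ u) yx ⟩
          (z ∙ (x ∙ y)) ∙ u   ≡⟨ solve 4 (λ z x y u → (z ⊕ (x ⊕ y)) ⊕ u ⊜ z ⊕ (x ⊕ (y ⊕ u))) refl z x y u ⟩
          z ∙ (x ∙ (y ∙ u))   ≡⟨ cong (λ d → z ∙ (x ∙ d)) (centralizes-y Cu) ⟨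
          z ∙ (x ∙ (u ∙ y))   ≡⟨ cong (z ∙_) (assoc x u y) ⟨
          z ∙ (w ∙ y)         ∎
        k = proj₁ (dedekind y w)
        wᵏ : w ↑ k ≡ z ∙ w
        wᵏ = ∙-cancelʳ y _ _ (trans (sym (proj₂ (dedekind y w))) (trans yw (sym (assoc z w y))))
        noncommuting : ¬ Commute w y
        noncommuting wy = z≢ε (∙-cancelʳ (w ∙ y) z ε (trans (sym yw) (trans (sym wy) (sym (identityˡ _)))))
        analyse : (w ↑ k ≡ ε ⊎ w ↑ k ≡ w) ⊎ (w ↑ k ≡ z ∙ c ⊎ w ↑ k ≡ (z ∙ c) ∙ w) → c ≡ ε
        analyse (inj₁ (inj₁ eq)) = contradiction (subst (λ d → Commute d y) z≡w z-y) noncommuting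
          where
          z≡w : z ≡ w
          z≡w = ∙-cancelˡ z z w (trans z² (trans (sym eq) wᵏ))
        analyse (inj₁ (inj₂ eq)) = contradiction (∙-cancelʳ w z ε (trans (sym wᵏ) (trans eq (sym (identityˡ w))))) z≢ε
        analyse (inj₂ (inj₁ eq)) = contradiction (subst (λ d → Commute d y) (∙-cancelˡ z c w (trans (sym eq) wᵏ))
          (subst (λ d → Commute d y) u² (Commute-∙ (centralizes-y Cu) (centralizes-y Cu)))) noncommuting
        analyse (inj₂ (inj₂ eq)) = ∙-cancelʳ w c ε (∙-cancelˡ z _ _
          (trans (sym (assoc z c w)) (trans (sym eq) (trans wᵏ (cong (z ∙_) (sym (identityˡ w)))))))

      no-involution : ∀ {a} → ¬ Involution Centralizer-ε Centralizer-∙ a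
      no-involution I = c≢ε (no-order-4 u∈ u²≡c (trans (cong (c ∙_) (sym (identityʳ c))) c²≡ε))
        where open Involution I

      centralizer-abelian : ∀ {g h} → Centralizer g → Centralizer h → Commute g h
      centralizer-abelian {g} {h} Cg Ch = decidable-stable (g ∙ h Fin.≟ h ∙ g)
        λ ¬gh → no-involution (proj₂ (nonabelian⇒involution Centralizer-ε Centralizer-∙ Cg Ch ¬gh))

      -- The roles are crossed: `x` commutes with itself but not with `y`, so the exponent of `x` is
      -- read off by `Y.sign` and that of `y` by `X.sign`.
      sign-x : Y.sign x ≡ true × X.sign x ≡ false
      sign-x = Y.sign-unique (sym (begin
          z ∙ (y ∙ x)          ≡⟨ cong (z ∙_) yx ⟩
          z ∙ (z ∙ (x ∙ y))    ≡⟨ assoc z z (x ∙ y) ⟨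
          (z ∙ z) ∙ (x ∙ y)    ≡⟨ cong (_∙ (x ∙ y)) z² ⟩
          ε ∙ (x ∙ y)          ≡⟨ identityˡ _ ⟩
          x ∙ y                ∎)) , X.sign-unique (sym (identityˡ _))

      sign-y : Y.sign y ≡ false × X.sign y ≡ true
      sign-y = Y.sign-unique (sym (identityˡ _)) , X.sign-unique yx

      xᵇ yᵇ : Bool → Fin n
      xᵇ i = if i then x else ε
      yᵇ j = if j then y else ε

      sign-xᵇ : ∀ i → Y.sign (xᵇ i) ≡ i × X.sign (xᵇ i) ≡ false
      sign-xᵇ true  = sign-x
      sign-xᵇ false = Centralizer-ε

      sign-yᵇ : ∀ j → Y.sign (yᵇ j) ≡ false × X.sign (yᵇ j) ≡ j
      sign-yᵇ true  = sign-y
      sign-yᵇ false = Centralizer-ε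

      square-xᵇ : ∀ i i′ → xᵇ i ∙ xᵇ i′ ≡ twist (i ∧ i′) ∙ xᵇ (i ⊻ i′)
      square-xᵇ false i′    = refl
      square-xᵇ true  false = trans (identityʳ x) (sym (identityˡ x))
      square-xᵇ true  true  = trans x² (sym (identityʳ z))

      square-yᵇ : ∀ j j′ → yᵇ j ∙ yᵇ j′ ≡ twist (j ∧ j′) ∙ yᵇ (j ⊻ j′)
      square-yᵇ false j′    = refl
      square-yᵇ true  false = trans (identityʳ y) (sym (identityˡ y))
      square-yᵇ true  true  = trans y² (sym (identityʳ z))

      swap-ᵇ : ∀ j i → yᵇ j ∙ xᵇ i ≡ twist (j ∧ i) ∙ (xᵇ i ∙ yᵇ j)
      swap-ᵇ false i     = trans (Commute-ε {xᵇ i}) (sym (identityˡ _))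
      swap-ᵇ true  false = trans (sym (Commute-ε {y})) (sym (identityˡ _))
      swap-ᵇ true  true  = yx

      quaternion-∙ : ∀ i j i′ j′ →
        (xᵇ i ∙ yᵇ j) ∙ (xᵇ i′ ∙ yᵇ j′) ≡ (xᵇ (i ⊻ i′) ∙ yᵇ (j ⊻ j′)) ∙ twist (cocycle i j i′ j′)
      quaternion-∙ i j i′ j′ = begin
        (X₁ ∙ Y₁) ∙ (X₂ ∙ Y₂)
          ≡⟨ solve 4 (λ X₁ Y₁ X₂ Y₂ → (X₁ ⊕ Y₁) ⊕ (X₂ ⊕ Y₂) ⊜ X₁ ⊕ ((Y₁ ⊕ X₂) ⊕ Y₂)) refl X₁ Y₁ X₂ Y₂ ⟩
        X₁ ∙ ((Y₁ ∙ X₂) ∙ Y₂)                ≡⟨ cong (λ d → X₁ ∙ (d ∙ Y₂)) (swap-ᵇ j i′) ⟩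
        X₁ ∙ ((r ∙ (X₂ ∙ Y₁)) ∙ Y₂)
          ≡⟨ solve 5 (λ X₁ Y₁ X₂ Y₂ r → X₁ ⊕ ((r ⊕ (X₂ ⊕ Y₁)) ⊕ Y₂) ⊜ (X₁ ⊕ r) ⊕ (X₂ ⊕ (Y₁ ⊕ Y₂))) refl X₁ Y₁ X₂ Y₂ r ⟩
        (X₁ ∙ r) ∙ (X₂ ∙ (Y₁ ∙ Y₂))
          ≡⟨ cong₂ (λ d e → d ∙ (X₂ ∙ e)) (sym (twist-central (j ∧ i′) X₁)) (square-yᵇ j j′) ⟩
        (r ∙ X₁) ∙ (X₂ ∙ (t ∙ Y₃))
          ≡⟨ solve 5 (λ r X₁ X₂ t Y → (r ⊕ X₁) ⊕ (X₂ ⊕ (t ⊕ Y)) ⊜ r ⊕ ((X₁ ⊕ X₂) ⊕ (t ⊕ Y))) refl r X₁ X₂ t Y₃ ⟩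
        r ∙ ((X₁ ∙ X₂) ∙ (t ∙ Y₃))
          ≡⟨ cong₂ (λ d e → r ∙ (d ∙ e)) (square-xᵇ i i′) (twist-central (j ∧ j′) Y₃) ⟩
        r ∙ ((s ∙ X₃) ∙ (Y₃ ∙ t))
          ≡⟨ solve 5 (λ r s X t Y → r ⊕ ((s ⊕ X) ⊕ (Y ⊕ t)) ⊜ (r ⊕ (s ⊕ (X ⊕ Y))) ⊕ t) refl r s X₃ t Y₃ ⟩
        (r ∙ (s ∙ (X₃ ∙ Y₃))) ∙ t            ≡⟨ cong (λ d → (r ∙ d) ∙ t) (twist-central (i ∧ i′) (X₃ ∙ Y₃)) ⟩
        (r ∙ ((X₃ ∙ Y₃) ∙ s)) ∙ t            ≡⟨ cong (_∙ t) (twist-central (j ∧ i′) _) ⟩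
        (((X₃ ∙ Y₃) ∙ s) ∙ r) ∙ t
          ≡⟨ cong (_∙ t) (trans (assoc _ s r) (cong ((X₃ ∙ Y₃) ∙_) (twist-central (i ∧ i′) r))) ⟩
        ((X₃ ∙ Y₃) ∙ (r ∙ s)) ∙ t
          ≡⟨ solve 4 (λ W r s t → (W ⊕ (r ⊕ s)) ⊕ t ⊜ W ⊕ (r ⊕ (s ⊕ t))) refl (X₃ ∙ Y₃) r s t ⟩
        (X₃ ∙ Y₃) ∙ (r ∙ (s ∙ t))
          ≡⟨ cong (λ d → (X₃ ∙ Y₃) ∙ (r ∙ d)) (twist-xor (i ∧ i′) (j ∧ j′)) ⟨
        (X₃ ∙ Y₃) ∙ (r ∙ twist ((i ∧ i′) ⊻ (j ∧ j′)))
          ≡⟨ cong ((X₃ ∙ Y₃) ∙_) (twist-xor (j ∧ i′) ((i ∧ i′) ⊻ (j ∧ j′))) ⟨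
        (X₃ ∙ Y₃) ∙ twist (cocycle i j i′ j′) ∎
        where
        X₁ = xᵇ i
        X₂ = xᵇ i′
        X₃ = xᵇ (i ⊻ i′)
        Y₁ = yᵇ j
        Y₂ = yᵇ j′
        Y₃ = yᵇ (j ⊻ j′)
        r = twist (j ∧ i′)
        s = twist (i ∧ i′)
        t = twist (j ∧ j′)

      base core : Fin n → Fin n
      base g = xᵇ (Y.sign g) ∙ yᵇ (X.sign g)
      core g = (base g ⁻¹) ∙ g

      base-core : ∀ g → base g ∙ core g ≡ g
      base-core g = trans (sym (assoc _ _ g)) (trans (cong (_∙ g) (inverseʳ (base g))) (identityˡ g))

      xor-cancel : ∀ {a b} → a ⊻ b ≡ a → b ≡ false
      xor-cancel {false} eq = eq
      xor-cancel {true} {false} eq = refl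

      -- `base g` has both signs in common with `g`, and the signs are homomorphisms.
      core∈ : ∀ g → Centralizer (core g)
      core∈ g =
        xor-cancel {Y.sign g} (begin
          Y.sign g ⊻ Y.sign (core g)
            ≡⟨ cong (_⊻ Y.sign (core g)) (trans (Y.sign-∙ _ _)
                 (trans (cong₂ _⊻_ (proj₁ (sign-xᵇ (Y.sign g))) (proj₁ (sign-yᵇ (X.sign g)))) (xor-identityʳ (Y.sign g)))) ⟨
          Y.sign (base g) ⊻ Y.sign (core g)   ≡⟨ Y.sign-∙ (base g) (core g) ⟨
          Y.sign (base g ∙ core g)              ≡⟨ cong Y.sign (base-core g) ⟩
          Y.sign g                              ∎) ,
        xor-cancel {X.sign g} (begin
          X.sign g ⊻ X.sign (core g)
            ≡⟨ cong (_⊻ X.sign (core g)) (trans (X.sign-∙ _ _)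
                 (cong₂ _⊻_ (proj₂ (sign-xᵇ (Y.sign g))) (proj₂ (sign-yᵇ (X.sign g))))) ⟨
          X.sign (base g) ⊻ X.sign (core g)   ≡⟨ X.sign-∙ (base g) (core g) ⟨
          X.sign (base g ∙ core g)              ≡⟨ cong X.sign (base-core g) ⟩
          X.sign g                              ∎)

      base-∙-Centralizer : ∀ i j {c} → Centralizer c → Commute (xᵇ i ∙ yᵇ j) c
      base-∙-Centralizer i j {c} Cc = Commute-∙ (x-c i) (y-c j)
        where
        x-c : ∀ i → Commute (xᵇ i) c
        x-c true  = sym (centralizes-x Cc)
        x-c false = Commute-ε
        y-c : ∀ j → Commute (yᵇ j) c
        y-c true  = sym (centralizes-y Cc)
        y-c false = Commute-ε

      core-product : ∀ g h →
        core (g ∙ h) ≡ (core g ∙ core h) ∙ twist (cocycle (Y.sign g) (X.sign g) (Y.sign h) (X.sign h))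
      core-product g h = ∙-cancelˡ (base (g ∙ h)) _ _ (begin
        base (g ∙ h) ∙ core (g ∙ h)                   ≡⟨ base-core (g ∙ h) ⟩
        g ∙ h                                         ≡⟨ cong₂ _∙_ (base-core g) (base-core h) ⟨
        (base g ∙ core g) ∙ (base h ∙ core h)
          ≡⟨ solve 4 (λ a b c d → (a ⊕ b) ⊕ (c ⊕ d) ⊜ a ⊕ ((b ⊕ c) ⊕ d)) refl (base g) (core g) (base h) (core h) ⟩
        base g ∙ ((core g ∙ base h) ∙ core h)
          ≡⟨ cong (λ d → base g ∙ (d ∙ core h)) (base-∙-Centralizer (Y.sign h) (X.sign h) (core∈ g)) ⟨
        base g ∙ ((base h ∙ core g) ∙ core h)
          ≡⟨ solve 4 (λ a b c d → a ⊕ ((c ⊕ b) ⊕ d) ⊜ (a ⊕ c) ⊕ (b ⊕ d)) refl (base g) (core g) (base h) (core h) ⟩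
        (base g ∙ base h) ∙ (core g ∙ core h)
          ≡⟨ cong (_∙ (core g ∙ core h)) (quaternion-∙ (Y.sign g) (X.sign g) (Y.sign h) (X.sign h)) ⟩
        (base′ ∙ t) ∙ (core g ∙ core h)               ≡⟨ assoc _ _ _ ⟩
        base′ ∙ (t ∙ (core g ∙ core h))
          ≡⟨ cong₂ _∙_ (cong₂ (λ i j → xᵇ i ∙ yᵇ j) (sym (Y.sign-∙ g h)) (sym (X.sign-∙ g h))) (twist-central _ _) ⟩
        base (g ∙ h) ∙ ((core g ∙ core h) ∙ t)        ∎)
        where
        base′ = xᵇ (Y.sign g ⊻ Y.sign h) ∙ yᵇ (X.sign g ⊻ X.sign h)
        t = twist (cocycle (Y.sign g) (X.sign g) (Y.sign h) (X.sign h))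

      Centralizer-⁻¹ : ∀ {g} → Centralizer g → Centralizer (g ⁻¹)
      Centralizer-⁻¹ {g} (yg , xg) =
        trans (cong (_⊻ Y.sign (g ⁻¹)) (sym yg)) (trans (sym (Y.sign-∙ g (g ⁻¹)))
          (trans (cong Y.sign (inverseʳ g)) (proj₁ Centralizer-ε))) ,
        trans (cong (_⊻ X.sign (g ⁻¹)) (sym xg)) (trans (sym (X.sign-∙ g (g ⁻¹)))
          (trans (cong X.sign (inverseʳ g)) (proj₂ Centralizer-ε)))

      C : Enumeration Centralizer
      C = enumerate λ g → (Y.sign g ≟ᵇ false) ×-dec (X.sign g ≟ᵇ false)

      open Enumeration C

      coreAdd : Fin size → Fin size → Fin size
      coreAdd i j = index (Centralizer-∙ (element∈ i) (element∈ j))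

      coreNeg : Fin size → Fin size
      coreNeg i = index (Centralizer-⁻¹ (element∈ i))

      C-isAbelianGroup : IsAbelianGroup _≡_ coreAdd (index Centralizer-ε) coreNeg
      C-isAbelianGroup = record
        { isGroup = GroupMonomorphism.isGroup {G₁ = C-rawGroup} {G₂ = Group.rawGroup G} {⟦_⟧ = element} (record
            { isGroupHomomorphism = record
              { isMonoidHomomorphism = record
                { isMagmaHomomorphism = record
                  { isRelHomomorphism = record { cong = cong element }
                  ; homo = λ i j → element-index _
                  }
                ; ε-homo = element-index _
                }
              ; ⁻¹-homo = λ i → element-index _
              }
            ; injective = injects
            }) isGroup
        ; comm = λ i j → injects (trans (element-index _)
            (trans (centralizer-abelian (element∈ i) (element∈ j)) (sym (element-index _))))
        }
        where
        C-rawGroup : RawGroup _ _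
        C-rawGroup = record { Carrier = Fin size ; _≈_ = _≡_ ; _∙_ = coreAdd ; ε = index Centralizer-ε ; _⁻¹ = coreNeg }

      twist∈ : ∀ b → Centralizer (twist b)
      twist∈ false = Centralizer-ε
      twist∈ true  = Y.sign-unique (trans z-y (sym (identityˡ _))) , X.sign-unique (trans z-x (sym (identityˡ _)))

      -- The centralizer and its coset by `x` are told apart by `Y.sign`. The factor 2 pays for the
      -- spare bit of a field, so that every single field fits into one word.
      2*size≤n : 2 * size ≤ n
      2*size≤n = Fin.injective⇒≤ {f = f} f-injective
        where
        row : Fin (2 * size) → Fin 2
        row q = proj₁ (Fin.remQuot {2} size q)
        boolean : Fin 2 → Bool
        boolean Fin.zero    = false
        boolean (Fin.suc _) = true
        boolean-injective : ∀ {i j} → boolean i ≡ boolean j → i ≡ j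
        boolean-injective {Fin.zero}         {Fin.zero}         _ = refl
        boolean-injective {Fin.suc Fin.zero} {Fin.suc Fin.zero} _ = refl
        side : Fin (2 * size) → Bool
        side q = boolean (row q)
        part : Fin (2 * size) → Fin size
        part q = proj₂ (Fin.remQuot {2} size q)
        f : Fin (2 * size) → Fin n
        f q = xᵇ (side q) ∙ element (part q)
        side≡ : ∀ q → Y.sign (f q) ≡ side q
        side≡ q = trans (Y.sign-∙ _ _) (trans (cong₂ _⊻_ (proj₁ (sign-xᵇ (side q))) (proj₁ (element∈ (part q))))
          (xor-identityʳ _))
        f-injective : ∀ {q r} → f q ≡ f r → q ≡ r
        f-injective {q} {r} eq = trans (sym (Fin.combine-remQuot {2} size q)) (trans
          (cong₂ (Fin.combine {2} {size}) (boolean-injective side-eq)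
            (injects (∙-cancelˡ (xᵇ (side r)) _ _ (trans (cong (λ b → xᵇ b ∙ element (part q)) (sym side-eq)) eq))))
          (Fin.combine-remQuot {2} size r))
          where
          side-eq : side q ≡ side r
          side-eq = trans (sym (side≡ q)) (trans (cong Y.sign eq) (side≡ r))

      extension : QuaternionExtension _∙_
      extension = record
        { coreSize       = size
        ; _⊕_            = coreAdd
        ; 𝟎              = index Centralizer-ε
        ; ζ              = index (twist∈ true)
        ; ⊝_             = coreNeg
        ; isAbelianGroup = C-isAbelianGroup
        ; bitˣ           = Y.sign
        ; bitʸ           = X.sign
        ; core           = λ g → index (core∈ g)
        ; bitˣ-∙         = Y.sign-∙
        ; bitʸ-∙         = X.sign-∙
        ; core-∙         = λ g h → injects (begin
            element (index (core∈ (g ∙ h)))   ≡⟨ element-index _ ⟩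
            core (g ∙ h)                      ≡⟨ core-product g h ⟩
            (core g ∙ core h) ∙ twist (cocycle (Y.sign g) (X.sign g) (Y.sign h) (X.sign h))
              ≡⟨ cong₂ _∙_ (trans (cong₂ _∙_ (sym (element-index (core∈ g))) (sym (element-index (core∈ h))))
                                  (sym (element-index _)))
                           (sym (element-twist (cocycle (Y.sign g) (X.sign g) (Y.sign h) (X.sign h)))) ⟩
            element (coreAdd (index (core∈ g)) (index (core∈ h))) ∙
            element (twistIndex (cocycle (Y.sign g) (X.sign g) (Y.sign h) (X.sign h)))
              ≡⟨ element-index _ ⟨
            element (coreAdd (coreAdd (index (core∈ g)) (index (core∈ h)))
                             (twistIndex (cocycle (Y.sign g) (X.sign g) (Y.sign h) (X.sign h)))) ∎)
        ; injective      = λ {g} {h} ˣ≡ ʸ≡ c≡ → begin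
            g                   ≡⟨ base-core g ⟨
            base g ∙ core g
              ≡⟨ cong₂ _∙_ (cong₂ (λ i j → xᵇ i ∙ yᵇ j) ˣ≡ ʸ≡)
                           (trans (sym (element-index (core∈ g))) (trans (cong element c≡) (element-index (core∈ h)))) ⟩
            base h ∙ core h     ≡⟨ base-core h ⟩
            h                   ∎
        ; 2*coreSize≤n   = 2*size≤n
        }
        where
        twistIndex : Bool → Fin size
        twistIndex b = if b then index (twist∈ true) else index Centralizer-ε
        element-twist : ∀ b → element (twistIndex b) ≡ twist b
        element-twist true  = element-index _
        element-twist false = element-index _

    quaternion-extension : ¬ (∀ a b → a ∙ b ≡ b ∙ a) → QuaternionExtension _∙_
    quaternion-extension ¬comm with Fin.¬∀⟶∃¬ n _ (λ a → Fin.all? λ b → a ∙ b Fin.≟ b ∙ a) ¬comm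
    ... | a , ¬comm-a with Fin.¬∀⟶∃¬ n _ (λ b → a ∙ b Fin.≟ b ∙ a) ¬comm-a
    ...   | b , ¬ab = build (square-root S-ε S-∙ (proj₂ (nonabelian⇒involution {λ _ → ⊤} S-ε S-∙ tt tt ¬ab)))
      where
      S-ε : ⊤
      S-ε = tt
      S-∙ : ⊤ → ⊤ → ⊤
      S-∙ _ _ = tt
      build : QuaternionGenerators → QuaternionExtension _∙_
      build (x , y , z , x² , y² , z² , z≢ε , yx) = Quaternion.extension x² y² z² z≢ε yx

-- The query program

-- Cells 0–4 and 5–9 hold the labels of the factors, 10–12 the code of ζ, 13–24 the
-- constants of the three packings; the other cells are working space.
addBlock : (dst src gap : ℕ) → Program
addBlock dst src gap =
  binaryOp add 26 dst src ∷
  binaryOp add 26 26 gap ∷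
  binaryOp and 27 26 (1 + gap) ∷
  unaryOp bit-reverse 28 27 ∷
  binaryOp add 28 28 (2 + gap) ∷
  unaryOp bit-reverse 28 28 ∷
  binaryOp xor 28 28 (3 + gap) ∷
  binaryOp and 28 gap 28 ∷
  binaryOp or 28 27 28 ∷
  binaryOp sub dst 26 28 ∷ []

-- After the first addition the cell `7 + k` of the second factor is free. It receives the code of
-- `ζ` masked by the sign word in cell 25, the second summand to be added.
coreBlock : ℕ → Program
coreBlock k =
  addBlock (2 + k) (7 + k) (13 + 4 * k) List.++
  binaryOp and (7 + k) (10 + k) 25 ∷
  addBlock (2 + k) (7 + k) (13 + 4 * k)

-- Cell 25 receives the cocycle before cells 0 and 1 are overwritten by the bits of the product.
multiply : Program
multiply =
  binaryOp and 25 1 5 ∷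
  binaryOp and 26 0 5 ∷
  binaryOp and 27 1 6 ∷
  binaryOp xor 26 26 27 ∷
  binaryOp xor 25 25 26 ∷
  binaryOp xor 0 0 5 ∷
  binaryOp xor 1 1 6 ∷
  coreBlock 0 List.++ coreBlock 1 List.++ coreBlock 2 List.++ halt ∷ []

-- `spread` is stored reversed, as it is only ever added to a reversed word.
stored : ∀ {w} → Constants w → Vec (Word w) 4
stored c = Constants.gap c ∷ Constants.top c ∷ reverse (Constants.spread c) ∷ Constants.keep c ∷ []

cocycleWord : ∀ {w} → (i j i′ j′ : Word w) → Word w
cocycleWord i j i′ j′ = zipWith _⊻_ (zipWith _∧_ j i′) (zipWith _⊻_ (zipWith _∧_ i i′) (zipWith _∧_ j j′))

module _ {w} (i j x₁ x₂ x₃ i′ j′ y₁ y₂ y₃ ζ₁ ζ₂ ζ₃ : Word w) (c₁ c₂ c₃ : Constants w) (t₀ t₁ t₂ t₃ : Word w) where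

  private
    s = cocycleWord i j i′ j′

    product₁ : (c : Constants w) (x y ζ : Word w) → Word w
    product₁ c x y ζ = packedAdd c (packedAdd c x y) (zipWith _∧_ ζ s)

  run-multiply :
    Σ[ rest ∈ Vec (Word w) 5 ] Σ[ work ∈ Vec (Word w) 4 ]
      run multiply 71 0
        ((i ∷ j ∷ x₁ ∷ x₂ ∷ x₃ ∷ []) ++ ((i′ ∷ j′ ∷ y₁ ∷ y₂ ∷ y₃ ∷ []) ++
         ((ζ₁ ∷ ζ₂ ∷ ζ₃ ∷ stored c₁ ++ stored c₂ ++ stored c₃) ++ (t₀ ∷ t₁ ∷ t₂ ∷ t₃ ∷ []))))
      ≡ just ((zipWith _⊻_ i i′ ∷ zipWith _⊻_ j j′ ∷
               product₁ c₁ x₁ y₁ ζ₁ ∷ product₁ c₂ x₂ y₂ ζ₂ ∷ product₁ c₃ x₃ y₃ ζ₃ ∷ []) ++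
              (rest ++ ((ζ₁ ∷ ζ₂ ∷ ζ₃ ∷ stored c₁ ++ stored c₂ ++ stored c₃) ++ work)))
  -- Without jumps and indirect addresses the run evaluates on unknown words. The 71 instructions
  -- are 7 for the bits, 21 for each of the three core words, and the halt.
  run-multiply = (_ ∷ _ ∷ _ ∷ _ ∷ _ ∷ []) , (_ ∷ _ ∷ _ ∷ _ ∷ []) , refl

-- Packing residues into words

binary-level : ∀ {d} → 1 < d → ∃[ l ] 2 ^ l < d × d ≤ 2 ^ suc l
binary-level {suc zero}          (s≤s ())
binary-level {suc (suc zero)}    _ = 0 , s≤s (s≤s z≤n) , ≤-refl
binary-level {suc (suc (suc d))} _ with binary-level {suc (suc d)} (s≤s (s≤s z≤n))
... | l , 2^l<d , d≤ with m≤n⇒m<n∨m≡n d≤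
...   | inj₁ d< = l , m<n⇒m<1+n 2^l<d , d<
...   | inj₂ d≡ = suc l , subst (_< suc (suc (suc d))) d≡ (n<1+n _) ,
                  subst (λ e → suc e ≤ 2 ^ suc (suc l)) (sym d≡)
                    (subst (suc (2 ^ suc l) ≤_) (cong (2 ^ suc l +_) (sym (+-identityʳ _)))
                      (+-monoˡ-≤ (2 ^ suc l) (m^n>0 2 (suc l))))

module _ {A : Set} {_⊕_ : A → A → A} where

  private
    Coord : Set
    Coord = Coordinate _⊕_ (λ _ → ⊤)

  level width : Coord → ℕ
  level c = proj₁ (binary-level (modulus>1 c))
  width c = suc (suc (level c))

  totalWidth : List Coord → ℕ
  totalWidth cs = sum (List.map width cs)

  totalModulus : List Coord → ℕ
  totalModulus cs = product (List.map modulus cs)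

  -- With `q = 2 ^ level c`, the square of `q + 1` exceeds `4 * q` by the square of `q - 1`, and
  -- `q + 1` is at most the modulus.
  2^width≤ : ∀ c → 2 ^ width c ≤ modulus c * modulus c
  2^width≤ c = ≤-trans (subst (2 ^ width c ≤_) (arith q) (m≤m+n (2 ^ width c) ((q ∸ 1) * (q ∸ 1)))) (*-mono-≤ q<d q<d)
    where
    q = 2 ^ level c
    q<d : q < modulus c
    q<d = proj₁ (proj₂ (binary-level (modulus>1 c)))
    arith′ : ∀ p → 2 * (2 * suc p) + p * p ≡ suc (suc p) * suc (suc p)
    arith′ = solve-∀
    arith : ∀ q → {{NonZero q}} → 2 * (2 * q) + (q ∸ 1) * (q ∸ 1) ≡ suc q * suc q
    arith (suc p) = arith′ p
    instance
      q≢0 : NonZero q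
      q≢0 = m^n≢0 2 (level c)

  2^totalWidth≤ : ∀ cs → 2 ^ totalWidth cs ≤ totalModulus cs * totalModulus cs
  2^totalWidth≤ []       = ≤-refl
  2^totalWidth≤ (c ∷ cs) = begin
    2 ^ (width c + totalWidth cs)         ≡⟨ ^-distribˡ-+-* 2 (width c) (totalWidth cs) ⟩
    2 ^ width c * 2 ^ totalWidth cs       ≤⟨ *-mono-≤ (2^width≤ c) (2^totalWidth≤ cs) ⟩
    (d * d) * (t * t)                     ≡⟨ arith d t ⟩
    (d * t) * (d * t)                     ∎
    where
    open ≤-Reasoning
    d = modulus c
    t = totalModulus cs
    arith : ∀ d t → (d * d) * (t * t) ≡ (d * t) * (d * t)
    arith = solve-∀

  totalModulus>0 : ∀ cs → 0 < totalModulus cs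
  totalModulus>0 []       = z<s
  totalModulus>0 (c ∷ cs) = *-mono-≤ (<⇒≤ (modulus>1 c)) (totalModulus>0 cs)

  modulus≤total : ∀ cs → All (λ c → modulus c ≤ totalModulus cs) cs
  modulus≤total []       = []
  modulus≤total (c ∷ cs) =
    m≤m*n (modulus c) (totalModulus cs) {{>-nonZero (totalModulus>0 cs)}} ∷
    All.map (λ ≤t → ≤-trans ≤t (m≤n*m (totalModulus cs) (modulus c) {{>-nonZero (<⇒≤ (modulus>1 c))}})) (modulus≤total cs)

  record Packing (w : ℕ) (cs : List Coord) : Set where
    field
      consts     : Constants w
      encode     : A → Word w
      adds       : ∀ x y → Adds consts (encode x) (encode y) (encode (x ⊕ y))
      idempotent : ∀ {e} → e ⊕ e ≡ e → encode e ≡ zeros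
      separate   : ∀ {x y} → encode x ≡ encode y → All (λ c → coord c x ≡ coord c y) cs

  -- Idempotence identifies the zero element using the operation alone. A reduction in `e ⊕ e` would
  -- make the coordinate equal to the modulus.
  coord-idempotent : ∀ (c : Coord) {e} → e ⊕ e ≡ e → coord c e ≡ 0
  coord-idempotent c {e} eq with additive c {e} {e} tt tt
  ... | inj₁ same = m+n≡n⇒m≡0 (trans same (cong (coord c) eq))
    where
    m+n≡n⇒m≡0 : ∀ {m n} → m + n ≡ n → m ≡ 0
    m+n≡n⇒m≡0 {m} {n} eq = +-cancelʳ-≡ n m 0 eq
  ... | inj₂ more = contradiction (+-cancelˡ-≡ (coord c e) _ _ (trans more (cong (λ x → coord c x + modulus c) eq)))
                                  (<⇒≢ (coord< c e))

  zeros-++ : ∀ v {w} → zeros {v} ++ zeros {w} ≡ zeros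
  zeros-++ zero    = refl
  zeros-++ (suc v) = cong (false ∷_) (zeros-++ v)

  digit-0 : ∀ l → digit l 0 ≡ zeros
  digit-0 zero    = refl
  digit-0 (suc l) = cong (false ∷_) (digit-0 l)

  prepend : ∀ {w cs} c → Packing w cs → Packing (width c + w) (c ∷ cs)
  prepend {w} {cs} c P = record
    { consts     = fieldConstants (modulus c) l ⊹ consts
    ; encode     = λ x → digit (suc l) (coord c x) ++ encode x
    ; adds       = λ x y → Adds-++
        (Adds-field (<⇒≤ (modulus>1 c)) d≤ (coord< c x) (coord< c y) (coord< c (x ⊕ y)) (additive c tt tt))
        (adds x y)
    ; idempotent = λ eq → trans (cong₂ _++_ (trans (cong (digit (suc l)) (coord-idempotent c eq)) (digit-0 (suc l)))
                                           (idempotent eq))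
                                (zeros-++ (width c))
    ; separate   = λ {x} {y} eq → let ≡ˡ , ≡ʳ = ++-injective _ _ eq in
        digit-injective (suc l) (<-≤-trans (coord< c x) d≤) (<-≤-trans (coord< c y) d≤) ≡ˡ ∷ separate ≡ʳ
    }
    where
    open Packing P
    l = level c
    d≤ : modulus c ≤ 2 ^ suc l
    d≤ = proj₂ (proj₂ (binary-level (modulus>1 c)))

  pack : ∀ w cs → totalWidth cs ≤ w → Packing w cs
  pack w []       _ = record
    { consts = padding ; encode = λ _ → zeros ; adds = λ _ _ → Adds-padding ; idempotent = λ _ → refl ; separate = λ _ → [] }
  pack w (c ∷ cs) ≤w = subst (λ v → Packing v (c ∷ cs)) (m+[n∸m]≡n (m+n≤o⇒m≤o (width c) ≤w))
    (prepend c (pack (w ∸ width c) cs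
      (subst (_≤ w ∸ width c) (m+n∸m≡n (width c) (totalWidth cs)) (∸-monoˡ-≤ (width c) ≤w))))

  fill : ∀ room cs → totalWidth cs ≤ room ⊎
    ∃[ pre ] ∃[ c ] ∃[ post ] cs ≡ pre List.++ c ∷ post × totalWidth pre ≤ room × room < totalWidth pre + width c
  fill room []       = inj₁ z≤n
  fill room (c ∷ cs) with width c ≤? room
  ... | no  c≰ = inj₂ ([] , c , cs , refl , z≤n , ≰⇒> c≰)
  ... | yes c≤ with fill (room ∸ width c) cs
  ...   | inj₁ fits = inj₁ (subst (totalWidth (c ∷ cs) ≤_) (m+[n∸m]≡n c≤) (+-monoʳ-≤ (width c) fits))
  ...   | inj₂ (pre , c′ , post , refl , fits , overflow) = inj₂ (c ∷ pre , c′ , post , refl ,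
      subst (totalWidth (c ∷ pre) ≤_) (m+[n∸m]≡n c≤) (+-monoʳ-≤ (width c) fits) ,
      subst₂ _<_ (m+[n∸m]≡n c≤) (sym (+-assoc (width c) (totalWidth pre) (width c′))) (+-monoʳ-< (width c) overflow))

  record Packing₃ (w : ℕ) (cs : List Coord) : Set where
    field
      {cs₁ cs₂ cs₃} : List Coord
      split : cs ≡ cs₁ List.++ cs₂ List.++ cs₃
      P₁ : Packing w cs₁
      P₂ : Packing w cs₂
      P₃ : Packing w cs₃

  pack₃ : ∀ {w} cs → totalWidth cs ≤ w + w → All (λ c → width c ≤ w) cs → Packing₃ w cs
  pack₃ {w} cs total≤ widths≤ with fill w cs
  ... | inj₁ fits = record
    { split = sym (List.++-identityʳ cs) ; P₁ = pack w cs fits ; P₂ = pack w [] z≤n ; P₃ = pack w [] z≤n }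
  ... | inj₂ (pre , c , post , refl , fits , overflow) = record
    { split = refl
    ; P₁ = pack w pre fits
    ; P₂ = pack w (c ∷ []) (subst (_≤ w) (sym (+-identityʳ (width c))) (All.head (All.++⁻ʳ pre widths≤)))
    -- The fields up to and including `c` take more than `w` of the at most `w + w` bits.
    ; P₃ = pack w post (<⇒≤ (+-cancelˡ-< w _ _ (begin-strict
        w + totalWidth post                              <⟨ +-monoˡ-< (totalWidth post) overflow ⟩
        totalWidth pre + width c + totalWidth post
          ≡⟨ +-assoc (totalWidth pre) (width c) (totalWidth post) ⟩
        totalWidth pre + totalWidth (c ∷ post)
          ≡⟨ sum-++ (List.map width pre) (List.map width (c ∷ post)) ⟨
        sum (List.map width pre List.++ List.map width (c ∷ post))
          ≡⟨ cong sum (List.map-++ width pre (c ∷ post)) ⟨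
        totalWidth (pre List.++ c ∷ post)                ≤⟨ total≤ ⟩
        w + w                                            ∎)))
    }
    where open ≤-Reasoning

  pack-coordinates : ∀ {w} cs → 2 * totalModulus cs < 2 ^ w → Packing₃ w cs
  pack-coordinates {w} cs 2t< = pack₃ cs (≮⇒≥ not-wider) (All.map (λ {c} → narrow c) (modulus≤total cs))
    where
    t = totalModulus cs
    not-wider : ¬ w + w < totalWidth cs
    not-wider wider = <⇒≱ (begin-strict
      t * t                     ≤⟨ *-mono-≤ t≤ t≤ ⟩
      2 ^ w * 2 ^ w             ≡⟨ ^-distribˡ-+-* 2 w w ⟨
      2 ^ (w + w)               <⟨ ^-monoʳ-< 2 (s≤s (s≤s z≤n)) wider ⟩
      2 ^ totalWidth cs         ∎) (2^totalWidth≤ cs)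
      where
      open ≤-Reasoning
      t≤ : t ≤ 2 ^ w
      t≤ = ≤-trans (m≤n*m t 2) (<⇒≤ 2t<)
    -- `2 ^ suc (level c)` is at most `2 * t`, hence strictly below `2 ^ w`; the strictness leaves
    -- room for the top bit.
    narrow : ∀ c → modulus c ≤ t → width c ≤ w
    narrow c d≤t = ^-cancelʳ-<-2 (≤-<-trans (*-monoʳ-≤ 2
      (≤-trans (<⇒≤ (proj₁ (proj₂ (binary-level (modulus>1 c))))) d≤t)) 2t<)
      where
      ^-cancelʳ-<-2 : 2 ^ suc (level c) < 2 ^ w → suc (level c) < w
      ^-cancelʳ-<-2 2^< = ≰⇒> λ w≤ → <⇒≱ 2^< (^-monoʳ-≤ 2 w≤)

-- Transfer along the enumeration and assembly of the representation

module Transported {c ℓ} (F : FiniteGroup c ℓ) where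
  private
    module F = FiniteGroup F
    module E = Inverse F.enumeration

  infixl 7 _∙_
  _∙_ : Fin F.order → Fin F.order → Fin F.order
  i ∙ j = E.to (E.from i F.∙ E.from j)

  ε : Fin F.order
  ε = E.to F.ε

  _⁻¹ : Fin F.order → Fin F.order
  i ⁻¹ = E.to (E.from i F.⁻¹)

  isGroup : IsGroup _≡_ _∙_ ε _⁻¹
  isGroup = GroupMonomorphism.isGroup {G₁ = raw} {G₂ = F.rawGroup} {⟦_⟧ = E.from} (record
    { isGroupHomomorphism = record
      { isMonoidHomomorphism = record
        { isMagmaHomomorphism = record
          { isRelHomomorphism = record { cong = E.from-cong }
          ; homo = λ i j → E.strictlyInverseʳ _
          }
        ; ε-homo = E.strictlyInverseʳ _
        }
      ; ⁻¹-homo = λ i → E.strictlyInverseʳ _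
      }
    ; injective = λ {i} {j} eq → trans (sym (E.strictlyInverseˡ i)) (trans (E.to-cong eq) (E.strictlyInverseˡ j))
    }) F.isGroup
    where
    raw : RawGroup _ _
    raw = record { Carrier = Fin F.order ; _≈_ = _≡_ ; _∙_ = _∙_ ; ε = ε ; _⁻¹ = _⁻¹ }

  to-∙ : ∀ x y → E.to (x F.∙ y) ≡ E.to x ∙ E.to y
  to-∙ x y = E.to-cong (F.∙-cong (F.sym (E.strictlyInverseʳ x)) (F.sym (E.strictlyInverseʳ y)))

  to-⁻¹ : ∀ x → E.to (x F.⁻¹) ≡ E.to x ⁻¹
  to-⁻¹ x = E.to-cong (F.⁻¹-cong (F.sym (E.strictlyInverseʳ x)))

  to-injective : ∀ {x y} → E.to x ≡ E.to y → x F.≈ y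
  to-injective {x} {y} eq = F.trans (F.sym (E.strictlyInverseʳ x)) (F.trans (E.from-cong eq) (E.strictlyInverseʳ y))

  open Dedekind isGroup using (_↑_; torsion; G)
  open Group G using (monoid; inverseʳ; inverseˡ; identityʳ; assoc)
  open MonoidMult monoid using (×-homo-+; ×-assocˡ)

  -- Natural exponents give inverses too, because every element has finite order. `Lift` places the
  -- predicate at the level over which `IsHamiltonian` quantifies.
  powers-subgroup : ∀ b → IsSubgroup F.group (λ x → Lift (c ⊔ˡ ℓ) (∃[ k ] E.to x ≡ b ↑ k))
  powers-subgroup b = record
    { resp-≈    = λ x≈y (lift (k , eq)) → lift (k , trans (sym (E.to-cong x≈y)) eq)
    ; ε-closed  = lift (0 , refl)
    ; ∙-closed  = λ {x} {y} (lift (k , x≡)) (lift (l , y≡)) →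
        lift (k + l , trans (to-∙ x y) (trans (cong₂ _∙_ x≡ y≡) (sym (×-homo-+ b k l))))
    ; ⁻¹-closed = λ {x} (lift (k , x≡)) → let N , bᴺ = torsion (b ↑ k) in
        lift (N * k , trans (to-⁻¹ x) (trans (cong _⁻¹ x≡) (trans (inverse-power N bᴺ) (×-assocˡ b N k))))
    }
    where
    inverse-power : ∀ {d} N → d ↑ suc N ≡ ε → d ⁻¹ ≡ d ↑ N
    inverse-power {d} N dᴺ = begin
      d ⁻¹                  ≡⟨ identityʳ _ ⟨
      d ⁻¹ ∙ ε              ≡⟨ cong (d ⁻¹ ∙_) dᴺ ⟨
      d ⁻¹ ∙ (d ∙ (d ↑ N))  ≡⟨ assoc _ _ _ ⟨
      (d ⁻¹ ∙ d) ∙ (d ↑ N)  ≡⟨ cong (_∙ (d ↑ N)) (inverseˡ d) ⟩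
      ε ∙ (d ↑ N)           ≡⟨ Group.identityˡ G _ ⟩
      d ↑ N                 ∎
      where open ≡-Reasoning

  dedekind : Hamiltonian F → ∀ a b → ∃[ k ] a ∙ b ≡ (b ↑ k) ∙ a
  dedekind (_ , normal) a b
    with normal _ (powers-subgroup b) (E.from a) {E.from b} (lift (1 , trans (E.strictlyInverseˡ b) (sym (identityʳ b))))
  ... | lift (k , eq) = k , (begin
    a ∙ b                     ≡⟨ identityʳ _ ⟨
    a ∙ b ∙ ε                 ≡⟨ cong (a ∙ b ∙_) (inverseˡ a) ⟨
    a ∙ b ∙ (a ⁻¹ ∙ a)        ≡⟨ assoc _ _ _ ⟨
    a ∙ b ∙ a ⁻¹ ∙ a          ≡⟨ cong (_∙ a) (trans (sym conjugate) eq) ⟩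
    (b ↑ k) ∙ a               ∎)
    where
    open ≡-Reasoning
    conjugate : E.to ((E.from a F.∙ E.from b) F.∙ E.from a F.⁻¹) ≡ a ∙ b ∙ a ⁻¹
    conjugate = trans (to-∙ _ _) (cong (a ∙ b ∙_) (trans (to-⁻¹ (E.from a)) (cong _⁻¹ (E.strictlyInverseˡ a))))

  noncommutative : Hamiltonian F → ¬ (∀ a b → a ∙ b ≡ b ∙ a)
  noncommutative (¬comm , _) comm = ¬comm λ x y →
    to-injective (trans (to-∙ x y) (trans (comm (E.to x) (E.to y)) (sym (to-∙ y x))))

  extension : Hamiltonian F → QuaternionExtension _∙_
  extension H = Dedekind.quaternion-extension isGroup (dedekind H) (noncommutative H)

-- An inhabitant of `Fin n` makes `n` positive, so `2 ^ w` exceeds 1 and words have at least one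
-- bit.
replicate-injective : ∀ {n w} {a b : Bool} → n < 2 ^ w → Fin n → replicate w a ≡ replicate w b → a ≡ b
replicate-injective {zero}          _        ()
replicate-injective {suc n} {zero}  (s≤s ()) _
replicate-injective {suc n} {suc w} _        _ eq = proj₁ (∷-injective eq)

cocycleWord-replicate : ∀ w i j i′ j′ →
  cocycleWord (replicate w i) (replicate w j) (replicate w i′) (replicate w j′) ≡ replicate w (cocycle i j i′ j′)
cocycleWord-replicate w i j i′ j′
  rewrite zipWith-replicate {n = w} _∧_ j i′ | zipWith-replicate {n = w} _∧_ i i′ | zipWith-replicate {n = w} _∧_ j j′
        | zipWith-replicate {n = w} _⊻_ (i ∧ i′) (j ∧ j′) = zipWith-replicate _⊻_ (j ∧ i′) ((i ∧ i′) ⊻ (j ∧ j′))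

record Coding {n} (w : ℕ) (_∙_ : Fin n → Fin n → Fin n) : Set where
  field
    code           : Fin n → Vec (Word w) 5
    form           : Vec (Word w) 15
    code-injective : ∀ {g h} → code g ≡ code h → g ≡ h
    correct        : ∀ g h (work : Vec (Word w) 4) →
      Σ[ rest ∈ Vec (Word w) 5 ] Σ[ work′ ∈ Vec (Word w) 4 ]
        run multiply 71 0 (code g ++ (code h ++ (form ++ work))) ≡ just (code (g ∙ h) ++ (rest ++ (form ++ work′)))

module Encoding {n w} {_∙_ : Fin n → Fin n → Fin n} (Q : QuaternionExtension _∙_) (n<2^w : n < 2 ^ w)
                {cs : List (Coordinate (QuaternionExtension._⊕_ Q) (λ _ → ⊤))} (packing : Packing₃ w cs)
                (separates : ∀ {x y} → All (λ c → Coordinate.coord c x ≡ Coordinate.coord c y) cs → x ≡ y) where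
  open QuaternionExtension Q
  open Packing₃ packing
  private
    module P₁ = Packing P₁
    module P₂ = Packing P₂
    module P₃ = Packing P₃

  separates₃ : ∀ {x y} → P₁.encode x ≡ P₁.encode y → P₂.encode x ≡ P₂.encode y → P₃.encode x ≡ P₃.encode y → x ≡ y
  separates₃ {x} {y} eq₁ eq₂ eq₃ = separates (subst (All (λ c → Coordinate.coord c x ≡ Coordinate.coord c y)) (sym split)
    (All.++⁺ (P₁.separate eq₁) (All.++⁺ (P₂.separate eq₂) (P₃.separate eq₃))))

  -- Each of the two bits fills a whole word, so that the cocycle computed from them is a mask: one
  -- `and` selects the code of `ζ` or zeros, the code of `𝟎`.
  code : Fin n → Vec (Word w) 5
  code g = replicate w (bitˣ g) ∷ replicate w (bitʸ g) ∷ P₁.encode (core g) ∷ P₂.encode (core g) ∷ P₃.encode (core g) ∷ []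

  form : Vec (Word w) 15
  form = P₁.encode ζ ∷ P₂.encode ζ ∷ P₃.encode ζ ∷ stored P₁.consts ++ stored P₂.consts ++ stored P₃.consts

  code-injective : ∀ {g h} → code g ≡ code h → g ≡ h
  code-injective {g} {h} eq = injective
    (replicate-injective n<2^w g (cong (λ v → lookup v 0F) eq)) (replicate-injective n<2^w g (cong (λ v → lookup v 1F) eq))
    (separates₃ {core g} {core h} (cong (λ v → lookup v 2F) eq) (cong (λ v → lookup v 3F) eq) (cong (λ v → lookup v 4F) eq))

  sign : (g h : Fin n) → Bool
  sign g h = cocycle (bitˣ g) (bitʸ g) (bitˣ h) (bitʸ h)

  signWord : (g h : Fin n) → Word w
  signWord g h = cocycleWord (replicate w (bitˣ g)) (replicate w (bitʸ g)) (replicate w (bitˣ h)) (replicate w (bitʸ h))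

  encode-product : ∀ {cs : List (Coordinate _⊕_ (λ _ → ⊤))} (P : Packing w cs) g h → let open Packing P in
    packedAdd consts (packedAdd consts (encode (core g)) (encode (core h))) (zipWith _∧_ (encode ζ) (signWord g h))
      ≡ encode (core (g ∙ h))
  encode-product P g h = begin
    packedAdd consts (packedAdd consts (encode (core g)) (encode (core h))) (zipWith _∧_ (encode ζ) (signWord g h))
      ≡⟨ cong₂ (packedAdd consts) (packedAdd-correct (adds (core g) (core h)))
           (trans (cong (zipWith _∧_ (encode ζ)) (cocycleWord-replicate w (bitˣ g) (bitʸ g) (bitˣ h) (bitʸ h)))
                  (select (sign g h))) ⟩
    packedAdd consts (encode (core g ⊕ core h)) (encode (if sign g h then ζ else 𝟎))
      ≡⟨ packedAdd-correct (adds (core g ⊕ core h) (if sign g h then ζ else 𝟎)) ⟩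
    encode (core g ⊕ core h ⊕ (if sign g h then ζ else 𝟎))
      ≡⟨ cong encode (core-∙ g h) ⟨
    encode (core (g ∙ h)) ∎
    where
    open ≡-Reasoning
    open Packing P
    select : ∀ b → zipWith _∧_ (encode ζ) (replicate w b) ≡ encode (if b then ζ else 𝟎)
    select true  = zipWith-identityʳ ∧-identityʳ (encode ζ)
    select false = trans (zipWith-zeroʳ ∧-zeroʳ (encode ζ)) (sym (idempotent (IsAbelianGroup.identityˡ isAbelianGroup 𝟎)))

  replicate-⊻ : ∀ {a b c} → c ≡ a ⊻ b → zipWith _⊻_ (replicate w a) (replicate w b) ≡ replicate w c
  replicate-⊻ {a} {b} eq = trans (zipWith-replicate _⊻_ a b) (cong (replicate w) (sym eq))

  correct : ∀ g h (work : Vec (Word w) 4) →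
    Σ[ rest ∈ Vec (Word w) 5 ] Σ[ work′ ∈ Vec (Word w) 4 ]
      run multiply 71 0 (code g ++ (code h ++ (form ++ work))) ≡ just (code (g ∙ h) ++ (rest ++ (form ++ work′)))
  correct g h (t₀ ∷ t₁ ∷ t₂ ∷ t₃ ∷ []) = rest , work′ , trans eq
    (cong (λ l → just (l ++ (rest ++ (form ++ work′))))
      (cong₂ _∷_ (replicate-⊻ (bitˣ-∙ g h)) (cong₂ _∷_ (replicate-⊻ (bitʸ-∙ g h))
        (cong₂ _∷_ (encode-product {cs₁} P₁ g h)
        (cong₂ _∷_ (encode-product {cs₂} P₂ g h) (cong (_∷ []) (encode-product {cs₃} P₃ g h)))))))
    where
    result = run-multiply
      (replicate w (bitˣ g)) (replicate w (bitʸ g)) (P₁.encode (core g)) (P₂.encode (core g)) (P₃.encode (core g))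
      (replicate w (bitˣ h)) (replicate w (bitʸ h)) (P₁.encode (core h)) (P₂.encode (core h)) (P₃.encode (core h))
      (P₁.encode ζ) (P₂.encode ζ) (P₃.encode ζ) P₁.consts P₂.consts P₃.consts t₀ t₁ t₂ t₃
    rest = proj₁ result
    work′ = proj₁ (proj₂ result)
    eq = proj₂ (proj₂ result)

coding : ∀ {n w} {_∙_ : Fin n → Fin n → Fin n} → QuaternionExtension _∙_ → n < 2 ^ w → Coding w _∙_
coding {n} {w} Q n<2^w = record
  { code = E.code ; form = E.form ; code-injective = E.code-injective ; correct = E.correct }
  where
  open QuaternionExtension Q using (isAbelianGroup; 2*coreSize≤n)
  A = FiniteAbelian.coordinates isAbelianGroup
  module E = Encoding {n} {w} Q n<2^w
    (pack-coordinates (proj₁ A) (≤-<-trans (*-monoʳ-≤ 2 (proj₁ (proj₂ A))) (≤-<-trans 2*coreSize≤n n<2^w)))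
    (proj₂ (proj₂ A))

module _ {c ℓ} (I : Input (Hamiltonian {c} {ℓ})) where
  open Input I using (finiteGroup; member; w; order<2^w; enumeration; Carrier; _≈_; _∙_)
  open Transported finiteGroup using (to-∙; to-injective; extension)
  open Inverse enumeration using (to; to-cong)

  opaque
    input-coding : Coding w (Transported._∙_ finiteGroup)
    input-coding = coding (extension member) order<2^w

  open Coding input-coding

  input-form : Vec (Word w) 15
  input-form = form

  input-label : Carrier → Vec (Word w) 5
  input-label x = code (to x)

  input-label-cong : ∀ {x y} → x ≈ y → input-label x ≡ input-label y
  input-label-cong x≈y = cong code (to-cong x≈y)

  input-label-injective : ∀ {x y} → input-label x ≡ input-label y → x ≈ y
  input-label-injective eq = to-injective (code-injective eq)

  input-correct : ∀ x y (work : Vec (Word w) 4) →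
    Σ[ rest ∈ Vec (Word w) 5 ] Σ[ work′ ∈ Vec (Word w) 4 ]
      run multiply 71 0 (input-label x ++ (input-label y ++ (form ++ work)))
      ≡ just (input-label (x ∙ y) ++ (rest ++ (form ++ work′)))
  input-correct x y work = subst (λ g → Σ[ rest ∈ Vec (Word w) 5 ] Σ[ work′ ∈ Vec (Word w) 4 ]
      run multiply 71 0 (code (to x) ++ (code (to y) ++ (form ++ work))) ≡ just (code g ++ (rest ++ (form ++ work′))))
    (sym (to-∙ x y)) (correct (to x) (to y) work)

representation : ∀ c ℓ → Representation (Hamiltonian {c} {ℓ})
representation c ℓ = record
  { query           = multiply
  ; formLength      = λ _ → 15
  ; labelLength     = λ _ → 5
  ; workLength      = λ _ → 4
  ; compress        = input-form
  ; label           = input-label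
  ; label-cong      = input-label-cong
  ; label-injective = input-label-injective
  ; time            = λ _ → 71
  ; correct         = input-correct
  }

theorem4 : ∀ (c ℓ : Level) →
    Σ[ R ∈ Representation (Hamiltonian {c} {ℓ}) ]
    Σ[ S ∈ ℕ ] Σ[ T ∈ ℕ ]
    (∀ (I : Input (Hamiltonian {c} {ℓ})) →
    Representation.space R I ≤ S × Representation.time R I ≤ T)
-- The cells are two labels of 5 words, the compressed form of 15 and 4 working cells.
theorem4 c ℓ = representation c ℓ , 29 , 71 , λ I → ≤-refl , ≤-refl
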